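{- Let $\mu$ be a diagram with $d$ boxes on the main diagonal. The Schur function $s_\mu(x)$ has the expansion $$s_\mu(x)=\sum_\lambda(-1)^{m(\lambda/\mu)}\det\big[e_{\lambda_i-\mu_j-i+j}(a_0,a_{ -1},\dots,a_{i-\lambda_i+1})\big]_{i,j=1}^d\;\det\big[h_{\lambda_i-\mu_j-i+j}(a_1,a_2,\dots,a_{i-\lambda_i})\big]_{i,j\geqslant d+1}\;\widehat s_\lambda(x\|a),$$ summed over diagrams $\lambda$ which contain $\mu$ and such that $\lambda$ has $d$ boxes on the main diagonal, where $m(\lambda/\mu)$ denotes the total number of boxes of $\lambda/\mu$ in rows $1,\dots,d$.
   Context: Let $a=(a_i)_{i\in\mathbb Z}$ be a sequence of commuting indeterminates and $\mathbb Q[a]$ the polynomial ring in the $a_i$; $x=(x_1,x_2,\dots)$; $\ell(\lambda)$ is the number of nonzero parts of $\lambda$. $h_k(\cdot)$ and $e_k(\cdot)$ are the usual complete and elementary symmetric polynomials in the indicated (possibly empty) finite set of variables, with $h_0=e_0=1$ and $h_k=e_k=0$ for $k<0$; an empty determinant is $1$. The second determinant may be taken over $d+1\leqslant i,j\leqslant N$ for any $N\geqslant\ell(\lambda)$, the value being independent of $N$. Dual Schur functions: let $\widehat\Lambda(x\|a)$ be the ring of formal (possibly infinite) sums $\sum_{\lambda}c_\lambda(a)s_\lambda(x)$, $c_\lambda(a)\in\mathbb Q[a]$, with $s_\lambda(x)$ the ordinary Schur functions. For a partition $\lambda$ with $d$ boxes on the main diagonal and $n\geqslant\ell(\lambda)$,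 $$\widehat s_\lambda(x_1,\dots,x_n\|a)=\frac{\det[A_{ij}]_{i,j=1}^n}{\prod_{1\leqslant i<j\leqslant n}(x_i-x_j)},$$ where $A_{ij}=\dfrac{x_i^{\lambda_j+n-j}}{(1-a_0x_i)(1-a_{ -1}x_i)\cdots(1-a_{j-\lambda_j}x_i)}$ for $1\leqslant j\leqslant d$ and $A_{ij}=x_i^{\lambda_j+n-j}(1-a_1x_i)\cdots(1-a_{j-\lambda_j-1}x_i)$ for $d<j\leqslant n$; it is $0$ if $\ell(\lambda)>n$. These are compatible with setting $x_n=0$ and define $\widehat s_\lambda(x\|a)\in\widehat\Lambda(x\|a)$. -}

module Defs where

open import Algebra.Bundles using (CommutativeRing)
open import Algebra.Structures using (IsCommutativeRing)
open import Data.Bool.Base using (if_then_else_)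
open import Data.Fin.Base as Fin using (Fin; zero; suc; toℕ; punchIn)
open import Data.Fin.Properties using (_<?_; <⇒≢)
open import Data.Integer.Base as ℤ using (ℤ; +_; -[1+_])
open import Data.List.Base as List
  using (List; []; _∷_; applyUpTo; length; filter; map; foldr; foldl; upTo; allFin; cartesianProduct)
open import Data.List.Relation.Binary.Subset.Propositional using () renaming (_⊆_ to _⊆ˡ_)
open import Data.List.Relation.Unary.All using (All; []; _∷_)
open import Data.List.Relation.Unary.All.Properties using (all-filter)
open import Data.List.Relation.Unary.Linked using (Linked)
open import Data.List.Relation.Unary.Unique.Propositional using (Unique)
open import Data.Nat.Base as ℕ using (ℕ; zero; suc; _≤_; _<_; _≥_; _∸_; s≤s; z≤n)
open import Data.Nat.ListAction using () renaming (sum to sumℕ)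
open import Data.Nat.Properties as ℕₚ using (_≤?_)
open import Data.Product.Base using (_×_; _,_; ∃; uncurry)
open import Data.Rational.Base as ℚ using (ℚ; 0ℚ; 1ℚ)
open import Data.Vec.Base as Vec using (Vec; []; _∷_; lookup; _[_]≔_)
open import Data.Vec.Properties using ([]≔-commutes; []≔-lookup)
open import Level using (Level; 0ℓ; _⊔_)
open import Relation.Binary.PropositionalEquality as ≡ using (_≡_; _≢_)
open import Relation.Nullary.Decidable using (does)

private
  variable
    c ℓ : Level

record Partition : Set where
  constructor mkPartition
  field
    parts     : List ℕ
    .sorted   : Linked _≥_ parts
    .positive : All (0 <_) parts

open Partition public

len : Partition → ℕ
len ν = length (parts ν)

nth : List ℕ → ℕ → ℕ
nth []       _       = 0
nth (p ∷ ps) zero    = p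
nth (p ∷ ps) (suc i) = nth ps i

-- Rows are numbered from 1; `row ν i` is 0 for i > len ν (and for the
-- meaningless index i = 0).
row : Partition → ℕ → ℕ
row ν zero    = 0
row ν (suc i) = nth (parts ν) i

infix 4 _⊆_
_⊆_ : Partition → Partition → Set
μ ⊆ ν = ∀ i → row μ i ≤ row ν i

-- The number of boxes (i , i), i ≥ 1, of the diagram.
diagonal : Partition → ℕ
diagonal ν = length (filter (λ i → suc i ≤? row ν (suc i)) (upTo (len ν)))

-- The number of boxes of ν/μ in rows 1, …, d, for μ ⊆ ν.
boxes : ℕ → Partition → Partition → ℕ
boxes d ν μ = sumℕ (map (λ i → row ν (suc i) ∸ row μ (suc i)) (upTo d))

-- The polynomial ring ℚ[a] = ℚ[…, a₋₁, a₀, a₁, …], constructed as the free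
-- commutative ℚ-algebra on ℤ: ring expressions modulo the congruence
-- generated by the axioms of commutative rings and the arithmetic of ℚ.

module Polynomials where

  infixl 6 _⊕_
  infixl 7 _⊗_
  infix  8 ⊝_
  infix  4 _≋_

  data Poly : Set where
    con     : ℚ → Poly
    var     : ℤ → Poly
    _⊕_ _⊗_ : Poly → Poly → Poly
    ⊝_      : Poly → Poly

  data _≋_ : Poly → Poly → Set where
    ≋-refl  : ∀ {p} → p ≋ p
    ≋-sym   : ∀ {p q} → p ≋ q → q ≋ p
    ≋-trans : ∀ {p q r} → p ≋ q → q ≋ r → p ≋ r

    ⊕-cong : ∀ {p p′ q q′} → p ≋ p′ → q ≋ q′ → p ⊕ q ≋ p′ ⊕ q′
    ⊗-cong : ∀ {p p′ q q′} → p ≋ p′ → q ≋ q′ → p ⊗ q ≋ p′ ⊗ q′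
    ⊝-cong : ∀ {p p′} → p ≋ p′ → ⊝ p ≋ ⊝ p′

    ⊕-assoc     : ∀ p q r → (p ⊕ q) ⊕ r ≋ p ⊕ (q ⊕ r)
    ⊕-comm      : ∀ p q → p ⊕ q ≋ q ⊕ p
    ⊕-identityˡ : ∀ p → con 0ℚ ⊕ p ≋ p
    ⊝-inverseˡ  : ∀ p → ⊝ p ⊕ p ≋ con 0ℚ
    ⊗-assoc     : ∀ p q r → (p ⊗ q) ⊗ r ≋ p ⊗ (q ⊗ r)
    ⊗-comm      : ∀ p q → p ⊗ q ≋ q ⊗ p
    ⊗-identityˡ : ∀ p → con 1ℚ ⊗ p ≋ p
    ⊗-distribˡ  : ∀ p q r → p ⊗ (q ⊕ r) ≋ p ⊗ q ⊕ p ⊗ r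

    con-⊕ : ∀ u v → con (u ℚ.+ v) ≋ con u ⊕ con v
    con-⊗ : ∀ u v → con (u ℚ.* v) ≋ con u ⊗ con v

  isCommutativeRing : IsCommutativeRing _≋_ _⊕_ _⊗_ ⊝_ (con 0ℚ) (con 1ℚ)
  isCommutativeRing = record
    { isRing = record
      { +-isAbelianGroup = record
        { isGroup = record
          { isMonoid = record
            { isSemigroup = record
              { isMagma = record
                { isEquivalence = record { refl = ≋-refl ; sym = ≋-sym ; trans = ≋-trans }
                ; ∙-cong = ⊕-cong
                }
              ; assoc = ⊕-assoc
              }
            ; identity = ⊕-identityˡ
                       , λ p → ≋-trans (⊕-comm p _) (⊕-identityˡ p)
            }
          ; inverse = ⊝-inverseˡ
                    , λ p → ≋-trans (⊕-comm p _) (⊝-inverseˡ p)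
          ; ⁻¹-cong = ⊝-cong
          }
        ; comm = ⊕-comm
        }
      ; *-cong = ⊗-cong
      ; *-assoc = ⊗-assoc
      ; *-identity = ⊗-identityˡ
                   , λ p → ≋-trans (⊗-comm p _) (⊗-identityˡ p)
      ; distrib = ⊗-distribˡ
                , λ p q r → ≋-trans (⊗-comm (q ⊕ r) p)
                    (≋-trans (⊗-distribˡ p q r) (⊕-cong (⊗-comm p q) (⊗-comm p r)))
      }
    ; *-comm = ⊗-comm
    }

ℚ[a] : CommutativeRing 0ℓ 0ℓ
ℚ[a] = record { isCommutativeRing = Polynomials.isCommutativeRing }

𝐚 : ℤ → CommutativeRing.Carrier ℚ[a]
𝐚 = Polynomials.var

module RingOps (R : CommutativeRing c ℓ) where

  open CommutativeRing R hiding (zero)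
  open import Algebra.Properties.Semiring.Exp semiring public using (_^_)
  open import Algebra.Properties.Semiring.Sum semiring public using (sum)

  Σᴸ Πᴸ : List Carrier → Carrier
  Σᴸ = foldr _+_ 0#
  Πᴸ = foldr _*_ 1#

  det : ∀ {n} → (Fin n → Fin n → Carrier) → Carrier
  det {zero}  M = 1#
  det {suc n} M = sum λ j →
    (- 1#) ^ toℕ j * M zero j * det (λ i k → M (suc i) (punchIn j k))

  -- In both recursions the first summand collects the monomials without the
  -- variable v, the second one those divisible by v.
  eℕ hℕ : ℕ → List Carrier → Carrier
  eℕ zero    vs       = 1#
  eℕ (suc k) []       = 0#
  eℕ (suc k) (v ∷ vs) = eℕ (suc k) vs + v * eℕ k vs
  hℕ zero    vs       = 1#
  hℕ (suc k) []       = 0#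
  hℕ (suc k) (v ∷ vs) = hℕ (suc k) vs + v * hℕ k (v ∷ vs)

  e h : ℤ → List Carrier → Carrier
  e (+ k)    vs = eℕ k vs
  e -[1+ _ ] vs = 0#
  h (+ k)    vs = hℕ k vs
  h -[1+ _ ] vs = 0#

module PowerSeries (R : CommutativeRing c ℓ) where

  open CommutativeRing R hiding (zero; ring)
  open RingOps R using (sum)
  open import Relation.Binary.Reasoning.Setoid setoid
  open import Algebra.Properties.CommutativeSemigroup +-commutativeSemigroup
    using (interchange; x∙yz≈y∙xz)

  infix  4 _≈ˢ_
  infixl 6 _+ˢ_
  infixl 7 _*ˢ_
  infix  8 -ˢ_

  _≈ˢ_ : (ℕ → Carrier) → (ℕ → Carrier) → Set ℓ
  f ≈ˢ g = ∀ k → f k ≈ g k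

  _+ˢ_ _*ˢ_ : (ℕ → Carrier) → (ℕ → Carrier) → ℕ → Carrier
  (f +ˢ g) k = f k + g k
  (f *ˢ g) k = sum {suc k} λ i → f (toℕ i) * g (k ∸ toℕ i)

  -ˢ_ : (ℕ → Carrier) → ℕ → Carrier
  (-ˢ f) k = - f k

  const : Carrier → ℕ → Carrier
  const r zero    = r
  const r (suc _) = 0#

  X : ℕ → Carrier
  X zero    = 0#
  X (suc k) = const 1# k

  tail : (ℕ → Carrier) → ℕ → Carrier
  tail f k = f (suc k)

  *ˢ-cong : ∀ {f f′ g g′} → f ≈ˢ f′ → g ≈ˢ g′ → f *ˢ g ≈ˢ f′ *ˢ g′
  *ˢ-cong p q zero    = +-congʳ (*-cong (p 0) (q 0))
  *ˢ-cong p q (suc k) = +-cong (*-cong (p 0) (q (suc k))) (*ˢ-cong (λ i → p (suc i)) q k)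

  *ˢ-snoc : ∀ f g k → (f *ˢ g) (suc k) ≈ (f *ˢ tail g) k + f (suc k) * g 0
  *ˢ-snoc f g zero = begin
    f 0 * g 1 + (f 1 * g 0 + 0#)  ≈⟨ +-congˡ (+-identityʳ _) ⟩
    f 0 * g 1 + f 1 * g 0         ≈⟨ +-congʳ (+-identityʳ _) ⟨
    f 0 * g 1 + 0# + f 1 * g 0    ∎
  *ˢ-snoc f g (suc k) = begin
    f 0 * g (suc (suc k)) + (tail f *ˢ g) (suc k)
      ≈⟨ +-congˡ (*ˢ-snoc (tail f) g k) ⟩
    f 0 * g (suc (suc k)) + ((tail f *ˢ tail g) k + f (suc (suc k)) * g 0)
      ≈⟨ +-assoc _ _ _ ⟨
    f 0 * g (suc (suc k)) + (tail f *ˢ tail g) k + f (suc (suc k)) * g 0 ∎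

  *ˢ-comm : ∀ f g → f *ˢ g ≈ˢ g *ˢ f
  *ˢ-comm f g zero    = +-congʳ (*-comm _ _)
  *ˢ-comm f g (suc k) = begin
    f 0 * g (suc k) + (tail f *ˢ g) k  ≈⟨ +-cong (*-comm _ _) (*ˢ-comm (tail f) g k) ⟩
    g (suc k) * f 0 + (g *ˢ tail f) k  ≈⟨ +-comm _ _ ⟩
    (g *ˢ tail f) k + g (suc k) * f 0  ≈⟨ *ˢ-snoc g f k ⟨
    (g *ˢ f) (suc k)                   ∎

  *ˢ-distribʳ : ∀ f g h → (g +ˢ h) *ˢ f ≈ˢ g *ˢ f +ˢ h *ˢ f
  *ˢ-distribʳ f g h zero = begin
    (g 0 + h 0) * f 0 + 0#               ≈⟨ +-cong (distribʳ _ _ _) (sym (+-identityʳ _)) ⟩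
    g 0 * f 0 + h 0 * f 0 + (0# + 0#)    ≈⟨ interchange _ _ _ _ ⟩
    g 0 * f 0 + 0# + (h 0 * f 0 + 0#)    ∎
  *ˢ-distribʳ f g h (suc k) = begin
    (g 0 + h 0) * f (suc k) + ((tail g +ˢ tail h) *ˢ f) k
      ≈⟨ +-cong (distribʳ _ _ _) (*ˢ-distribʳ f (tail g) (tail h) k) ⟩
    g 0 * f (suc k) + h 0 * f (suc k) + ((tail g *ˢ f) k + (tail h *ˢ f) k)
      ≈⟨ interchange _ _ _ _ ⟩
    g 0 * f (suc k) + (tail g *ˢ f) k + (h 0 * f (suc k) + (tail h *ˢ f) k) ∎

  *ˢ-distribˡ : ∀ f g h → f *ˢ (g +ˢ h) ≈ˢ f *ˢ g +ˢ f *ˢ h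
  *ˢ-distribˡ f g h k = trans (*ˢ-comm f (g +ˢ h) k)
    (trans (*ˢ-distribʳ f g h k) (+-cong (*ˢ-comm g f k) (*ˢ-comm h f k)))

  scale : ∀ r f g k → ((λ i → r * f i) *ˢ g) k ≈ r * (f *ˢ g) k
  scale r f g zero = begin
    r * f 0 * g 0 + 0#        ≈⟨ +-cong (*-assoc _ _ _) (sym (zeroʳ r)) ⟩
    r * (f 0 * g 0) + r * 0#  ≈⟨ distribˡ _ _ _ ⟨
    r * (f 0 * g 0 + 0#)      ∎
  scale r f g (suc k) = begin
    r * f 0 * g (suc k) + ((λ i → r * f (suc i)) *ˢ g) k
      ≈⟨ +-cong (*-assoc _ _ _) (scale r (tail f) g k) ⟩
    r * (f 0 * g (suc k)) + r * (tail f *ˢ g) k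
      ≈⟨ distribˡ _ _ _ ⟨
    r * (f 0 * g (suc k) + (tail f *ˢ g) k) ∎

  *ˢ-assoc : ∀ f g h → (f *ˢ g) *ˢ h ≈ˢ f *ˢ (g *ˢ h)
  *ˢ-assoc f g h zero = +-congʳ (begin
    (f 0 * g 0 + 0#) * h 0  ≈⟨ *-congʳ (+-identityʳ _) ⟩
    f 0 * g 0 * h 0         ≈⟨ *-assoc _ _ _ ⟩
    f 0 * (g 0 * h 0)       ≈⟨ *-congˡ (+-identityʳ _) ⟨
    f 0 * (g 0 * h 0 + 0#)  ∎)
  *ˢ-assoc f g h (suc k) = begin
    (f 0 * g 0 + 0#) * h (suc k) + (((λ i → f 0 * g (suc i)) +ˢ tail f *ˢ g) *ˢ h) k
      ≈⟨ +-cong (trans (*-congʳ (+-identityʳ _)) (*-assoc _ _ _))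
                (*ˢ-distribʳ h (λ i → f 0 * g (suc i)) (tail f *ˢ g) k) ⟩
    f 0 * (g 0 * h (suc k)) + (((λ i → f 0 * g (suc i)) *ˢ h) k + ((tail f *ˢ g) *ˢ h) k)
      ≈⟨ +-assoc _ _ _ ⟨
    f 0 * (g 0 * h (suc k)) + ((λ i → f 0 * g (suc i)) *ˢ h) k + ((tail f *ˢ g) *ˢ h) k
      ≈⟨ +-cong (+-congˡ (scale (f 0) (tail g) h k)) (*ˢ-assoc (tail f) g h k) ⟩
    f 0 * (g 0 * h (suc k)) + f 0 * (tail g *ˢ h) k + (tail f *ˢ (g *ˢ h)) k
      ≈⟨ +-congʳ (distribˡ _ _ _) ⟨
    f 0 * (g 0 * h (suc k) + (tail g *ˢ h) k) + (tail f *ˢ (g *ˢ h)) k ∎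

  *ˢ-zeroˡ : ∀ f k → ((λ _ → 0#) *ˢ f) k ≈ 0#
  *ˢ-zeroˡ f zero    = trans (+-identityʳ _) (zeroˡ _)
  *ˢ-zeroˡ f (suc k) = trans (+-cong (zeroˡ _) (*ˢ-zeroˡ f k)) (+-identityʳ _)

  const-*ˢ : ∀ r f k → (const r *ˢ f) k ≈ r * f k
  const-*ˢ r f zero    = +-identityʳ _
  const-*ˢ r f (suc k) = trans (+-congˡ (*ˢ-zeroˡ f k)) (+-identityʳ _)

  X-*ˢ-zero : ∀ f → (X *ˢ f) 0 ≈ 0#
  X-*ˢ-zero f = trans (+-identityʳ _) (zeroˡ _)

  X-*ˢ-suc : ∀ f k → (X *ˢ f) (suc k) ≈ f k
  X-*ˢ-suc f k = trans (+-cong (zeroˡ _) (trans (const-*ˢ 1# f k) (*-identityˡ _))) (+-identityˡ _)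

  *ˢ-identityˡ : ∀ f → const 1# *ˢ f ≈ˢ f
  *ˢ-identityˡ f k = trans (const-*ˢ 1# f k) (*-identityˡ _)

  ring : CommutativeRing c ℓ
  ring = record
    { Carrier = ℕ → Carrier
    ; _≈_ = _≈ˢ_
    ; _+_ = _+ˢ_
    ; _*_ = _*ˢ_
    ; -_  = -ˢ_
    ; 0#  = λ _ → 0#
    ; 1#  = const 1#
    ; isCommutativeRing = record
      { isRing = record
        { +-isAbelianGroup = record
          { isGroup = record
            { isMonoid = record
              { isSemigroup = record
                { isMagma = record
                  { isEquivalence = record
                    { refl  = λ _ → refl
                    ; sym   = λ p k → sym (p k)
                    ; trans = λ p q k → trans (p k) (q k)
                    }
                  ; ∙-cong = λ p q k → +-cong (p k) (q k)
                  }
                ; assoc = λ _ _ _ _ → +-assoc _ _ _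
                }
              ; identity = (λ _ _ → +-identityˡ _) , (λ _ _ → +-identityʳ _)
              }
            ; inverse = (λ _ _ → -‿inverseˡ _) , (λ _ _ → -‿inverseʳ _)
            ; ⁻¹-cong = λ p k → -‿cong (p k)
            }
          ; comm = λ _ _ _ → +-comm _ _
          }
        ; *-cong = *ˢ-cong
        ; *-assoc = *ˢ-assoc
        ; *-identity = *ˢ-identityˡ
                     , λ f k → trans (*ˢ-comm f (const 1#) k) (*ˢ-identityˡ f k)
        ; distrib = *ˢ-distribˡ , *ˢ-distribʳ
        }
      ; *-comm = *ˢ-comm
      }
    }

-- R[[x₁, …, xₙ]], as power series in x₁ over R[[x₂, …, xₙ]]

Series : CommutativeRing c ℓ → ℕ → CommutativeRing c ℓ
Series R zero    = R
Series R (suc n) = PowerSeries.ring (Series R n)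

module SeriesOps (R : CommutativeRing c ℓ) where

  open CommutativeRing R using (Carrier)

  ⟦_⟧ : ℕ → Set c
  ⟦ n ⟧ = CommutativeRing.Carrier (Series R n)

  C : ∀ n → Carrier → ⟦ n ⟧
  C zero    r = r
  C (suc n) r = PowerSeries.const (Series R n) (C n r)

  x : ∀ {n} → Fin n → ⟦ n ⟧
  x {suc n} zero    = PowerSeries.X (Series R n)
  x {suc n} (suc i) = PowerSeries.const (Series R n) (x i)

  -- `insert f i` is the series f(xᵢ) = f 0 + f 1 xᵢ + f 2 xᵢ² + ….
  insert : ∀ {n} → (ℕ → Carrier) → Fin n → ⟦ n ⟧
  insert {suc n} f zero    k = C n (f k)
  insert {suc n} f (suc i)   = PowerSeries.const (Series R n) (insert f i)

  -- `coeff F α` is the coefficient of x₁^α₁ ⋯ xₙ^αₙ in F.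
  coeff : ∀ {n} → ⟦ n ⟧ → Vec ℕ n → Carrier
  coeff F []      = F
  coeff F (k ∷ α) = coeff (F k) α

  fromCoeff : ∀ {n} → (Vec ℕ n → Carrier) → ⟦ n ⟧
  fromCoeff {zero}  φ   = φ []
  fromCoeff {suc n} φ k = fromCoeff (λ α → φ (k ∷ α))

  private module R = CommutativeRing R
  private module S n = CommutativeRing (Series R n)
  open RingOps R using (_^_; sum)
  open import Algebra.Properties.Semiring.Sum R.semiring using (sum-cong-≋)

  -- 1/(1 - r xᵢ)
  geometric : ∀ {n} → Carrier → Fin n → ⟦ n ⟧
  geometric r = insert (r ^_)

  -- Exact division by xᵢ - xⱼ: if F = (xᵢ - xⱼ) G, then the coefficients satisfy
  --   F[p , r] = G[p - 1 , r] - G[p , r - 1],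
  -- where only the exponents of xᵢ and xⱼ are displayed, so that
  --   G[p , s] = F[p + s + 1 , 0] + F[p + s , 1] + ⋯ + F[p + 1 , s].
  divideCoeff : ∀ {n} → Fin n → Fin n → ⟦ n ⟧ → Vec ℕ n → Carrier
  divideCoeff i j F α = sum {suc (lookup α j)} λ r → coeff F
    ((α [ i ]≔ suc (lookup α i ℕ.+ (lookup α j ∸ toℕ r))) [ j ]≔ toℕ r)

  divide : ∀ {n} → Fin n → Fin n → ⟦ n ⟧ → ⟦ n ⟧
  divide i j F = fromCoeff (divideCoeff i j F)

  -- All (i , j) with i < j.
  pairs : ∀ n → List (Fin n × Fin n)
  pairs n = filter (uncurry _<?_) (cartesianProduct (allFin n) (allFin n))

  Δ : ∀ n → ⟦ n ⟧
  Δ n = RingOps.Πᴸ (Series R n) (map (λ (i , j) → x i - x j) (pairs n))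
    where open CommutativeRing (Series R n) using (_-_)

  -- Exact division by Δ n; see divideΔ-unique.
  divideΔ : ∀ n → ⟦ n ⟧ → ⟦ n ⟧
  divideΔ n F = foldl (λ G (i , j) → divide i j G) F (pairs n)

  coeff-cong : ∀ {n} {F G : ⟦ n ⟧} → S._≈_ n F G →
               ∀ (α : Vec ℕ n) → coeff F α R.≈ coeff G α
  coeff-cong p []      = p
  coeff-cong p (k ∷ α) = coeff-cong (p k) α

  coeff-ext : ∀ {n} {F G : ⟦ n ⟧} → (∀ (α : Vec ℕ n) → coeff F α R.≈ coeff G α) →
              S._≈_ n F G
  coeff-ext {zero}  p   = p []
  coeff-ext {suc n} p k = coeff-ext λ α → p (k ∷ α)

  coeff-fromCoeff : ∀ {n} (φ : Vec ℕ n → Carrier) α → coeff (fromCoeff φ) α ≡ φ α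
  coeff-fromCoeff φ []      = ≡.refl
  coeff-fromCoeff φ (k ∷ α) = coeff-fromCoeff (λ α → φ (k ∷ α)) α

  coeff-+ : ∀ {n} (F G : ⟦ n ⟧) (α : Vec ℕ n) →
            coeff (S._+_ n F G) α R.≈ coeff F α R.+ coeff G α
  coeff-+ F G []      = R.refl
  coeff-+ F G (k ∷ α) = coeff-+ (F k) (G k) α

  coeff-neg : ∀ {n} (F : ⟦ n ⟧) (α : Vec ℕ n) → coeff (S.-_ n F) α R.≈ R.- coeff F α
  coeff-neg F []      = R.refl
  coeff-neg F (k ∷ α) = coeff-neg (F k) α

  coeff-0 : ∀ {n} (α : Vec ℕ n) → coeff (S.0# n) α R.≈ R.0#
  coeff-0 []      = R.refl
  coeff-0 (k ∷ α) = coeff-0 α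

  coeff-x-suc : ∀ {n} (i : Fin n) F α p →
    coeff (S._*_ n (x i) F) (α [ i ]≔ suc p) R.≈ coeff F (α [ i ]≔ p)
  coeff-x-suc {suc n} zero    F (_ ∷ α) p =
    coeff-cong (PowerSeries.X-*ˢ-suc (Series R n) F p) α
  coeff-x-suc {suc n} (suc i) F (k ∷ α) p = R.trans
    (coeff-cong (PowerSeries.const-*ˢ (Series R n) (x i) F k) (α [ i ]≔ suc p))
    (coeff-x-suc i (F k) α p)

  coeff-x-zero : ∀ {n} (i : Fin n) F α → coeff (S._*_ n (x i) F) (α [ i ]≔ 0) R.≈ R.0#
  coeff-x-zero {suc n} zero    F (_ ∷ α) =
    R.trans (coeff-cong (PowerSeries.X-*ˢ-zero (Series R n) F) α) (coeff-0 α)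
  coeff-x-zero {suc n} (suc i) F (k ∷ α) = R.trans
    (coeff-cong (PowerSeries.const-*ˢ (Series R n) (x i) F k) (α [ i ]≔ 0))
    (coeff-x-zero i (F k) α)

  telescope : ∀ s (t u : ℕ → Carrier) t₀ → t₀ R.≈ u 0 →
    (∀ r → r < s → t r R.≈ u (suc r) R.- u r) →
    t₀ R.+ sum {s} (λ r → t (toℕ r)) R.≈ u s
  telescope zero    t u t₀ t₀≈ t≈ = R.trans (R.+-identityʳ _) t₀≈
  telescope (suc s) t u t₀ t₀≈ t≈ = R.trans (R.sym (R.+-assoc _ _ _))
    (telescope s (λ r → t (suc r)) (λ r → u (suc r)) (t₀ R.+ t 0) step
      (λ r r<s → t≈ (suc r) (s≤s r<s)))
    where
    open import Relation.Binary.Reasoning.Setoid R.setoid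
    step : t₀ R.+ t 0 R.≈ u 1
    step = begin
      t₀ R.+ t 0                 ≈⟨ R.+-cong t₀≈ (t≈ 0 (s≤s z≤n)) ⟩
      u 0 R.+ (u 1 R.- u 0)      ≈⟨ R.+-congˡ (R.+-comm _ _) ⟩
      u 0 R.+ (R.- u 0 R.+ u 1)  ≈⟨ R.+-assoc _ _ _ ⟨
      u 0 R.- u 0 R.+ u 1        ≈⟨ R.+-congʳ (R.-‿inverseʳ _) ⟩
      R.0# R.+ u 1               ≈⟨ R.+-identityˡ _ ⟩
      u 1                        ∎

  module _ {n : ℕ} where

    open CommutativeRing (Series R n) hiding (Carrier; zero)

    divide-cong : ∀ (i j : Fin n) {F G : ⟦ n ⟧} → F ≈ G → divide i j F ≈ divide i j G
    divide-cong i j {F} {G} F≈G = coeff-ext {n} λ α → R.trans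
      (R.reflexive (coeff-fromCoeff (divideCoeff i j F) α))
      (R.trans (sum-cong-≋ {suc (lookup α j)} λ r → coeff-cong {n} F≈G
        ((α [ i ]≔ suc (lookup α i ℕ.+ (lookup α j ∸ toℕ r))) [ j ]≔ toℕ r))
               (R.reflexive (≡.sym (coeff-fromCoeff (divideCoeff i j G) α))))

    divide-correct : ∀ {i j : Fin n} → i ≢ j → ∀ G → divide i j ((x i - x j) * G) ≈ G
    divide-correct {i} {j} i≢j G = coeff-ext {n} λ α → begin
      coeff (divide i j F) α
        ≡⟨ coeff-fromCoeff (divideCoeff i j F) α ⟩
      t α 0 R.+ sum {lookup α j} (λ r → t α (suc (toℕ r)))
        ≈⟨ telescope (lookup α j) (λ r → t α (suc r)) (u α) (t α 0) (first α) (next α) ⟩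
      u α (lookup α j)
        ≡⟨ ≡.cong (coeff G) (last α) ⟩
      coeff G α ∎
      where
      open import Relation.Binary.Reasoning.Setoid R.setoid
      F : ⟦ n ⟧
      F = (x i - x j) * G
      t u : Vec ℕ n → ℕ → Carrier
      t α r = coeff F ((α [ i ]≔ suc (lookup α i ℕ.+ (lookup α j ∸ r))) [ j ]≔ r)
      u α r = coeff G ((α [ i ]≔ (lookup α i ℕ.+ (lookup α j ∸ r))) [ j ]≔ r)

      split : ∀ β → coeff F β R.≈ coeff (x i * G) β R.- coeff (x j * G) β
      split β = begin
        coeff F β
          ≈⟨ coeff-cong {n} (distribʳ G (x i) (- x j)) β ⟩
        coeff (x i * G + (- x j) * G) β
          ≈⟨ coeff-+ (x i * G) ((- x j) * G) β ⟩
        coeff (x i * G) β R.+ coeff ((- x j) * G) β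
          ≈⟨ R.+-congˡ (coeff-cong {n} (sym (-‿distribˡ-* (x j) G)) β) ⟩
        coeff (x i * G) β R.+ coeff (- (x j * G)) β
          ≈⟨ R.+-congˡ (coeff-neg (x j * G) β) ⟩
        coeff (x i * G) β R.- coeff (x j * G) β ∎
        where open import Algebra.Properties.Ring ring using (-‿distribˡ-*)

      xᵢ-part : ∀ α q r → coeff (x i * G) ((α [ i ]≔ suc q) [ j ]≔ r)
                      R.≈ coeff G ((α [ i ]≔ q) [ j ]≔ r)
      xᵢ-part α q r = begin
        coeff (x i * G) ((α [ i ]≔ suc q) [ j ]≔ r)
          ≡⟨ ≡.cong (coeff (x i * G)) ([]≔-commutes α i j i≢j) ⟩
        coeff (x i * G) ((α [ j ]≔ r) [ i ]≔ suc q)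
          ≈⟨ coeff-x-suc i G (α [ j ]≔ r) q ⟩
        coeff G ((α [ j ]≔ r) [ i ]≔ q)
          ≡⟨ ≡.cong (coeff G) ([]≔-commutes α i j i≢j) ⟨
        coeff G ((α [ i ]≔ q) [ j ]≔ r) ∎

      first : ∀ α → t α 0 R.≈ u α 0
      first α = begin
        t α 0
          ≈⟨ split ((α [ i ]≔ suc q) [ j ]≔ 0) ⟩
        _ R.- _
          ≈⟨ R.+-cong (xᵢ-part α q 0) (R.-‿cong (coeff-x-zero j G (α [ i ]≔ suc q))) ⟩
        u α 0 R.- R.0#   ≈⟨ R.+-congˡ ε⁻¹≈ε ⟩
        u α 0 R.+ R.0#   ≈⟨ R.+-identityʳ _ ⟩
        u α 0            ∎
        where
        open import Algebra.Properties.Group R.+-group using (ε⁻¹≈ε)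
        q = lookup α i ℕ.+ lookup α j

      next : ∀ α r → r < lookup α j → t α (suc r) R.≈ u α (suc r) R.- u α r
      next α r r<s = R.trans
        (split ((α [ i ]≔ suc q) [ j ]≔ suc r))
        (R.+-cong (xᵢ-part α q (suc r)) (R.-‿cong (begin
          coeff (x j * G) ((α [ i ]≔ suc q) [ j ]≔ suc r)
            ≈⟨ coeff-x-suc j G (α [ i ]≔ suc q) r ⟩
          coeff G ((α [ i ]≔ suc q) [ j ]≔ r)
            ≡⟨ ≡.cong (λ q → coeff G ((α [ i ]≔ q) [ j ]≔ r)) index ⟩
          u α r ∎)))
        where
        p = lookup α i
        s = lookup α j
        q = p ℕ.+ (s ∸ suc r)
        index : suc q ≡ p ℕ.+ (s ∸ r)
        index = ≡.trans (≡.sym (ℕₚ.+-suc p (s ∸ suc r)))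
                        (≡.cong (p ℕ.+_) (≡.sym (ℕₚ.+-∸-assoc 1 r<s)))

      last : ∀ α → (α [ i ]≔ (lookup α i ℕ.+ (lookup α j ∸ lookup α j))) [ j ]≔ lookup α j ≡ α
      last α rewrite ℕₚ.n∸n≡0 (lookup α j) | ℕₚ.+-identityʳ (lookup α i)
                   | []≔-lookup α i = []≔-lookup α j

    quot : ⟦ n ⟧ → List (Fin n × Fin n) → ⟦ n ⟧
    quot = foldl (λ G (i , j) → divide i j G)

    quot-cong : ∀ ps {F G} → F ≈ G → quot F ps ≈ quot G ps
    quot-cong []             p = p
    quot-cong ((i , j) ∷ ps) p = quot-cong ps (divide-cong i j p)

    divideΔ-correct : ∀ G → divideΔ n (G * Δ n) ≈ G
    divideΔ-correct = go (pairs n)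
      (all-filter (uncurry _<?_) (cartesianProduct (allFin n) (allFin n)))
      where
      open import Relation.Binary.Reasoning.Setoid setoid
      open import Algebra.Properties.CommutativeSemigroup *-commutativeSemigroup
        using (x∙yz≈y∙xz)
      Π : List (Fin n × Fin n) → ⟦ n ⟧
      Π ps = RingOps.Πᴸ (Series R n) (map (λ (i , j) → x i - x j) ps)
      go : ∀ ps → All (uncurry Fin._<_) ps → ∀ G → quot (G * Π ps) ps ≈ G
      go []             []            G = *-identityʳ G
      go ((i , j) ∷ ps) (i<j ∷ is<js) G = begin
        quot (divide i j (G * ((x i - x j) * Π ps))) ps
          ≈⟨ quot-cong ps (divide-cong i j (x∙yz≈y∙xz G (x i - x j) (Π ps))) ⟩
        quot (divide i j ((x i - x j) * (G * Π ps))) ps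
          ≈⟨ quot-cong ps (divide-correct (<⇒≢ i<j) (G * Π ps)) ⟩
        quot (G * Π ps) ps
          ≈⟨ go ps is<js G ⟩
        G ∎

    -- A quotient F / Δ n is unique, and divideΔ computes it.
    divideΔ-unique : ∀ F G → G * Δ n ≈ F → divideΔ n F ≈ G
    divideΔ-unique F G GΔ≈F = trans (quot-cong (pairs n) (sym GΔ≈F)) (divideΔ-correct G)

  C-1 : ∀ n → S._≈_ n (C n R.1#) (S.1# n)
  C-1 zero            = R.refl
  C-1 (suc n) zero    = C-1 n
  C-1 (suc n) (suc k) = S.refl n

  C-* : ∀ n r s → S._≈_ n (C n (r R.* s)) (S._*_ n (C n r) (C n s))
  C-* zero    r s   = R.refl
  C-* (suc n) r s k = S.trans n (const-* k)
    (S.sym n (PowerSeries.const-*ˢ (Series R n) (C n r) (C (suc n) s) k))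
    where
    const-* : ∀ k → S._≈_ n (C (suc n) (r R.* s) k) (S._*_ n (C n r) (C (suc n) s k))
    const-* zero    = C-* n r s
    const-* (suc k) = S.sym n (S.zeroʳ n (C n r))

  geometric-step : ∀ {n} r (i : Fin n) → let open CommutativeRing (Series R n) in
                   geometric r i ≈ 1# + C n r * (x i * geometric r i)
  geometric-step {suc n} r i = step i
    where
    open CommutativeRing (Series R n) hiding (zero)
    open PowerSeries (Series R n) using (const-*ˢ; X-*ˢ-zero; X-*ˢ-suc)
    open import Relation.Binary.Reasoning.Setoid setoid
    module T = CommutativeRing (Series R (suc n))
    expand : ∀ (i : Fin (suc n)) k {z} → (x i T.* geometric r i) k ≈ z →
             (C (suc n) r T.* (x i T.* geometric r i)) k ≈ C n r * z
    expand i k p = trans (const-*ˢ (C n r) (x i T.* geometric r i) k) (*-congˡ p)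
    step : ∀ i → geometric r i T.≈ T.1# T.+ C (suc n) r T.* (x i T.* geometric r i)
    step zero zero = begin
      C n R.1#         ≈⟨ C-1 n ⟩
      1#               ≈⟨ +-identityʳ 1# ⟨
      1# + 0#          ≈⟨ +-congˡ (zeroʳ (C n r)) ⟨
      1# + C n r * 0#  ≈⟨ +-congˡ (expand zero 0 (X-*ˢ-zero (geometric {suc n} r zero))) ⟨
      _                ∎
    step zero (suc k) = begin
      C n (r R.* r ^ k)           ≈⟨ C-* n r (r ^ k) ⟩
      C n r * C n (r ^ k)         ≈⟨ +-identityˡ _ ⟨
      0# + C n r * C n (r ^ k)    ≈⟨ +-congˡ (expand zero (suc k) (X-*ˢ-suc (geometric {suc n} r zero) k)) ⟨
      _                           ∎
    step (suc i) zero = begin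
      geometric r i                            ≈⟨ geometric-step r i ⟩
      1# + C n r * (x i * geometric r i)
        ≈⟨ +-congˡ (expand (suc i) 0 (const-*ˢ (x i) (geometric r (suc i)) 0)) ⟨
      _                                        ∎
    step (suc i) (suc k) = begin
      0#                        ≈⟨ zeroʳ _ ⟨
      C n r * 0#                ≈⟨ *-congˡ (zeroʳ _) ⟨
      C n r * (x i * 0#)        ≈⟨ +-identityˡ _ ⟨
      0# + C n r * (x i * 0#)
        ≈⟨ +-congˡ (expand (suc i) (suc k) (const-*ˢ (x i) (geometric r (suc i)) (suc k))) ⟨
      _                         ∎

  geometric-correct : ∀ {n} r (i : Fin n) → let open CommutativeRing (Series R n) in
                      (1# - C n r * x i) * geometric r i ≈ 1#
  geometric-correct {n} r i = begin
    (1# - C n r * x i) * g            ≈⟨ distribʳ g 1# (- (C n r * x i)) ⟩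
    1# * g + (- (C n r * x i)) * g    ≈⟨ +-cong (*-identityˡ g) (sym (-‿distribˡ-* (C n r * x i) g)) ⟩
    g - C n r * x i * g               ≈⟨ +-congˡ (-‿cong (*-assoc (C n r) (x i) g)) ⟩
    g - C n r * (x i * g)             ≈⟨ +-congʳ (geometric-step r i) ⟩
    1# + C n r * (x i * g) - C n r * (x i * g)  ≈⟨ +-assoc 1# _ _ ⟩
    1# + (C n r * (x i * g) - C n r * (x i * g))  ≈⟨ +-congˡ (-‿inverseʳ _) ⟩
    1# + 0#                           ≈⟨ +-identityʳ 1# ⟩
    1#                                ∎
    where
    open CommutativeRing (Series R n)
    open import Algebra.Properties.Ring ring using (-‿distribˡ-*)
    open import Relation.Binary.Reasoning.Setoid setoid
    g = geometric r i

-- An element of the ring Λ̂(x ‖ a) of formal sums Σ c_ν(a) s_ν(x) is determined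
-- by its specialisations to x = (x₁, …, xₙ, 0, 0, …), n ≥ 0, and ŝ_ν(x ‖ a) is
-- defined by giving these.  So an element F of Λ̂ is represented by the family of
-- the series F(x₁, …, xₙ), and an identity in Λ̂ by the identities between the
-- specialisations for all n.

module DualSchur (R : CommutativeRing c ℓ) (a : ℤ → CommutativeRing.Carrier R) where

  open CommutativeRing R using (Carrier; _≈_)
  open SeriesOps R

  -- a₁, …, aₘ
  a₁⋯ : ℕ → List Carrier
  a₁⋯ m = applyUpTo (λ k → a (+ suc k)) m

  -- a₀, a₋₁, …, a₁₋ₘ
  a₀⋯ : ℕ → List Carrier
  a₀⋯ m = applyUpTo (λ k → a (ℤ.- (+ k))) m

  -- det M / Δ n, replaced by 0 if ν has more than n rows.
  overΔ : Partition → ∀ n → (Fin n → Fin n → ⟦ n ⟧) → ⟦ n ⟧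
  overΔ ν n M = if does (len ν ≤? n) then divideΔ n (RingOps.det (Series R n) M)
                                     else CommutativeRing.0# (Series R n)

  -- s_ν(x₁, …, xₙ), as the ratio of alternants.
  s : Partition → ∀ n → ⟦ n ⟧
  s ν n = overΔ ν n λ i j → let j′ = suc (toℕ j) in x i ^ (row ν j′ ℕ.+ (n ∸ j′))
    where open RingOps (Series R n) using (_^_)

  module _ (ν : Partition) (n : ℕ) where

    open CommutativeRing (Series R n) using (_*_; _-_; 1#)
    open RingOps (Series R n) using (_^_; Πᴸ)

    -- The factors involve a₀, a₋₁, …, a_{j-ν_j} if j ≤ d, that is ν_j - j + 1 of
    -- the parameters, and a₁, …, a_{j-ν_j-1} if j > d, that is j - ν_j - 1 of them.
    A : Fin n → Fin n → ⟦ n ⟧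
    A i j =
      let j′ = suc (toℕ j) in
      x i ^ (row ν j′ ℕ.+ (n ∸ j′)) *
      (if does (j′ ≤? diagonal ν)
       then Πᴸ (map (λ r → geometric r i)    (a₀⋯ (suc (row ν j′) ∸ j′)))
       else Πᴸ (map (λ r → 1# - C n r * x i) (a₁⋯ (j′ ∸ suc (row ν j′)))))

    -- ŝ_ν(x₁, …, xₙ ‖ a)
    ŝ : ⟦ n ⟧
    ŝ = overΔ ν n A

  -- The coefficient of ŝ_ν in the expansion of s_μ, for μ ⊆ ν with d diagonal
  -- boxes each.  The second determinant is over d + 1 ≤ i , j ≤ len ν; extending
  -- it to d + 1 ≤ i , j ≤ N with N ≥ len ν does not change its value.  The lists
  -- of variables are a₀, a₋₁, …, a_{i-ν_i+1} and a₁, a₂, …, a_{i-ν_i}.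
  module _ (μ ν : Partition) where

    open CommutativeRing R using (_*_; -_; 1#)
    open RingOps R using (_^_; det; e; h)

    private
      d = diagonal μ

    degree : ℕ → ℕ → ℤ
    degree i j = + row ν i ℤ.- + row μ j ℤ.- + i ℤ.+ + j

    E : Fin d → Fin d → Carrier
    E p q = e (degree i j) (a₀⋯ (row ν i ∸ i))
      where
      i = suc (toℕ p)
      j = suc (toℕ q)

    H : Fin (len ν ∸ d) → Fin (len ν ∸ d) → Carrier
    H p q = h (degree i j) (a₁⋯ (i ∸ row ν i))
      where
      i = suc (d ℕ.+ toℕ p)
      j = suc (d ℕ.+ toℕ q)

    expansionCoeff : Carrier
    expansionCoeff = (- 1#) ^ boxes d ν μ * det E * det H

  -- F is the (possibly infinite) sum of f i over the indices i satisfying P: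
  -- for each monomial, all sufficiently large finite partial sums have the
  -- coefficient of F.
  IsSum : {I : Set} (P : I → Set) (n : ℕ) → (I → ⟦ n ⟧) → ⟦ n ⟧ → Set ℓ
  IsSum {I} P n f F = ∀ (α : Vec ℕ n) → ∃ λ is₀ → All P is₀ ×
    (∀ is → All P is → Unique is → is₀ ⊆ˡ is →
      RingOps.Σᴸ R (map (λ i → coeff (f i) α) is) ≈ coeff F α)

{-# OPTIONS --safe #-}
module Submission where

-- Column j of A depends only on the bead l = νⱼ + n - j, and the partitions with
-- at most n rows correspond to the strictly decreasing sequences of n beads.
-- Calling this column w l, one has x ^ k = Σ M k l · w l in each variable, where
-- M k l is 0 for l < k; for l ≥ k it is ± an elementary symmetric polynomial of
-- a₀, a₋₁, … if k , l ≥ n, a complete symmetric polynomial of a₁, a₂, … if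
-- k , l < n, and 0 otherwise.  With kⱼ = μⱼ + n - j the Cauchy-Binet formula turns
-- the alternant det [xᵢ ^ kⱼ] into the sum of det [M kⱼ lᵢ] · det [w lⱼ (xᵢ)] over
-- the bead sequences l.  The matrix M kⱼ lᵢ has a zero block forcing its
-- determinant to vanish unless ν contains μ and has the same diagonal; then it is
-- block triangular with determinant (-1)^m(ν/μ) · det E · det H.
--
-- The sum over l is infinite, but a coefficient of the quotient by Δ is a linear
-- combination of finitely many coefficients of the numerator, so that one may
-- compute modulo high powers of the variables, where the sum is finite.

open import Defs
open import Algebra.Bundles using (CommutativeRing)
open import Algebra.Morphism.Structures using (IsRingHomomorphism)
open import Data.Bool.Base using (if_then_else_)
open import Data.Empty using (⊥-elim)
open import Data.Fin.Base as Fin using (Fin; zero; suc; toℕ; punchIn)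
open import Data.Fin.Properties using (toℕ<n)
open import Data.Integer.Base as ℤ using (ℤ; +_; -[1+_]; _⊖_)
open import Data.Integer.Properties as ℤₚ using (+-cancelˡ-⊖; [1+m]⊖[1+n]≡m⊖n)
import Data.Integer.Tactic.RingSolver as ℤ-Solver
open import Data.List.Base as List
  using (List; []; _∷_; _++_; map; applyUpTo; concatMap; filter; length; tabulate)
open import Data.List.Membership.Propositional using (_∈_)
open import Data.List.Membership.Propositional.Properties
  using (∈-++⁺ˡ; ∈-++⁺ʳ; ∈-map⁺; ∈-map⁻; ∈-filter⁺; ∈-filter⁻)
open import Data.List.Membership.Propositional.Properties.WithK using (unique∧set⇒bag)
open import Data.List.Properties using (map-∘; map-applyUpTo)
open import Data.List.Relation.Binary.BagAndSetEquality using (∼bag⇒↭)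
open import Data.List.Relation.Binary.Permutation.Propositional as ↭ using (_↭_)
open import Data.List.Relation.Unary.All as All using (All; []; _∷_)
import Data.List.Relation.Unary.All.Properties as Allₚ
open import Data.List.Relation.Unary.AllPairs using ([]; _∷_)
open import Data.List.Relation.Unary.Any using (here)
open import Data.List.Relation.Unary.Linked using (Linked; []; [-]; _∷_)
open import Data.List.Relation.Unary.Unique.Propositional using (Unique)
import Data.List.Relation.Unary.Unique.Propositional.Properties as Uniqueₚ
open import Data.Nat.Base as ℕ using (ℕ; zero; suc; _≤_; _<_; _≥_; _∸_; _⊔_; s≤s; z≤n)
open import Data.Nat.ListAction using () renaming (sum to sumℕ)
import Data.Nat.Properties as ℕₚ
open import Data.Product.Base using (_×_; _,_; ∃; proj₁; proj₂)
open import Data.Sum.Base using (_⊎_; inj₁; inj₂)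
open import Data.Unit.Polymorphic.Base using (⊤)
open import Data.Vec.Base as Vec using (Vec; []; _∷_; lookup; _[_]≔_)
open import Data.Vec.Properties using ([]≔-lookup; lookup∘updateAt; ∷-injectiveʳ)
import Data.Vec.Relation.Unary.All as Vecᴬ
open import Data.Vec.Relation.Unary.All.Properties using (lookup⁺)
open import Function.Bundles using (mk⇔)
open import Level using (Level)
open import Relation.Binary.Core using (Rel)
open import Relation.Binary.PropositionalEquality as ≡ using (_≡_; _≢_)
open import Relation.Binary.Structures using (IsEquivalence)
open import Relation.Nullary using (¬_)
open import Relation.Nullary.Decidable
  using (Dec; yes; no; does; dec-true; dec-false; recompute; _×-dec_)
open import Relation.Unary using (Decidable)

-- The columns with bead l < n are polynomials of degree at most n - 1 in their variable, those with
-- l ≥ n are divisible by its n-th power. The change of basis therefore splits into two independent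
-- ones, and the number of beads ≥ n, which is the size of the diagonal, is preserved. Each of the
-- two expansions is proved by splitting off the first parameter with the recursion of the symmetric
-- polynomials.
--
-- Determinants are defined by expansion along the first row, not by permutations. Cauchy-Binet is
-- therefore derived from the alternation of a determinant in its rows, which is read off from the
-- simultaneous expansion along two rows; sorting a row index into a decreasing vector then replaces
-- the sum over permutations.
--
-- Exact division by Δ does not respect truncation, since it reads exponents larger than the one it
-- computes. Hence the coefficient α is fixed before anything is truncated: it determines which
-- coefficients of the numerator are read, these determine the degree of truncation, and only
-- numerators are ever compared in the truncated ring.

private
  variable
    c ℓ c′ ℓ′ ι ι′ : Level
    I : Set ι

-- The index set of the Cauchy-Binet sum, with all entries below `B`. It is split by whether the
-- largest admissible entry occurs, which is the recursion followed by `∑-insert`.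
decreasing : ℕ → (n : ℕ) → List (Vec ℕ n)
decreasing B       zero    = [] ∷ []
decreasing zero    (suc n) = []
decreasing (suc B) (suc n) = decreasing B (suc n) ++ map (B ∷_) (decreasing B n)

-- Finite sums over `Fin`, over initial segments of ℕ, and over lists

module Sums (R : CommutativeRing c ℓ) where

  open CommutativeRing R hiding (zero)
  open RingOps R
  import Algebra.Properties.Semiring.Sum semiring as Sum
  open import Algebra.Properties.Ring ring using (-‿+-comm)
  open import Algebra.Properties.Group +-group using (ε⁻¹≈ε)
  open import Algebra.Properties.CommutativeSemigroup +-commutativeSemigroup
    using (interchange; x∙yz≈y∙xz)
  open import Relation.Binary.Reasoning.Setoid setoid

  -- Opaque, so that the summand can be inferred from the sum.
  opaque

    ∑ᶠ : ∀ n → (Fin n → Carrier) → Carrier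
    ∑ᶠ n f = sum {n} f

    ∑ : ℕ → (ℕ → Carrier) → Carrier
    ∑ n f = sum {n} λ i → f (toℕ i)

  opaque

    unfolding ∑ᶠ

    ∑ᶠ-sum : ∀ n f → ∑ᶠ n f ≈ sum {n} f
    ∑ᶠ-sum n f = refl

    ∑ᶠ-zero : ∀ f → ∑ᶠ 0 f ≈ 0#
    ∑ᶠ-zero f = refl

    ∑ᶠ-suc : ∀ n f → ∑ᶠ (suc n) f ≈ f zero + ∑ᶠ n λ j → f (suc j)
    ∑ᶠ-suc n f = refl

    ∑ᶠ-cong : ∀ n {f g} → (∀ j → f j ≈ g j) → ∑ᶠ n f ≈ ∑ᶠ n g
    ∑ᶠ-cong n p = Sum.sum-cong-≋ {n} p

    ∑ᶠ-zeros : ∀ n {f} → (∀ j → f j ≈ 0#) → ∑ᶠ n f ≈ 0#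
    ∑ᶠ-zeros n p = trans (Sum.sum-cong-≋ {n} p) (Sum.sum-replicate-zero n)

    ∑ᶠ-+ : ∀ n f g → ∑ᶠ n (λ j → f j + g j) ≈ ∑ᶠ n f + ∑ᶠ n g
    ∑ᶠ-+ n f g = Sum.∑-distrib-+ {n} f g

    ∑ᶠ-*ˡ : ∀ n r f → r * ∑ᶠ n f ≈ ∑ᶠ n λ j → r * f j
    ∑ᶠ-*ˡ n r f = Sum.*-distribˡ-sum {n} r f

    ∑ᶠ-neg : ∀ n f → ∑ᶠ n (λ j → - f j) ≈ - ∑ᶠ n f
    ∑ᶠ-neg zero    f = sym ε⁻¹≈ε
    ∑ᶠ-neg (suc n) f = trans (+-congˡ (∑ᶠ-neg n λ i → f (suc i))) (-‿+-comm _ _)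

    ∑-∑ᶠ : ∀ n f → ∑ᶠ n (λ j → f (toℕ j)) ≈ ∑ n f
    ∑-∑ᶠ n f = refl

    ∑ᶠ-∑-comm : ∀ m n (f : Fin m → ℕ → Carrier) → ∑ᶠ m (λ j → ∑ n (f j)) ≈ ∑ n λ i → ∑ᶠ m λ j → f j i
    ∑ᶠ-∑-comm m n f = Sum.∑-comm {m} {n} λ j i → f j (toℕ i)

    ∑-zero : ∀ f → ∑ 0 f ≈ 0#
    ∑-zero f = refl

    ∑-suc : ∀ n f → ∑ (suc n) f ≈ f 0 + ∑ n λ i → f (suc i)
    ∑-suc n f = refl

    ∑-cong : ∀ n {f g} → (∀ i → i < n → f i ≈ g i) → ∑ n f ≈ ∑ n g
    ∑-cong zero    p = refl
    ∑-cong (suc n) p = +-cong (p 0 (s≤s z≤n)) (∑-cong n λ i i<n → p (suc i) (s≤s i<n))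

    ∑-zeros : ∀ n {f} → (∀ i → i < n → f i ≈ 0#) → ∑ n f ≈ 0#
    ∑-zeros n p = trans (∑-cong n p) (Sum.sum-replicate-zero n)

    ∑-*ˡ : ∀ n r f → r * ∑ n f ≈ ∑ n λ i → r * f i
    ∑-*ˡ n r f = Sum.*-distribˡ-sum {n} r λ i → f (toℕ i)

    ∑-+ : ∀ n f g → ∑ n (λ i → f i + g i) ≈ ∑ n f + ∑ n g
    ∑-+ n f g = Sum.∑-distrib-+ {n} (λ i → f (toℕ i)) (λ i → g (toℕ i))

    ∑-neg : ∀ n f → ∑ n (λ i → - f i) ≈ - ∑ n f
    ∑-neg n f = ∑ᶠ-neg n λ j → f (toℕ j)

    ∑-++ : ∀ m n f → ∑ (m ℕ.+ n) f ≈ ∑ m f + ∑ n λ i → f (m ℕ.+ i)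
    ∑-++ zero    n f = sym (+-identityˡ _)
    ∑-++ (suc m) n f = trans (+-congˡ (∑-++ m n λ i → f (suc i))) (sym (+-assoc _ _ _))

    ∑-snoc : ∀ n f → ∑ (suc n) f ≈ ∑ n f + f n
    ∑-snoc zero    f = +-comm _ _
    ∑-snoc (suc n) f = trans (+-congˡ (∑-snoc n λ i → f (suc i))) (sym (+-assoc _ _ _))

  Π : ℕ → (ℕ → Carrier) → Carrier
  Π zero    f = 1#
  Π (suc n) f = f 0 * Π n λ i → f (suc i)

  ∑ᴸ : (I → Carrier) → List I → Carrier
  ∑ᴸ f xs = Σᴸ (map f xs)

  ∑ᴸ-cong : ∀ {f g : I → Carrier} → (∀ x → f x ≈ g x) → ∀ xs → ∑ᴸ f xs ≈ ∑ᴸ g xs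
  ∑ᴸ-cong p []       = refl
  ∑ᴸ-cong p (x ∷ xs) = +-cong (p x) (∑ᴸ-cong p xs)

  ∑ᴸ-cong-All : ∀ {f g : I → Carrier} {xs} → All (λ x → f x ≈ g x) xs → ∑ᴸ f xs ≈ ∑ᴸ g xs
  ∑ᴸ-cong-All []       = refl
  ∑ᴸ-cong-All (p ∷ ps) = +-cong p (∑ᴸ-cong-All ps)

  ∑ᴸ-zero : ∀ {f : I → Carrier} → (∀ x → f x ≈ 0#) → ∀ xs → ∑ᴸ f xs ≈ 0#
  ∑ᴸ-zero p []       = refl
  ∑ᴸ-zero p (x ∷ xs) = trans (+-cong (p x) (∑ᴸ-zero p xs)) (+-identityˡ _)

  ∑ᴸ-zeros : ∀ {f : I → Carrier} {xs} → All (λ x → f x ≈ 0#) xs → ∑ᴸ f xs ≈ 0#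
  ∑ᴸ-zeros []       = refl
  ∑ᴸ-zeros (p ∷ ps) = trans (+-cong p (∑ᴸ-zeros ps)) (+-identityˡ _)

  ∑ᴸ-++ : ∀ (f : I → Carrier) xs ys → ∑ᴸ f (xs ++ ys) ≈ ∑ᴸ f xs + ∑ᴸ f ys
  ∑ᴸ-++ f []       ys = sym (+-identityˡ _)
  ∑ᴸ-++ f (x ∷ xs) ys = trans (+-congˡ (∑ᴸ-++ f xs ys)) (sym (+-assoc _ _ _))

  ∑ᴸ-concatMap : ∀ {J : Set ι′} (f : I → Carrier) (g : J → List I) xs →
                 ∑ᴸ f (List.concatMap g xs) ≈ ∑ᴸ (λ x → ∑ᴸ f (g x)) xs
  ∑ᴸ-concatMap f g []       = refl
  ∑ᴸ-concatMap f g (x ∷ xs) = trans (∑ᴸ-++ f (g x) _) (+-congˡ (∑ᴸ-concatMap f g xs))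

  ∑ᴸ-tabulate : ∀ n (f : I → Carrier) (g : Fin n → I) → ∑ᴸ f (List.tabulate g) ≈ sum λ i → f (g i)
  ∑ᴸ-tabulate zero    f g = refl
  ∑ᴸ-tabulate (suc n) f g = +-congˡ (∑ᴸ-tabulate n f λ i → g (suc i))

  ∑ᴸ-map : ∀ {J : Set ι′} (f : I → Carrier) (g : J → I) xs → ∑ᴸ f (map g xs) ≡ ∑ᴸ (λ x → f (g x)) xs
  ∑ᴸ-map f g xs = ≡.cong Σᴸ (≡.sym (map-∘ {g = f} {f = g} xs))

  ∑ᴸ-+ : ∀ (f g : I → Carrier) xs → ∑ᴸ (λ x → f x + g x) xs ≈ ∑ᴸ f xs + ∑ᴸ g xs
  ∑ᴸ-+ f g []       = sym (+-identityˡ _)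
  ∑ᴸ-+ f g (x ∷ xs) = trans (+-congˡ (∑ᴸ-+ f g xs)) (interchange _ _ _ _)

  ∑ᴸ-*ˡ : ∀ r (f : I → Carrier) xs → r * ∑ᴸ f xs ≈ ∑ᴸ (λ x → r * f x) xs
  ∑ᴸ-*ˡ r f []       = zeroʳ r
  ∑ᴸ-*ˡ r f (x ∷ xs) = trans (distribˡ r _ _) (+-congˡ (∑ᴸ-*ˡ r f xs))

  ∑ᴸ-neg : ∀ (f : I → Carrier) xs → ∑ᴸ (λ x → - f x) xs ≈ - ∑ᴸ f xs
  ∑ᴸ-neg f []       = sym ε⁻¹≈ε
  ∑ᴸ-neg f (x ∷ xs) = trans (+-congˡ (∑ᴸ-neg f xs)) (-‿+-comm _ _)

  ∑ᶠ-∑ᴸ-comm : ∀ n (f : Fin n → I → Carrier) xs →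
               ∑ᶠ n (λ j → ∑ᴸ (f j) xs) ≈ ∑ᴸ (λ x → ∑ᶠ n λ j → f j x) xs
  ∑ᶠ-∑ᴸ-comm n f []       = ∑ᶠ-zeros n λ _ → refl
  ∑ᶠ-∑ᴸ-comm n f (x ∷ xs) = trans (∑ᶠ-+ n _ _) (+-congˡ (∑ᶠ-∑ᴸ-comm n f xs))

  ∑ᴸ-comm : ∀ {J : Set ι′} (f : I → J → Carrier) xs ys →
            ∑ᴸ (λ x → ∑ᴸ (f x) ys) xs ≈ ∑ᴸ (λ y → ∑ᴸ (λ x → f x y) xs) ys
  ∑ᴸ-comm f []       ys = sym (∑ᴸ-zero (λ _ → refl) ys)
  ∑ᴸ-comm f (x ∷ xs) ys = trans (+-congˡ (∑ᴸ-comm f xs ys)) (sym (∑ᴸ-+ _ _ ys))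

  -- Needed because `IsSum` admits the indices of a partial sum in any order.
  ∑ᴸ-↭ : ∀ (f : I → Carrier) {xs ys} → xs ↭ ys → ∑ᴸ f xs ≈ ∑ᴸ f ys
  ∑ᴸ-↭ f ↭.refl           = refl
  ∑ᴸ-↭ f (↭.prep x p)     = +-congˡ (∑ᴸ-↭ f p)
  ∑ᴸ-↭ f (↭.swap x y p)   = trans (+-congˡ (+-congˡ (∑ᴸ-↭ f p))) (x∙yz≈y∙xz _ _ _)
  ∑ᴸ-↭ f (↭.trans p q)    = trans (∑ᴸ-↭ f p) (∑ᴸ-↭ f q)

-- Determinants

module Determinants (R : CommutativeRing c ℓ) where

  open CommutativeRing R hiding (zero)
  open RingOps R
  open Sums R
  open import Algebra.Properties.Ring ring using (-‿+-comm; -‿distribˡ-*; -‿distribʳ-*; -1*x≈-x)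
  open import Algebra.Properties.Group +-group using (ε⁻¹≈ε; ⁻¹-involutive)
  import Algebra.Properties.CommutativeSemigroup *-commutativeSemigroup as *
  open import Algebra.Solver.CommutativeMonoid *-commutativeMonoid using (solve; _⊜_; _⊕_)
  open import Relation.Binary.Reasoning.Setoid setoid

  det-expand : ∀ {n} (M : Fin (suc n) → Fin (suc n) → Carrier) → det M ≈
    ∑ᶠ (suc n) λ j → (- 1#) ^ toℕ j * M zero j * det λ i k → M (suc i) (punchIn j k)
  det-expand M = sym (∑ᶠ-sum _ _)

  det-cong : ∀ {n} {M N : Fin n → Fin n → Carrier} → (∀ i j → M i j ≈ N i j) → det M ≈ det N
  det-cong {zero}          p = refl
  det-cong {suc n} {M} {N} p = begin
    det M  ≈⟨ det-expand M ⟩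
    _      ≈⟨ ∑ᶠ-cong (suc n) (λ j → *-cong (*-congˡ (p zero j))
        (det-cong λ i k → p (suc i) (punchIn j k))) ⟩
    _      ≈⟨ det-expand N ⟨
    det N  ∎

  -- In the expansion along the first row, the term of column 0 contains an entry of that column,
  -- and all other minors still contain the rest of it.
  det-zeroColumn : ∀ {n} (M : Fin (suc n) → Fin (suc n) → Carrier) → (∀ i → M i zero ≈ 0#) → det M ≈ 0#
  det-zeroColumn {n} M p = trans (det-expand M) (∑ᶠ-zeros (suc n) (go n M p))
    where
    go : ∀ n (M : Fin (suc n) → Fin (suc n) → Carrier) → (∀ i → M i zero ≈ 0#) → ∀ (j : Fin (suc n)) →
      (- 1#) ^ toℕ j * M zero j * det (λ i k → M (suc i) (punchIn j k)) ≈ 0#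
    go n       M p zero    = trans (*-congʳ (trans (*-congˡ (p zero)) (zeroʳ _))) (zeroˡ _)
    go (suc n) M p (suc j) = trans (*-congˡ
        (det-zeroColumn (λ i k → M (suc i) (punchIn (suc j) k))
        λ i → p (suc i))) (zeroʳ _)

  -- Minors are given as functions of an embedding of columns, and the embeddings that arise below
  -- agree only pointwise.
  Congruent : ∀ {n m} → ((Fin n → Fin m) → Carrier) → Set ℓ
  Congruent m = ∀ {f g} → (∀ i → f i ≡ g i) → m f ≈ m g

  -- The determinant with first two rows u and v, the minors of the remaining
  -- rows being given by m as a function of the embedding of their columns.
  twoRows : ∀ n → (u v : Fin (2 ℕ.+ n) → Carrier) → ((Fin n → Fin (2 ℕ.+ n)) → Carrier) → Carrier
  twoRows n u v m = ∑ᶠ (2 ℕ.+ n) λ j → (- 1#) ^ toℕ j * u j *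
    ∑ᶠ (suc n) λ k → (- 1#) ^ toℕ k * v (punchIn j k) * m (λ i → punchIn j (punchIn k i))

  module _ {n} (m : (Fin n → Fin (2 ℕ.+ n)) → Carrier) where

    -- Removing column 0 and column k + 1 leaves the same columns in either order, so both kinds of
    -- cross term involve these minors.
    minor : Fin (suc n) → Carrier
    minor k = m λ i → suc (punchIn k i)

    private
      rest : (v : Fin (2 ℕ.+ n) → Carrier) → Fin (suc n) → Carrier
      rest v j = ∑ᶠ n λ k → (- 1#) ^ toℕ k * v (suc (punchIn j k)) *
        m (λ i → punchIn (suc j) (punchIn (suc k) i))

    inner : (u v : Fin (2 ℕ.+ n) → Carrier) → Carrier
    inner u v = ∑ᶠ (suc n) λ j → (- 1#) ^ toℕ j * u (suc j) * rest v j

    cross : (u v : Fin (2 ℕ.+ n) → Carrier) → Carrier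
    cross u v = u zero * ∑ᶠ (suc n) λ k → (- 1#) ^ toℕ k * (v (suc k) * minor k)

    -- The terms in which the first, the second, or none of the two rows
    -- contributes its first entry.
    twoRows-split : ∀ u v → twoRows n u v m ≈ cross u v - cross v u + inner u v
    twoRows-split u v = begin
      twoRows n u v m
        ≈⟨ ∑ᶠ-suc (suc n) _ ⟩
      1# * u zero * ∑ᶠ (suc n) (λ k → (- 1#) ^ toℕ k * v (suc k) * minor k) +
      ∑ᶠ (suc n) (λ j → (- 1#) ^ suc (toℕ j) * u (suc j) * ∑ᶠ (suc n) λ k →
        (- 1#) ^ toℕ k * v (punchIn (suc j) k) * m (λ i → punchIn (suc j) (punchIn k i)))
        ≈⟨ +-cong (*-cong (*-identityˡ _) (∑ᶠ-cong (suc n) λ k → *-assoc _ _ _))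
                  (∑ᶠ-cong (suc n) split) ⟩
      cross u v + ∑ᶠ (suc n) (λ j → - (v zero * ((- 1#) ^ toℕ j * (u (suc j) * minor j))) +
                                   (- 1#) ^ toℕ j * u (suc j) * rest v j)
        ≈⟨ +-congˡ (∑ᶠ-+ (suc n) _ _) ⟩
      cross u v + (∑ᶠ (suc n) (λ j → - (v zero * ((- 1#) ^ toℕ j * (u (suc j) * minor j)))) + inner u v)
        ≈⟨ +-congˡ (+-congʳ (trans (∑ᶠ-neg (suc n) _) (-‿cong (sym (∑ᶠ-*ˡ (suc n) _ _))))) ⟩
      cross u v + (- cross v u + inner u v)
        ≈⟨ +-assoc _ _ _ ⟨
      cross u v - cross v u + inner u v ∎
      where
      neg³ : ∀ s a b → - 1# * s * a * b ≈ - (s * a * b)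
      neg³ s a b = begin
        - 1# * s * a * b   ≈⟨ *-congʳ (*-congʳ (-1*x≈-x s)) ⟩
        - s * a * b        ≈⟨ *-congʳ (-‿distribˡ-* s a) ⟨
        - (s * a) * b      ≈⟨ -‿distribˡ-* (s * a) b ⟨
        - (s * a * b)      ∎
      -- Passing from column j to j + 1 changes the sign once and from k to k + 1 once more, so that
      -- only the term with k = 0 keeps a minus sign.
      split : ∀ j → (- 1#) ^ suc (toℕ j) * u (suc j) * ∑ᶠ (suc n) (λ k →
                      (- 1#) ^ toℕ k * v (punchIn (suc j) k) * m (λ i → punchIn (suc j) (punchIn k i))) ≈
                    - (v zero * ((- 1#) ^ toℕ j * (u (suc j) * minor j))) +
                    (- 1#) ^ toℕ j * u (suc j) * rest v j
      split j = begin
        - 1# * s * u (suc j) * _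
          ≈⟨ neg³ s (u (suc j)) _ ⟩
        - (s * u (suc j) * _)
          ≈⟨ -‿cong (*-congˡ (trans (∑ᶠ-suc n _) (+-cong (*-congʳ (*-identityˡ _))
               (trans (∑ᶠ-cong n λ k → neg³ _ _ _) (∑ᶠ-neg n _))))) ⟩
        - (s * u (suc j) * (v zero * minor j + - rest v j))
          ≈⟨ -‿cong (distribˡ _ _ _) ⟩
        - (s * u (suc j) * (v zero * minor j) + s * u (suc j) * - rest v j)
          ≈⟨ -‿+-comm _ _ ⟨
        - (s * u (suc j) * (v zero * minor j)) + - (s * u (suc j) * - rest v j)
          ≈⟨ +-cong (-‿cong (solve 4 (λ s u v m → ((s ⊕ u) ⊕ (v ⊕ m)) ⊜ (v ⊕ (s ⊕ (u ⊕ m)))) refl _ _ _ _))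
                    (trans (-‿cong (sym (-‿distribʳ-* _ _))) (⁻¹-involutive _)) ⟩
        - (v zero * (s * (u (suc j) * minor j))) + s * u (suc j) * rest v j ∎
        where s = (- 1#) ^ toℕ j

  private
    extend : ∀ {n} → (Fin n → Fin (2 ℕ.+ n)) → Fin (suc n) → Fin (3 ℕ.+ n)
    extend f zero    = zero
    extend f (suc i) = suc (f i)

    extend-cong : ∀ {n} {f g : Fin n → Fin (2 ℕ.+ n)} → (∀ i → f i ≡ g i) → ∀ i → extend f i ≡ extend g i
    extend-cong p zero    = ≡.refl
    extend-cong p (suc i) = ≡.cong suc (p i)

  -- If neither row uses column 0, every remaining minor contains it; what the two rows see is a
  -- two-row expansion with one column fewer, which makes induction possible.
  inner-suc : ∀ {n} {m : (Fin (suc n) → Fin (3 ℕ.+ n)) → Carrier} → Congruent m → ∀ u v →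
    inner m u v ≈ twoRows n (λ j → u (suc j)) (λ j → v (suc j)) (λ f → m (extend f))
  inner-suc {n} {m} m-cong u v = ∑ᶠ-cong (2 ℕ.+ n) λ j → *-congˡ (∑ᶠ-cong (suc n) λ k → *-congˡ
    (m-cong {λ i → punchIn (suc j) (punchIn (suc k) i)} λ { zero → ≡.refl ; (suc i) → ≡.refl }))

  inner-zero : ∀ {m : (Fin 0 → Fin 2) → Carrier} u v → inner m u v ≈ 0#
  inner-zero u v = ∑ᶠ-zeros 1 λ j → trans (*-congˡ (∑ᶠ-zero _)) (zeroʳ _)

  -- Not a consequence of antisymmetry: in a general commutative ring x = - x does not imply x = 0.
  -- The two cross terms cancel, and the inner part is treated by induction.
  twoRows-diag : ∀ n {m : (Fin n → Fin (2 ℕ.+ n)) → Carrier} → Congruent m →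
                 ∀ u → twoRows n u u m ≈ 0#
  twoRows-diag n {m} m-cong u = begin
    twoRows n u u m                     ≈⟨ twoRows-split m u u ⟩
    cross m u u - cross m u u + inner m u u  ≈⟨ +-cong (-‿inverseʳ _) (go n m-cong u) ⟩
    0# + 0#                             ≈⟨ +-identityˡ _ ⟩
    0#                                  ∎
    where
    go : ∀ n {m : (Fin n → Fin (2 ℕ.+ n)) → Carrier} → Congruent m → ∀ u → inner m u u ≈ 0#
    go zero    {m} m-cong u = inner-zero {m} u u
    go (suc n) m-cong u = trans (inner-suc m-cong u u)
      (twoRows-diag n (λ p → m-cong (extend-cong p)) (λ j → u (suc j)))

  twoRows-swap : ∀ n {m : (Fin n → Fin (2 ℕ.+ n)) → Carrier} → Congruent m →
                 ∀ u v → twoRows n u v m ≈ - twoRows n v u m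
  twoRows-swap n {m} m-cong u v = begin
    twoRows n u v m                                     ≈⟨ twoRows-split m u v ⟩
    cross m u v - cross m v u + inner m u v             ≈⟨ +-cong (sym (⁻¹-anti-homo‿- _ _)) (go n m-cong u v) ⟩
    - (cross m v u - cross m u v) + - inner m v u       ≈⟨ -‿+-comm _ _ ⟩
    - (cross m v u - cross m u v + inner m v u)         ≈⟨ -‿cong (twoRows-split m v u) ⟨
    - twoRows n v u m                                   ∎
    where
    open import Algebra.Properties.AbelianGroup +-abelianGroup using (⁻¹-anti-homo‿-)
    go : ∀ n {m : (Fin n → Fin (2 ℕ.+ n)) → Carrier} → Congruent m → ∀ u v → inner m u v ≈ - inner m v u
    go zero    {m} m-cong u v = trans (inner-zero {m} u v)
      (trans (sym ε⁻¹≈ε) (-‿cong (sym (inner-zero {m} v u))))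
    go (suc n) m-cong u v = trans (inner-suc m-cong u v) (trans
      (twoRows-swap n (λ p → m-cong (extend-cong p)) (λ j → u (suc j)) (λ j → v (suc j)))
      (-‿cong (sym (inner-suc m-cong v u))))

  -- Only neighbouring entries are compared, which is all that insertion into a decreasing vector
  -- requires; the third component carries the condition to later positions.
  Alternating : ∀ {n} → (Vec ℕ n → Carrier) → Set ℓ
  Alternating {zero}        D = ⊤
  Alternating {suc zero}    D = ⊤
  Alternating {suc (suc n)} D =
    (∀ l L → D (l ∷ l ∷ L) ≈ 0#) ×
    (∀ k l L → D (k ∷ l ∷ L) ≈ - D (l ∷ k ∷ L)) ×
    (∀ l → Alternating λ L → D (l ∷ L))

  alternating-resp : ∀ n {D E : Vec ℕ n → Carrier} → (∀ L → D L ≈ E L) → Alternating D → Alternating E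
  alternating-resp zero          p _ = _
  alternating-resp (suc zero)    p _ = _
  alternating-resp (suc (suc n)) p (diag , swap , tail)
    = (λ l L → trans (sym (p _)) (diag l L))
    , (λ k l L → trans (sym (p _)) (trans (swap k l L) (-‿cong (p _))))
    , (λ l → alternating-resp (suc n) (λ L → p (l ∷ L)) (tail l))

  alternating-sum : ∀ n {m} (r : Fin m → Carrier) {D : Fin m → Vec ℕ n → Carrier} →
    (∀ j → Alternating (D j)) → Alternating (λ L → ∑ᶠ m λ j → r j * D j L)
  alternating-sum zero          r p = _
  alternating-sum (suc zero)    r p = _
  alternating-sum (suc (suc n)) {m} r p
    = (λ l L → ∑ᶠ-zeros m λ j → trans (*-congˡ (proj₁ (p j) l L)) (zeroʳ _))
    , (λ k l L → trans (∑ᶠ-cong m λ j → trans (*-congˡ (proj₁ (proj₂ (p j)) k l L)) (sym (-‿distribʳ-* _ _)))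
                       (∑ᶠ-neg m _))
    , (λ l → alternating-sum (suc n) r λ j → proj₂ (proj₂ (p j)) l)

  det-twoRows : ∀ {n} (M : Fin (2 ℕ.+ n) → Fin (2 ℕ.+ n) → Carrier) → det M ≈
    twoRows n (M zero) (M (suc zero)) λ f → det λ i k → M (suc (suc i)) (f k)
  det-twoRows {n} M = trans (det-expand M) (∑ᶠ-cong (2 ℕ.+ n) λ j → *-congˡ
    (det-expand λ i k → M (suc i) (punchIn j k)))

  -- The first two rows are covered by the two-row expansion. With the first row fixed, the
  -- determinant is a linear combination of minors, which alternate in the remaining rows by
  -- induction.
  det-alternating : ∀ n (N : ℕ → Fin n → Carrier) → Alternating λ L → det λ i j → N (lookup L i) j
  det-alternating zero          N = _
  det-alternating (suc zero)    N = _
  det-alternating (suc (suc n)) N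
    = (λ l L → trans (det-twoRows (λ i j → N (lookup (l ∷ l ∷ L) i) j)) (twoRows-diag n (minors-cong L) (N l)))
    , (λ k l L → trans (det-twoRows (λ i j → N (lookup (k ∷ l ∷ L) i) j))
        (trans (twoRows-swap n (minors-cong L) (N k) (N l))
                   (-‿cong (sym (det-twoRows (λ i j → N (lookup (l ∷ k ∷ L) i) j))))))
    , (λ l → alternating-resp (suc n) (λ L → sym (det-expand (λ i j → N (lookup (l ∷ L) i) j)))
               (alternating-sum (suc n) (λ j → (- 1#) ^ toℕ j * N l j) λ j →
                  det-alternating (suc n) λ l k → N l (punchIn j k)))
    where
    minors-cong : ∀ L → Congruent λ f → det λ i k → N (lookup L i) (f k)
    minors-cong L p = det-cong λ i k → reflexive (≡.cong (N (lookup L i)) (p k))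

  -- The alternating sum of F (entry of L, remaining entries of L).
  removals : ∀ {n} → (ℕ → Vec ℕ n → Carrier) → Vec ℕ (suc n) → Carrier
  removals {zero}  F (l ∷ []) = F l []
  removals {suc n} F (l ∷ L)  = F l L - removals (λ k K → F k (l ∷ K)) L

  -- Sorting the first argument of an alternating function into the other ones.
  ∑-insert : ∀ B n (F : ℕ → Vec ℕ n → Carrier) {D : Vec ℕ (suc n) → Carrier} → Alternating D →
    ∑ B (λ l → ∑ᴸ (λ L → F l L * D (l ∷ L)) (decreasing B n)) ≈
    ∑ᴸ (λ L → removals F L * D L) (decreasing B (suc n))
  ∑-insert zero    n       F alt = ∑-zero _
  ∑-insert (suc B) zero    F {D} alt = begin
    ∑ (suc B) (λ l → F l [] * D (l ∷ []) + 0#)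
      ≈⟨ ∑-snoc B (λ l → F l [] * D (l ∷ []) + 0#) ⟩
    ∑ B (λ l → F l [] * D (l ∷ []) + 0#) + (F B [] * D (B ∷ []) + 0#)
      ≈⟨ +-congʳ (∑-insert B zero F alt) ⟩
    ∑ᴸ (λ L → removals F L * D L) (decreasing B 1) + (F B [] * D (B ∷ []) + 0#)
      ≈⟨ ∑ᴸ-++ (λ L → removals F L * D L) (decreasing B 1) _ ⟨
    ∑ᴸ (λ L → removals F L * D L) (decreasing (suc B) 1) ∎
  ∑-insert (suc B) (suc n) F {D} alt@(diag , swap , tail) = begin
    ∑ (suc B) (λ l → ∑ᴸ (G l) (decreasing (suc B) (suc n)))
      ≈⟨ ∑-cong (suc B) (λ l _ → split (G l)) ⟩
    ∑ (suc B) (λ l → ∑ᴸ (G l) (decreasing B (suc n)) + ∑ᴸ (λ L → G l (B ∷ L)) (decreasing B n))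
      ≈⟨ ∑-snoc B _ ⟩
    ∑ B (λ l → ∑ᴸ (G l) (decreasing B (suc n)) + ∑ᴸ (λ L → G l (B ∷ L)) (decreasing B n)) +
    (∑ᴸ (G B) (decreasing B (suc n)) + ∑ᴸ (λ L → G B (B ∷ L)) (decreasing B n))
      ≈⟨ +-cong (∑-+ B _ _)
          (trans (+-congˡ (∑ᴸ-zero (λ L → trans (*-congˡ (diag B L)) (zeroʳ _)) (decreasing B n)))
          (+-identityʳ _)) ⟩
    ∑ B (λ l → ∑ᴸ (G l) (decreasing B (suc n))) +
    ∑ B (λ l → ∑ᴸ (λ L → G l (B ∷ L)) (decreasing B n)) + ∑ᴸ (G B) (decreasing B (suc n))
      ≈⟨ +-congʳ (+-cong (∑-insert B (suc n) F alt) moved) ⟩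
    ∑ᴸ H (decreasing B (suc (suc n))) + - ∑ᴸ H′ (decreasing B (suc n)) + ∑ᴸ (G B) (decreasing B (suc n))
      ≈⟨ trans (+-assoc _ _ _) (+-congˡ (+-comm _ _)) ⟩
    ∑ᴸ H (decreasing B (suc (suc n))) + (∑ᴸ (G B) (decreasing B (suc n)) + - ∑ᴸ H′ (decreasing B (suc n)))
      ≈⟨ +-congˡ (+-congˡ (∑ᴸ-neg H′ (decreasing B (suc n)))) ⟨
    ∑ᴸ H (decreasing B (suc (suc n))) +
        (∑ᴸ (G B) (decreasing B (suc n)) + ∑ᴸ (λ L → - H′ L) (decreasing B (suc n)))
      ≈⟨ +-congˡ (∑ᴸ-+ _ _ (decreasing B (suc n))) ⟨
    ∑ᴸ H (decreasing B (suc (suc n))) + ∑ᴸ (λ L → G B L - H′ L) (decreasing B (suc n))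
      ≈⟨ +-congˡ (∑ᴸ-cong (λ L → sym (trans (distribʳ _ _ _) (+-congˡ (sym (-‿distribˡ-* _ _)))))
          (decreasing B (suc n))) ⟩
    ∑ᴸ H (decreasing B (suc (suc n))) + ∑ᴸ (λ L → H (B ∷ L)) (decreasing B (suc n))
      ≈⟨ split H ⟨
    ∑ᴸ H (decreasing (suc B) (suc (suc n))) ∎
    where
    G : ℕ → Vec ℕ (suc n) → Carrier
    G l L = F l L * D (l ∷ L)
    H : Vec ℕ (suc (suc n)) → Carrier
    H L = removals F L * D L
    H′ : Vec ℕ (suc n) → Carrier
    H′ L = removals (λ k K → F k (B ∷ K)) L * D (B ∷ L)
    split : ∀ {n} (G : Vec ℕ (suc n) → Carrier) → ∑ᴸ G (decreasing (suc B) (suc n)) ≈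
            ∑ᴸ G (decreasing B (suc n)) + ∑ᴸ (λ L → G (B ∷ L)) (decreasing B n)
    split {n} G = trans (∑ᴸ-++ G (decreasing B (suc n)) _)
      (+-congˡ (reflexive (∑ᴸ-map G (B ∷_) (decreasing B n))))
    -- For l < B and a vector with head `B`, exchanging the two puts `B` in front; the sign of the
    -- exchange is the minus in `removals`. The case l = `B` with head `B` has vanished by `diag`.
    moved : ∑ B (λ l → ∑ᴸ (λ L → G l (B ∷ L)) (decreasing B n)) ≈ - ∑ᴸ H′ (decreasing B (suc n))
    moved = begin
      ∑ B (λ l → ∑ᴸ (λ L → F l (B ∷ L) * D (l ∷ B ∷ L)) (decreasing B n))
        ≈⟨ ∑-cong B (λ l _ → trans
             (∑ᴸ-cong (λ L → trans (*-congˡ (swap l B L)) (sym (-‿distribʳ-* _ _))) (decreasing B n))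
             (∑ᴸ-neg _ (decreasing B n))) ⟩
      ∑ B (λ l → - ∑ᴸ (λ L → F l (B ∷ L) * D (B ∷ l ∷ L)) (decreasing B n))
        ≈⟨ ∑-neg B _ ⟩
      - ∑ B (λ l → ∑ᴸ (λ L → F l (B ∷ L) * D (B ∷ l ∷ L)) (decreasing B n))
        ≈⟨ -‿cong (∑-insert B n (λ k K → F k (B ∷ K)) (tail B)) ⟩
      - ∑ᴸ H′ (decreasing B (suc n)) ∎

  -- Turns the signs collected while sorting into those of an expansion along the first row, the
  -- removed entry being the chosen column.
  removals-sum : ∀ {n} (F : ℕ → Vec ℕ n → Carrier) L →
    removals F L ≈ ∑ᶠ (suc n) λ j → (- 1#) ^ toℕ j * F (lookup L j) (Vec.removeAt L j)
  removals-sum {zero}  F (l ∷ []) = sym (trans (∑ᶠ-suc 0 _)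
    (trans (+-congˡ (∑ᶠ-zero _)) (trans (+-identityʳ _) (*-identityˡ _))))
  removals-sum {suc n} F (l ∷ L@(_ ∷ _)) = begin
    F l L - removals (λ k K → F k (l ∷ K)) L
      ≈⟨ +-cong (sym (*-identityˡ _)) (-‿cong (removals-sum (λ k K → F k (l ∷ K)) L)) ⟩
    1# * F l L - ∑ᶠ (suc n) (λ j → (- 1#) ^ toℕ j * F (lookup L j) (l ∷ Vec.removeAt L j))
      ≈⟨ +-congˡ (∑ᶠ-neg (suc n) _) ⟨
    1# * F l L + ∑ᶠ (suc n) (λ j → - ((- 1#) ^ toℕ j * F (lookup L j) (l ∷ Vec.removeAt L j)))
      ≈⟨ +-congˡ (∑ᶠ-cong (suc n) (λ j → trans (-‿distribˡ-* _ _) (*-congʳ (sym (-1*x≈-x _))))) ⟩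
    1# * F l L + ∑ᶠ (suc n) (λ j → (- 1#) ^ suc (toℕ j) * F (lookup L j) (l ∷ Vec.removeAt L j))
      ≈⟨ ∑ᶠ-suc (suc n) _ ⟨
    _ ∎

  lookup-removeAt : ∀ {n} (L : Vec ℕ (suc n)) j k → lookup (Vec.removeAt L j) k ≡ lookup L (punchIn j k)
  lookup-removeAt (_ ∷ _)     zero    k       = ≡.refl
  lookup-removeAt (_ ∷ _ ∷ _) (suc j) zero    = ≡.refl
  lookup-removeAt (_ ∷ L@(_ ∷ _)) (suc j) (suc k) = lookup-removeAt L j k

  -- After expansion along row 0 and induction on the minors, the sum over j for fixed l and `L` is
  -- itself an expansion, that of the determinant of `N` with rows `l ∷ L`. This alternates, so l
  -- can be sorted into `L`, and the signs that arise assemble the determinant of `W`.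
  cauchyBinet : ∀ n B (W : Fin n → ℕ → Carrier) (N : ℕ → Fin n → Carrier) →
    det (λ i j → ∑ B λ l → W i l * N l j) ≈
    ∑ᴸ (λ L → det (λ i j → W i (lookup L j)) * det (λ i j → N (lookup L i) j)) (decreasing B n)
  cauchyBinet zero    B W N = sym (trans (+-identityʳ _) (*-identityʳ _))
  cauchyBinet (suc n) B W N = begin
    det (λ i j → ∑ B λ l → W i l * N l j)
      ≈⟨ det-expand (λ i j → ∑ B λ l → W i l * N l j) ⟩
    ∑ᶠ (suc n) (λ j → (- 1#) ^ toℕ j * ∑ B (λ l → W zero l * N l j) *
               det (λ i k → ∑ B λ l → W (suc i) l * N l (punchIn j k)))
      ≈⟨ ∑ᶠ-cong (suc n) expand ⟩
    ∑ᶠ (suc n) (λ j → ∑ B λ l → ∑ᴸ (term j l) (decreasing B n))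
      ≈⟨ ∑ᶠ-∑-comm (suc n) B (λ j l → ∑ᴸ (term j l) (decreasing B n)) ⟩
    ∑ B (λ l → ∑ᶠ (suc n) λ j → ∑ᴸ (term j l) (decreasing B n))
      ≈⟨ ∑-cong B (λ l _ → trans (∑ᶠ-∑ᴸ-comm _ (λ j → term j l) (decreasing B n))
           (∑ᴸ-cong (λ L → trans (sym (∑ᶠ-*ˡ (suc n) _ _)) (*-congˡ
             (sym (det-expand (λ i j → N (lookup (l ∷ L) i) j))))) (decreasing B n))) ⟩
    ∑ B (λ l → ∑ᴸ (λ L → W zero l * w L * D (l ∷ L)) (decreasing B n))
      ≈⟨ ∑-insert B n (λ l L → W zero l * w L) (det-alternating (suc n) N) ⟩
    ∑ᴸ (λ L → removals (λ l L → W zero l * w L) L * D L) (decreasing B (suc n))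
      ≈⟨ ∑ᴸ-cong (λ L → *-congʳ (trans (removals-sum _ L)
          (trans (∑ᶠ-cong (suc n) λ j → trans (sym (*-assoc _ _ _))
           (*-congˡ (det-cong λ i k → reflexive (≡.cong (W (suc i)) (lookup-removeAt L j k)))))
           (sym (det-expand λ i j → W i (lookup L j))))))
           (decreasing B (suc n)) ⟩
    ∑ᴸ (λ L → det (λ i j → W i (lookup L j)) * D L) (decreasing B (suc n)) ∎
    where
    w : Vec ℕ n → Carrier
    w L = det λ i j → W (suc i) (lookup L j)
    D : Vec ℕ (suc n) → Carrier
    D L = det λ i j → N (lookup L i) j
    d : Fin (suc n) → Vec ℕ n → Carrier
    d j L = det λ i k → N (lookup L i) (punchIn j k)
    term : Fin (suc n) → ℕ → Vec ℕ n → Carrier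
    term j l L = W zero l * w L * ((- 1#) ^ toℕ j * N l j * d j L)
    expand : ∀ j → (- 1#) ^ toℕ j * ∑ B (λ l → W zero l * N l j) *
               det (λ i k → ∑ B λ l → W (suc i) l * N l (punchIn j k)) ≈
             ∑ B λ l → ∑ᴸ (term j l) (decreasing B n)
    expand j = begin
      s * ∑ B (λ l → W zero l * N l j) * det (λ i k → ∑ B λ l → W (suc i) l * N l (punchIn j k))
        ≈⟨ *-congˡ (cauchyBinet n B (λ i → W (suc i)) (λ l k → N l (punchIn j k))) ⟩
      s * ∑ B (λ l → W zero l * N l j) * ∑ᴸ (λ L → w L * d j L) (decreasing B n)
        ≈⟨ trans (*.xy∙z≈xz∙y _ _ _) (∑-*ˡ B _ _) ⟩
      ∑ B (λ l → s * ∑ᴸ (λ L → w L * d j L) (decreasing B n) * (W zero l * N l j))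
        ≈⟨ ∑-cong B (λ l _ → trans (trans (*.xy∙z≈xz∙y _ _ _) (∑ᴸ-*ˡ _ _ (decreasing B n))) (∑ᴸ-cong (λ L →
             solve 5 (λ s W N w d → ((s ⊕ (W ⊕ N)) ⊕ (w ⊕ d)) ⊜
                 ((W ⊕ w) ⊕ ((s ⊕ N) ⊕ d)))
                 refl s (W zero l) (N l j) (w L) (d j L)) (decreasing B n))) ⟩
      ∑ B (λ l → ∑ᴸ (term j l) (decreasing B n)) ∎
      where s = (- 1#) ^ toℕ j

-- `punchIn` on ℕ: without bounds in the types, shifts between blocks of a matrix are plain
-- arithmetic.
skip : ℕ → ℕ → ℕ
skip zero    k       = suc k
skip (suc j) zero    = zero
skip (suc j) (suc k) = suc (skip j k)

toℕ-punchIn : ∀ {n} (j : Fin (suc n)) k → toℕ (punchIn j k) ≡ skip (toℕ j) (toℕ k)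
toℕ-punchIn zero    k       = ≡.refl
toℕ-punchIn (suc j) zero    = ≡.refl
toℕ-punchIn (suc j) (suc k) = ≡.cong suc (toℕ-punchIn j k)

skip-≤ : ∀ j k → skip j k ≤ suc k
skip-≤ zero    k       = ℕₚ.≤-refl
skip-≤ (suc j) zero    = z≤n
skip-≤ (suc j) (suc k) = s≤s (skip-≤ j k)

skip-≥ : ∀ {j k} → j ≤ k → skip j k ≡ suc k
skip-≥ z≤n     = ≡.refl
skip-≥ (s≤s p) = ≡.cong suc (skip-≥ p)

skip-< : ∀ {j k} → k < j → skip j k ≡ k
skip-< {k = zero}  (s≤s p) = ≡.refl
skip-< {k = suc k} (s≤s p) = ≡.cong suc (skip-< p)

-- Determinants of the leading n × n submatrices of matrices indexed by ℕ

module BlockDeterminants (R : CommutativeRing c ℓ) where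

  open CommutativeRing R hiding (zero)
  open RingOps R
  open Sums R
  open Determinants R
  open import Algebra.Solver.CommutativeMonoid *-commutativeMonoid using (solve; _⊜_; _⊕_)
  import Algebra.Properties.CommutativeSemigroup *-commutativeSemigroup as *
  open import Relation.Binary.Reasoning.Setoid setoid

  det< : ℕ → (ℕ → ℕ → Carrier) → Carrier
  det< n M = det {n} λ i j → M (toℕ i) (toℕ j)

  minor< : ℕ → (ℕ → ℕ → Carrier) → ℕ → ℕ → Carrier
  minor< j M i k = M (suc i) (skip j k)

  det<-cong : ∀ n {M N} → (∀ i j → i < n → j < n → M i j ≈ N i j) → det< n M ≈ det< n N
  det<-cong n p = det-cong λ i j → p (toℕ i) (toℕ j) (toℕ<n i) (toℕ<n j)

  det<-expand : ∀ n M → det< (suc n) M ≈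
    ∑ (suc n) λ j → (- 1#) ^ j * M 0 j * det< n (minor< j M)
  det<-expand n M = begin
    det< (suc n) M  ≈⟨ det-expand (λ i j → M (toℕ i) (toℕ j)) ⟩
    _               ≈⟨ ∑ᶠ-cong (suc n) (λ j → *-congˡ (det-cong λ i k →
                         reflexive (≡.cong (M (suc (toℕ i))) (toℕ-punchIn j k)))) ⟩
    _               ≈⟨ ∑-∑ᶠ (suc n) (λ j → (- 1#) ^ j * M 0 j * det< n (minor< j M)) ⟩
    _               ∎

  det<-zeros : ∀ n M → (∀ j → j < suc n → M 0 j ≈ 0# ⊎ det< n (minor< j M) ≈ 0#) → det< (suc n) M ≈ 0#
  det<-zeros n M p = trans (det<-expand n M) (∑-zeros (suc n) λ j j<n → zero-term (p j j<n))
    where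
    zero-term : ∀ {s a d} → a ≈ 0# ⊎ d ≈ 0# → s * a * d ≈ 0#
    zero-term (inj₁ a≈0) = trans (*-congʳ (trans (*-congˡ a≈0) (zeroʳ _))) (zeroˡ _)
    zero-term (inj₂ d≈0) = trans (*-congˡ d≈0) (zeroʳ _)

  -- The zero block has n - m rows and m + 1 columns, together more than n, as in the
  -- Frobenius-König theorem. Removing row 0 and any column leaves such a block in size n - 1, until
  -- m = 0, where column 0 is zero.
  det<-lowerLeft : ∀ m n M → m < n → (∀ i j → m ≤ i → i < n → j ≤ m → M i j ≈ 0#) → det< n M ≈ 0#
  det<-lowerLeft m (suc n) M (s≤s m≤n) p = det<-zeros n M (go m m≤n p)
    where
    go : ∀ m → m ≤ n → (∀ i j → m ≤ i → i < suc n → j ≤ m → M i j ≈ 0#) →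
         ∀ j → j < suc n → M 0 j ≈ 0# ⊎ det< n (minor< j M) ≈ 0#
    go zero    m≤n p zero    _        = inj₁ (p 0 0 z≤n (s≤s z≤n) z≤n)
    go zero    m≤n p (suc j) (s≤s j<n) = inj₂ (det<-lowerLeft 0 n (minor< (suc j) M)
      (ℕₚ.≤-<-trans z≤n j<n) λ { i zero _ i<n _ → p (suc i) 0 z≤n (s≤s i<n) z≤n })
    go (suc m) m<n p j       _        = inj₂ (det<-lowerLeft m n (minor< j M) m<n λ i k m≤i i<n k≤m →
      p (suc i) (skip j k) (s≤s m≤i) (s≤s i<n) (ℕₚ.≤-trans (skip-≤ j k) (s≤s k≤m)))

  -- The zero block has m + 1 rows and n - m columns. Only the columns to its left contribute to the
  -- expansion along row 0, and removing one of them moves the block one place up and to the left.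
  det<-upperRight : ∀ m n M → m < n → (∀ i j → i ≤ m → m ≤ j → j < n → M i j ≈ 0#) → det< n M ≈ 0#
  det<-upperRight zero    (suc n) M _         p = det<-zeros n M λ j j<n → inj₁ (p 0 j z≤n z≤n j<n)
  det<-upperRight (suc m) (suc n) M (s≤s m<n) p = det<-zeros n M go
    where
    go : ∀ j → j < suc n → M 0 j ≈ 0# ⊎ det< n (minor< j M) ≈ 0#
    go j j<n with ℕₚ.≤-<-connex (suc m) j
    ... | inj₁ m<j       = inj₁ (p 0 j z≤n m<j j<n)
    ... | inj₂ (s≤s j≤m) = inj₂ (det<-upperRight m n (minor< j M) m<n λ i k i≤m m≤k k<n →
      trans (reflexive (≡.cong (M (suc i)) (skip-≥ (ℕₚ.≤-trans j≤m m≤k))))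
            (p (suc i) (suc k) (s≤s i≤m) (s≤s m≤k) (s≤s k<n)))

  -- In the expansion along row 0, a column of the first block leaves a block triangular minor. Any
  -- other column leaves all columns of the first block in a minor with one row fewer above the
  -- zeros, and `det<-lowerLeft` applies.
  det<-blockTriangular : ∀ m n M → (∀ i j → m ≤ i → i < m ℕ.+ n → j < m → M i j ≈ 0#) →
    det< (m ℕ.+ n) M ≈ det< m M * det< n λ i j → M (m ℕ.+ i) (m ℕ.+ j)
  det<-blockTriangular zero    n M p = sym (*-identityˡ _)
  det<-blockTriangular (suc m) n M p = begin
    det< (suc m ℕ.+ n) M
      ≈⟨ det<-expand (m ℕ.+ n) M ⟩
    ∑ (suc m ℕ.+ n) (λ j → (- 1#) ^ j * M 0 j * det< (m ℕ.+ n) (minor< j M))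
      ≈⟨ ∑-++ (suc m) n _ ⟩
    ∑ (suc m) (λ j → (- 1#) ^ j * M 0 j * det< (m ℕ.+ n) (minor< j M)) +
    ∑ n (λ k → (- 1#) ^ (suc m ℕ.+ k) * M 0 (suc m ℕ.+ k) * det< (m ℕ.+ n) (minor< (suc m ℕ.+ k) M))
      ≈⟨ +-cong (∑-cong (suc m) λ j j≤m → near j j≤m) (∑-zeros n far) ⟩
    ∑ (suc m) (λ j → D * ((- 1#) ^ j * M 0 j * det< m (minor< j M))) + 0#
      ≈⟨ +-identityʳ _ ⟩
    ∑ (suc m) (λ j → D * ((- 1#) ^ j * M 0 j * det< m (minor< j M)))
      ≈⟨ ∑-*ˡ (suc m) D _ ⟨
    D * ∑ (suc m) (λ j → (- 1#) ^ j * M 0 j * det< m (minor< j M))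
      ≈⟨ *-congˡ (det<-expand m M) ⟨
    D * det< (suc m) M
      ≈⟨ *-comm _ _ ⟩
    det< (suc m) M * D ∎
    where
    D = det< n λ i j → M (suc m ℕ.+ i) (suc m ℕ.+ j)
    near : ∀ j → j < suc m → (- 1#) ^ j * M 0 j * det< (m ℕ.+ n) (minor< j M) ≈
                             D * ((- 1#) ^ j * M 0 j * det< m (minor< j M))
    near j (s≤s j≤m) = begin
      (- 1#) ^ j * M 0 j * det< (m ℕ.+ n) (minor< j M)
        ≈⟨ *-congˡ (det<-blockTriangular m n (minor< j M) λ i k m≤i i<m+n k<m →
             p (suc i) (skip j k) (s≤s m≤i) (s≤s i<m+n) (ℕₚ.≤-<-trans (skip-≤ j k) (s≤s k<m))) ⟩
      (- 1#) ^ j * M 0 j * (det< m (minor< j M) * det< n λ i k → minor< j M (m ℕ.+ i) (m ℕ.+ k))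
        ≈⟨ *-congˡ (*-congˡ (det<-cong n λ i k _ _ → reflexive (≡.cong (M (suc m ℕ.+ i))
             (skip-≥ (ℕₚ.≤-trans j≤m (ℕₚ.m≤m+n m k)))))) ⟩
      (- 1#) ^ j * M 0 j * (det< m (minor< j M) * D)
        ≈⟨ *.x∙yz≈z∙xy _ _ _ ⟩
      D * ((- 1#) ^ j * M 0 j * det< m (minor< j M)) ∎
    far : ∀ k → k < n → (- 1#) ^ (suc m ℕ.+ k) * M 0 (suc m ℕ.+ k) *
        det< (m ℕ.+ n) (minor< (suc m ℕ.+ k) M) ≈ 0#
    far k k<n = trans (*-congˡ (det<-lowerLeft m (m ℕ.+ n) (minor< (suc m ℕ.+ k) M)
      (ℕₚ.m<m+n m (ℕₚ.≤-<-trans z≤n k<n)) λ i j m≤i i<m+n j≤m →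
        trans (reflexive (≡.cong (M (suc i)) (skip-< {suc m ℕ.+ k} (s≤s (ℕₚ.≤-trans j≤m (ℕₚ.m≤m+n m k))))))
              (p (suc i) j (s≤s m≤i) (s≤s i<m+n) (s≤s j≤m)))) (zeroʳ _)

  det<-unitriangular : ∀ n M → (∀ i j → i < n → j < i → M i j ≈ 0#) → (∀ i → i < n → M i i ≈ 1#) →
                       det< n M ≈ 1#
  det<-unitriangular zero    M lower diag = refl
  det<-unitriangular (suc n) M lower diag = begin
    det< (suc n) M
      ≈⟨ det<-blockTriangular 1 n M
          (λ { (suc i) zero _ i<n _ → lower (suc i) 0 i<n (s≤s z≤n) ; i (suc j) _ _ (s≤s ())
          ; zero j () _ _ }) ⟩
    (1# * M 0 0 * 1# + 0#) * det< n (λ i j → M (suc i) (suc j))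
      ≈⟨ *-cong (trans (+-identityʳ _) (trans (*-identityʳ _) (*-identityˡ _)))
                (det<-unitriangular n _ (λ i j i<n j<i → lower (suc i) (suc j) (s≤s i<n) (s≤s j<i))
                                        (λ i i<n → diag (suc i) (s≤s i<n))) ⟩
    M 0 0 * 1#
      ≈⟨ trans (*-identityʳ _) (diag 0 (s≤s z≤n)) ⟩
    1# ∎

  Π-skip : ∀ n j τ → j < suc n → τ j * Π n (λ k → τ (skip j k)) ≈ Π (suc n) τ
  Π-skip n       zero    τ _         = refl
  Π-skip (suc n) (suc j) τ (s≤s j<n) = trans (*.x∙yz≈y∙xz _ _ _)
    (*-congˡ (Π-skip n j (λ k → τ (suc k)) j<n))

  det<-scale : ∀ n σ τ M → det< n (λ i j → σ i * τ j * M i j) ≈ Π n σ * Π n τ * det< n M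
  det<-scale zero    σ τ M = sym (trans (*-identityʳ _) (*-identityʳ _))
  det<-scale (suc n) σ τ M = begin
    det< (suc n) (λ i j → σ i * τ j * M i j)
      ≈⟨ det<-expand n (λ i j → σ i * τ j * M i j) ⟩
    ∑ (suc n) (λ j → (- 1#) ^ j * (σ 0 * τ j * M 0 j) * det< n (minor< j (λ i j → σ i * τ j * M i j)))
      ≈⟨ ∑-cong (suc n) (λ j j<n → begin
        (- 1#) ^ j * (σ 0 * τ j * M 0 j) * det< n (minor< j (λ i j → σ i * τ j * M i j))
          ≈⟨ *-congˡ (det<-scale n (λ i → σ (suc i)) (λ k → τ (skip j k)) (minor< j M)) ⟩
        (- 1#) ^ j * (σ 0 * τ j * M 0 j) *
            (Π n (λ i → σ (suc i)) * Π n (λ k → τ (skip j k)) * det< n (minor< j M))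
          ≈⟨ solve 7 (λ s σ τ m p q d → ((s ⊕ ((σ ⊕ τ) ⊕ m)) ⊕ ((p ⊕ q) ⊕ d)) ⊜
              (((σ ⊕ p) ⊕ (τ ⊕ q)) ⊕ ((s ⊕ m) ⊕ d)))
              refl _ _ _ _ _ _ _ ⟩
        Π (suc n) σ * (τ j * Π n (λ k → τ (skip j k))) * ((- 1#) ^ j * M 0 j * det< n (minor< j M))
          ≈⟨ *-congʳ (*-congˡ (Π-skip n j τ j<n)) ⟩
        Π (suc n) σ * Π (suc n) τ * ((- 1#) ^ j * M 0 j * det< n (minor< j M)) ∎) ⟩
    ∑ (suc n) (λ j → Π (suc n) σ * Π (suc n) τ * ((- 1#) ^ j * M 0 j * det< n (minor< j M)))
      ≈⟨ ∑-*ˡ (suc n) _ _ ⟨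
    Π (suc n) σ * Π (suc n) τ * ∑ (suc n) (λ j → (- 1#) ^ j * M 0 j * det< n (minor< j M))
      ≈⟨ *-congˡ (det<-expand n M) ⟨
    Π (suc n) σ * Π (suc n) τ * det< (suc n) M ∎

m<n⇒m⊖n≡-[1+] : ∀ {m n} → m < n → ∃ λ k → m ⊖ n ≡ -[1+ k ]
m<n⇒m⊖n≡-[1+] {zero}  (s≤s {n = n} p) = n , ≡.refl
m<n⇒m⊖n≡-[1+] {suc m} {suc n} (s≤s p) =
  proj₁ (m<n⇒m⊖n≡-[1+] p) , ≡.trans ([1+m]⊖[1+n]≡m⊖n m n) (proj₂ (m<n⇒m⊖n≡-[1+] p))

-- Elementary and complete symmetric polynomials in integer degrees

module Symmetric (R : CommutativeRing c ℓ) where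

  open CommutativeRing R hiding (zero) public
  open RingOps R public
  open import Algebra.Properties.Ring ring using (-1*x≈-x) public
  open import Algebra.Properties.Group +-group using (⁻¹-involutive) public
  open import Algebra.Solver.Ring.NaturalCoefficients.Default commutativeSemiring
    using (solve; _:=_; _:*_; _:+_) public

  -- With the degree written as `p ⊖ r`, lowering it by one is raising r. The recursion then holds
  -- in all integer degrees, the last term being zero from degree 0 downwards; likewise for `h-∷`.
  e-∷ : ∀ p r v vs → e (p ⊖ r) (v ∷ vs) ≈ e (p ⊖ r) vs + v * e (p ⊖ suc r) vs
  e-∷ zero    zero    v vs = sym (trans (+-congˡ (zeroʳ v)) (+-identityʳ _))
  e-∷ zero    (suc r) v vs = sym (trans (+-congˡ (zeroʳ v)) (+-identityʳ _))
  e-∷ (suc p) zero    v vs = refl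
  e-∷ (suc p) (suc r) v vs
    rewrite [1+m]⊖[1+n]≡m⊖n p r | [1+m]⊖[1+n]≡m⊖n p (suc r) = e-∷ p r v vs

  h-∷ : ∀ p r v vs → h (p ⊖ r) (v ∷ vs) ≈ h (p ⊖ r) vs + v * h (p ⊖ suc r) (v ∷ vs)
  h-∷ zero    zero    v vs = sym (trans (+-congˡ (zeroʳ v)) (+-identityʳ _))
  h-∷ zero    (suc r) v vs = sym (trans (+-congˡ (zeroʳ v)) (+-identityʳ _))
  h-∷ (suc p) zero    v vs = refl
  h-∷ (suc p) (suc r) v vs
    rewrite [1+m]⊖[1+n]≡m⊖n p r | [1+m]⊖[1+n]≡m⊖n p (suc r) = h-∷ p r v vs

  e-< : ∀ {p r} vs → p < r → e (p ⊖ r) vs ≈ 0#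
  e-< vs p<r rewrite proj₂ (m<n⇒m⊖n≡-[1+] p<r) = refl

  h-< : ∀ {p r} vs → p < r → h (p ⊖ r) vs ≈ 0#
  h-< vs p<r rewrite proj₂ (m<n⇒m⊖n≡-[1+] p<r) = refl

  h-≡ : ∀ p vs → h (p ⊖ p) vs ≈ 1#
  h-≡ p vs rewrite ℤₚ.n⊖n≡0 p = refl

  h-[] : ∀ {p r} → r < p → h (p ⊖ r) [] ≈ 0#
  h-[] {suc p} {zero}  _         = refl
  h-[] {suc p} {suc r} (s≤s r<p) rewrite [1+m]⊖[1+n]≡m⊖n p r = h-[] r<p

  -- The degree exceeds the number of variables. The excess is left arbitrary because it grows when
  -- a variable is dropped at the same degree.
  eℕ-applyUpTo : ∀ (β : ℕ → Carrier) p j → eℕ (suc (p ℕ.+ j)) (applyUpTo β p) ≈ 0#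
  eℕ-applyUpTo β zero    j = refl
  eℕ-applyUpTo β (suc p) j = trans (+-cong
    (trans (reflexive (≡.cong (λ k → eℕ (suc k) (applyUpTo (λ i → β (suc i)) p))
        (≡.sym (ℕₚ.+-suc p j))))
        (eℕ-applyUpTo (λ i → β (suc i)) p (suc j)))
    (trans (*-congˡ (eℕ-applyUpTo (λ i → β (suc i)) p j)) (zeroʳ _))) (+-identityʳ _)

-- Expansions of the powers of an element x of an R-algebra T

module Expansions (R : CommutativeRing c ℓ) (T : CommutativeRing c′ ℓ′)
  {C : CommutativeRing.Carrier R → CommutativeRing.Carrier T}
  (isHom : IsRingHomomorphism (CommutativeRing.rawRing R) (CommutativeRing.rawRing T) C) where

  open CommutativeRing T hiding (zero)
  open RingOps T using (_^_; Πᴸ)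
  open Sums T
  open IsRingHomomorphism isHom
      renaming (+-homo to C-+; *-homo to C-*; 0#-homo to C-0
      ; 1#-homo to C-1; -‿homo to C-neg; ⟦⟧-cong to C-cong)
  open import Algebra.Solver.Ring.NaturalCoefficients.Default commutativeSemiring
      using (solve; _:=_; _:*_; _:+_; con)
  open import Algebra.Properties.Ring ring using (-‿distribˡ-*)
  open import Relation.Binary.Reasoning.Setoid setoid
  private
    module R = Symmetric R

  C-det : ∀ {n} (M : Fin n → Fin n → R.Carrier) → C (R.det M) ≈ RingOps.det T λ i j → C (M i j)
  C-det {zero}  M = C-1
  C-det {suc n} M = go (suc n) λ j → trans (C-* ((R.- R.1#) R.^ toℕ j R.* M zero j) _) (*-cong
    (trans (C-* ((R.- R.1#) R.^ toℕ j) (M zero j)) (*-congʳ (C-sign (toℕ j))))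
    (C-det λ i k → M (suc i) (punchIn j k)))
    where
    C-sign : ∀ k → C ((R.- R.1#) R.^ k) ≈ (- 1#) ^ k
    C-sign zero    = C-1
    C-sign (suc k) = trans (C-* _ _) (*-cong (trans (C-neg _) (-‿cong C-1)) (C-sign k))
    go : ∀ n {f g} → (∀ j → C (f j) ≈ g j) → C (R.sum {n} f) ≈ RingOps.sum T {n} g
    go zero    p = C-0
    go (suc n) p = trans (C-+ _ _) (+-cong (p zero) (go n λ j → p (suc j)))

  module _ (x : Carrier) where

    linearProduct : (ℕ → R.Carrier) → ℕ → Carrier
    linearProduct b m = Πᴸ (map (λ r → 1# - C r * x) (applyUpTo b m))

    lowerTerm : (ℕ → R.Carrier) → ℕ → ℕ → ℕ → Carrier
    lowerTerm b n k l = C (R.h (l ⊖ k) (applyUpTo b (n ∸ l))) * (x ^ l * linearProduct b (n ∸ suc l))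

    lowerExpansion-zero : ∀ n b {k} → n ≤ k → ∑ n (lowerTerm b n k) ≈ 0#
    lowerExpansion-zero n b n≤k = ∑-zeros n λ l l<n → trans
      (*-congʳ (trans (C-cong (R.h-< _ (ℕₚ.<-≤-trans l<n n≤k))) C-0)) (zeroˡ _)

    -- Split each `h` by its first variable `b 0`. The terms without it have the common factor 1 -
    -- b₀x for l < m, leaving the sum for the shifted parameters; at l = m the product is empty and
    -- x ^ m remains. The terms with `b 0` form the sum for k + 1.
    lowerExpansion-suc : ∀ m b k → let b′ = λ i → b (suc i) in
      ∑ (suc m) (lowerTerm b (suc m) k) ≈
      (1# - C (b 0) * x) * ∑ m (lowerTerm b′ m k) + C (R.h (m ⊖ k) []) * x ^ m +
      C (b 0) * ∑ (suc m) (lowerTerm b (suc m) (suc k))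
    lowerExpansion-suc m b k = begin
      ∑ (suc m) (lowerTerm b (suc m) k)
        ≈⟨ ∑-cong (suc m) (λ l l≤m → pascal l (ℕₚ.≤-pred l≤m)) ⟩
      ∑ (suc m) (λ l → first l + C (b 0) * lowerTerm b (suc m) (suc k) l)
        ≈⟨ ∑-+ (suc m) _ _ ⟩
      ∑ (suc m) first + ∑ (suc m) (λ l → C (b 0) * lowerTerm b (suc m) (suc k) l)
        ≈⟨ +-cong (∑-snoc m first) (sym (∑-*ˡ (suc m) _ _)) ⟩
      ∑ m first + first m + C (b 0) * ∑ (suc m) (lowerTerm b (suc m) (suc k))
        ≈⟨ +-congʳ (+-cong (trans (∑-cong m below) (sym (∑-*ˡ m _ _))) top) ⟩
      (1# - C (b 0) * x) * ∑ m (lowerTerm b′ m k) + C (R.h (m ⊖ k) []) * x ^ m +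
      C (b 0) * ∑ (suc m) (lowerTerm b (suc m) (suc k)) ∎
      where
      b′ : ℕ → R.Carrier
      b′ i = b (suc i)
      first : ℕ → Carrier
      first l = C (R.h (l ⊖ k) (applyUpTo b′ (m ∸ l))) * (x ^ l * linearProduct b (m ∸ l))
      pascal : ∀ l → l ≤ m → lowerTerm b (suc m) k l ≈ first l + C (b 0) * lowerTerm b (suc m) (suc k) l
      pascal l l≤m rewrite ℕₚ.+-∸-assoc 1 l≤m = begin
        C (R.h (l ⊖ k) (b 0 ∷ applyUpTo b′ (m ∸ l))) * (x ^ l * linearProduct b (m ∸ l))
          ≈⟨ *-congʳ (trans (C-cong (R.h-∷ l k _ _)) (trans (C-+ _ _) (+-congˡ (C-* _ _)))) ⟩
        (C (R.h (l ⊖ k) (applyUpTo b′ (m ∸ l))) + C (b 0) * C (R.h (l ⊖ suc k) (b 0 ∷ applyUpTo b′ (m ∸ l)))) *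
          (x ^ l * linearProduct b (m ∸ l))
          ≈⟨ solve 4 (λ p q r s → (p :+ q :* r) :* s := p :* s :+ q :* (r :* s)) refl _ _ _ _ ⟩
        _ ∎
      below : ∀ l → l < m → first l ≈ (1# - C (b 0) * x) * lowerTerm b′ m k l
      below l l<m rewrite ℕₚ.+-∸-assoc 1 l<m =
        solve 4 (λ h p q r → h :* (p :* (q :* r)) := q :* (h :* (p :* r))) refl _ _ _ _
      top : first m ≈ C (R.h (m ⊖ k) []) * x ^ m
      top rewrite ℕₚ.n∸n≡0 m = *-congˡ (*-identityʳ _)

    -- Induction on n - k - 1, which is smaller by one in both sums of `lowerExpansion-suc`; they
    -- recombine as (1 - b₀x) x ^ k + b₀ x ^ (k + 1) = x ^ k. When n = k + 1 only the middle term
    -- survives.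
    lowerExpansion : ∀ n b {k} → k < n → ∑ n (lowerTerm b n k) ≈ x ^ k
    lowerExpansion n b {k} k<n = ≡.subst (λ n → ∑ n (lowerTerm b n k) ≈ x ^ k)
        (ℕₚ.m+[n∸m]≡n k<n) (go (n ∸ suc k) k b)
      where
      go : ∀ j k b → ∑ (suc k ℕ.+ j) (lowerTerm b (suc k ℕ.+ j) k) ≈ x ^ k
      go zero    k b rewrite ℕₚ.+-identityʳ k = begin
        ∑ (suc k) (lowerTerm b (suc k) k)
          ≈⟨ lowerExpansion-suc k b k ⟩
        (1# - C (b 0) * x) * ∑ k (lowerTerm _ k k) + C (R.h (k ⊖ k) []) * x ^ k +
            C (b 0) * ∑ (suc k) (lowerTerm b (suc k) (suc k))
          ≈⟨ +-cong (+-cong (*-congˡ (lowerExpansion-zero k _ ℕₚ.≤-refl))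
              (*-congʳ (trans (C-cong (R.h-≡ k [])) C-1)))
                    (*-congˡ (lowerExpansion-zero (suc k) b ℕₚ.≤-refl)) ⟩
        (1# - C (b 0) * x) * 0# + 1# * x ^ k + C (b 0) * 0#
          ≈⟨ solve 3 (λ p q r → p :* con 0 :+ con 1 :* q :+ r :* con 0 := q) refl _ _ _ ⟩
        x ^ k ∎
      go (suc j) k b = begin
        ∑ (suc (k ℕ.+ suc j)) (lowerTerm b (suc (k ℕ.+ suc j)) k)
          ≈⟨ lowerExpansion-suc (k ℕ.+ suc j) b k ⟩
        (1# - C (b 0) * x) * ∑ (k ℕ.+ suc j) (lowerTerm b′ (k ℕ.+ suc j) k) +
            C (R.h ((k ℕ.+ suc j) ⊖ k) []) * x ^ (k ℕ.+ suc j) +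
        C (b 0) * ∑ (suc (k ℕ.+ suc j)) (lowerTerm b (suc (k ℕ.+ suc j)) (suc k))
          ≈⟨ +-cong (+-cong (*-congˡ IH₁)
              (*-congʳ (trans (C-cong (R.h-[] (ℕₚ.m<m+n k (s≤s z≤n)))) C-0)))
              (*-congˡ IH₂) ⟩
        (1# - C (b 0) * x) * x ^ k + 0# * x ^ (k ℕ.+ suc j) + C (b 0) * (x * x ^ k)
          ≈⟨ +-congʳ (trans (+-cong (trans (distribʳ _ _ _)
              (+-cong (*-identityˡ _) (sym (-‿distribˡ-* _ _))))
              (zeroˡ _)) (+-identityʳ _)) ⟩
        x ^ k - C (b 0) * x * x ^ k + C (b 0) * (x * x ^ k)
          ≈⟨ trans (+-assoc _ _ _) (+-congˡ (trans (+-congˡ (sym (*-assoc _ _ _))) (-‿inverseˡ _))) ⟩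
        x ^ k + 0#
          ≈⟨ +-identityʳ _ ⟩
        x ^ k ∎
        where
        b′ : ℕ → R.Carrier
        b′ i = b (suc i)
        IH₁ : ∑ (k ℕ.+ suc j) (lowerTerm b′ (k ℕ.+ suc j) k) ≈ x ^ k
        IH₁ rewrite ℕₚ.+-suc k j = go j k b′
        IH₂ : ∑ (suc (k ℕ.+ suc j)) (lowerTerm b (suc (k ℕ.+ suc j)) (suc k)) ≈ x ^ suc k
        IH₂ rewrite ℕₚ.+-suc k j = go j (suc k) b

    module _ (g : R.Carrier → Carrier) (g-inverse : ∀ r → (1# - C r * x) * g r ≈ 1#) where

      inverseProduct : (ℕ → R.Carrier) → ℕ → Carrier
      inverseProduct β m = Πᴸ (map g (applyUpTo β m))

      -- Here p and r stand for l - n and k - n. The exponent p + r has the parity of p - r and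
      -- avoids a subtraction.
      upperCoeff : (ℕ → R.Carrier) → ℕ → ℕ → R.Carrier
      upperCoeff β r p = (R.- R.1#) R.^ (p ℕ.+ r) R.* R.e (p ⊖ r) (applyUpTo β p)

      upperTerm : (ℕ → R.Carrier) → ℕ → ℕ → Carrier
      upperTerm β r p = C (upperCoeff β r p) * (x ^ p * inverseProduct β (suc p))

      private

        upperCoeff-suc-suc : ∀ β r p → C (upperCoeff β (suc r) (suc p)) ≈
          C (upperCoeff (λ i → β (suc i)) r p) + - C (β 0) * C (upperCoeff (λ i → β (suc i)) (suc r) p)
        upperCoeff-suc-suc β r p = trans (C-cong step)
          (trans (C-+ _ _) (+-congˡ (trans (C-* _ _) (*-congʳ (C-neg _)))))
          where
          β′ : ℕ → R.Carrier
          β′ i = β (suc i)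
          step : upperCoeff β (suc r) (suc p) R.≈ upperCoeff β′ r p R.+ R.- β 0 R.* upperCoeff β′ (suc r) p
          step rewrite ℕₚ.+-suc p r | [1+m]⊖[1+n]≡m⊖n p r = R.trans
            (R.*-congˡ (R.e-∷ p r (β 0) _)) (R.trans
            (R.solve 5 (λ n s b E F → (n R.:* (n R.:* s)) R.:* (E R.:+ b R.:* F) R.:=
                                      (n R.:* n) R.:* (s R.:* E) R.:+ (n R.:* b) R.:* ((n R.:* s) R.:* F)) R.refl
               (R.- R.1#) ((R.- R.1#) R.^ (p ℕ.+ r)) (β 0) _ _)
            (R.+-cong (R.trans (R.*-congʳ (R.trans (R.-1*x≈-x _) (R.⁻¹-involutive _))) (R.*-identityˡ _))
                      (R.*-congʳ (R.-1*x≈-x _))))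

        -- The elementary polynomial of top degree is the product of its variables, so the summand
        -- without `β 0` drops out; this is why r = 0 is a separate case.
        upperCoeff-suc-zero : ∀ β p → C (upperCoeff β 0 (suc p)) ≈
            - C (β 0) * C (upperCoeff (λ i → β (suc i)) 0 p)
        upperCoeff-suc-zero β p = trans (C-cong step) (trans (C-* _ _) (*-congʳ (C-neg _)))
          where
          β′ : ℕ → R.Carrier
          β′ i = β (suc i)
          vanishing : R.eℕ (suc p) (applyUpTo β′ p) R.≈ R.0#
          vanishing = R.trans (R.reflexive (≡.cong (λ k → R.eℕ (suc k) (applyUpTo β′ p))
              (≡.sym (ℕₚ.+-identityʳ p))))
                              (R.eℕ-applyUpTo β′ p 0)
          step : upperCoeff β 0 (suc p) R.≈ R.- β 0 R.* upperCoeff β′ 0 p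
          step = R.trans (R.*-congˡ (R.trans (R.+-congʳ vanishing) (R.+-identityˡ _))) (R.trans
            (R.solve 4 (λ n s b E → (n R.:* s) R.:* (b R.:* E) R.:= (n R.:* b) R.:* (s R.:* E)) R.refl
               (R.- R.1#) ((R.- R.1#) R.^ (p ℕ.+ 0)) (β 0) _)
            (R.*-congʳ (R.-1*x≈-x _)))

      -- The expansion is infinite, but finite where x is nilpotent. Splitting off the first
      -- parameter frees a factor x, which is passed to `x ^ t`: the sum t + P stays constant and
      -- the hypothesis survives the induction. At P = 0 both sides vanish; otherwise the induction
      -- leaves (1 - β₀x) times its inverse.
      upperExpansion : ∀ P t β r → x ^ (t ℕ.+ P) ≈ 0# → x ^ t * ∑ P (upperTerm β r) ≈ x ^ t * x ^ r
      upperExpansion zero    t β r x^t≈0 rewrite ℕₚ.+-identityʳ t =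
        trans (trans (*-congʳ x^t≈0) (zeroˡ _)) (sym (trans (*-congʳ x^t≈0) (zeroˡ _)))
      upperExpansion (suc P) t β r x^t≈0 rewrite ℕₚ.+-suc t P = begin
        x ^ t * ∑ (suc P) (upperTerm β r)
          ≈⟨ *-congˡ (∑-suc P _) ⟩
        x ^ t * (upperTerm β r 0 + ∑ P (λ p → upperTerm β r (suc p)))
          ≈⟨ step r ⟩
        x ^ t * x ^ r * ((1# - C (β 0) * x) * g (β 0))
          ≈⟨ trans (*-congˡ (g-inverse (β 0))) (*-identityʳ _) ⟩
        x ^ t * x ^ r ∎
        where
        β′ : ℕ → R.Carrier
        β′ i = β (suc i)
        g₀ b₀ : Carrier
        g₀ = g (β 0)
        b₀ = - C (β 0)
        expanded : ∀ y → y * (g₀ + b₀ * x * g₀) ≈ y * ((1# - C (β 0) * x) * g₀)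
        expanded y = *-congˡ (trans (+-cong (sym (*-identityˡ g₀)) (*-congʳ (sym (-‿distribˡ-* _ _))))
            (sym (distribʳ _ _ _)))
        step : ∀ r → x ^ t * (upperTerm β r 0 + ∑ P (λ p → upperTerm β r (suc p))) ≈
                     x ^ t * x ^ r * ((1# - C (β 0) * x) * g₀)
        step zero = begin
          x ^ t * (upperTerm β 0 0 + ∑ P (λ p → upperTerm β 0 (suc p)))
            ≈⟨ *-congˡ (+-cong
                 (*-congʳ (trans (C-* _ _) (trans (*-cong C-1 C-1) (*-identityˡ _))))
                 (trans (∑-cong P λ p _ → trans (*-congʳ (upperCoeff-suc-zero β p))
                   (solve 6 (λ b c x y g G → (b :* c) :* ((x :* y) :* (g :* G)) :=
                       (b :* (x :* g)) :* (c :* (y :* G)))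
                       refl b₀ _ x (x ^ p) g₀ _))
                   (sym (∑-*ˡ P _ _)))) ⟩
          x ^ t * (1# * (1# * (g₀ * 1#)) + b₀ * (x * g₀) * ∑ P (upperTerm β′ 0))
            ≈⟨ solve 5 (λ y g b x S → y :* (con 1 :* (con 1 :* (g :* con 1)) :+ b :* (x :* g) :* S) :=
                y :* g :+ b :* g :* ((x :* y) :* S))
                refl _ _ _ _ _ ⟩
          x ^ t * g₀ + b₀ * g₀ * (x ^ suc t * ∑ P (upperTerm β′ 0))
            ≈⟨ +-congˡ (*-congˡ (upperExpansion P (suc t) β′ 0 x^t≈0)) ⟩
          x ^ t * g₀ + b₀ * g₀ * (x ^ suc t * 1#)
            ≈⟨ solve 4 (λ y g b x → y :* g :+ b :* g :* ((x :* y) :* con 1) :=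
                (y :* con 1) :* (g :+ b :* x :* g))
                refl (x ^ t) g₀ b₀ x ⟩
          x ^ t * 1# * (g₀ + b₀ * x * g₀)
            ≈⟨ expanded _ ⟩
          x ^ t * 1# * ((1# - C (β 0) * x) * g₀) ∎
        step (suc r) = begin
          x ^ t * (upperTerm β (suc r) 0 + ∑ P (λ p → upperTerm β (suc r) (suc p)))
            ≈⟨ *-congˡ (+-cong
                 (trans (*-congʳ (trans (C-cong (R.zeroʳ _)) C-0)) (zeroˡ _))
                 (trans (∑-cong P λ p _ → trans (*-congʳ (upperCoeff-suc-suc β r p))
                   (solve 7 (λ b c d x y g G → (c :+ b :* d) :* ((x :* y) :* (g :* G)) :=
                       (x :* g) :* (c :* (y :* G)) :+ (b :* (x :* g)) :* (d :* (y :* G)))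
                           refl b₀ _ _ x (x ^ p) g₀ _))
                   (trans (∑-+ P _ _) (+-cong (sym (∑-*ˡ P _ _)) (sym (∑-*ˡ P _ _)))))) ⟩
          x ^ t * (0# + (x * g₀ * ∑ P (upperTerm β′ r) + b₀ * (x * g₀) * ∑ P (upperTerm β′ (suc r))))
            ≈⟨ solve 6 (λ y g b x S T → y :* (con 0 :+ (x :* g :* S :+ b :* (x :* g) :* T)) :=
                g :* ((x :* y) :* S) :+ b :* g :* ((x :* y) :* T))
                refl _ _ _ _ _ _ ⟩
          g₀ * (x ^ suc t * ∑ P (upperTerm β′ r)) + b₀ * g₀ * (x ^ suc t * ∑ P (upperTerm β′ (suc r)))
            ≈⟨ +-cong (*-congˡ (upperExpansion P (suc t) β′ r x^t≈0))
                (*-congˡ (upperExpansion P (suc t) β′ (suc r) x^t≈0)) ⟩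
          g₀ * (x ^ suc t * x ^ r) + b₀ * g₀ * (x ^ suc t * x ^ suc r)
            ≈⟨ solve 5 (λ y g b x z → g :* ((x :* y) :* z) :+ b :* g :* ((x :* y) :* (x :* z)) :=
                (y :* (x :* z)) :* (g :+ b :* x :* g))
                refl (x ^ t) g₀ b₀ x (x ^ r) ⟩
          x ^ t * x ^ suc r * (g₀ + b₀ * x * g₀)
            ≈⟨ expanded _ ⟩
          x ^ t * x ^ suc r * ((1# - C (β 0) * x) * g₀) ∎

-- A quotient ring presented by a coarser equality on the same carrier, so that series enter it
-- unchanged.
coarsen : (R : CommutativeRing c ℓ) → let open CommutativeRing R in {_∼_ : Rel Carrier ℓ′} →
  IsEquivalence _∼_ → (∀ {p q} → p ≈ q → p ∼ q) →
  (∀ {p p′ q q′} → p ∼ p′ → q ∼ q′ → (p + q) ∼ (p′ + q′)) →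
  (∀ {p p′ q q′} → p ∼ p′ → q ∼ q′ → (p * q) ∼ (p′ * q′)) →
  (∀ {p p′} → p ∼ p′ → (- p) ∼ (- p′)) → CommutativeRing c ℓ′
coarsen R {_∼_} isEq weaken +-cong′ *-cong′ neg-cong′ = record
  { Carrier = Carrier
  ; _≈_ = _∼_
  ; _+_ = _+_
  ; _*_ = _*_
  ; -_ = -_
  ; 0# = 0#
  ; 1# = 1#
  ; isCommutativeRing = record
    { isRing = record
      { +-isAbelianGroup = record
        { isGroup = record
          { isMonoid = record
            { isSemigroup = record
              { isMagma = record { isEquivalence = isEq ; ∙-cong = +-cong′ }
              ; assoc = λ p q r → weaken (+-assoc p q r)
              }
            ; identity = (λ p → weaken (+-identityˡ p)) , λ p → weaken (+-identityʳ p)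
            }
          ; inverse = (λ p → weaken (-‿inverseˡ p)) , λ p → weaken (-‿inverseʳ p)
          ; ⁻¹-cong = neg-cong′
          }
        ; comm = λ p q → weaken (+-comm p q)
        }
      ; *-cong = *-cong′
      ; *-assoc = λ p q r → weaken (*-assoc p q r)
      ; *-identity = (λ p → weaken (*-identityˡ p)) , λ p → weaken (*-identityʳ p)
      ; distrib = (λ p q r → weaken (distribˡ p q r)) , λ p q r → weaken (distribʳ p q r)
      }
    ; *-comm = λ p q → weaken (*-comm p q)
    }
  }
  where open CommutativeRing R

-- Power series modulo the monomials with an exponent > D

module Truncation (R : CommutativeRing c ℓ) where

  open SeriesOps R
  open CommutativeRing R hiding (zero)
  open Sums R
  private
    module S n = CommutativeRing (Series R n)

  Bounded : ℕ → ∀ {n} → Vec ℕ n → Set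
  Bounded D = Vecᴬ.All (_≤ D)

  Agree : ∀ n → ℕ → ⟦ n ⟧ → ⟦ n ⟧ → Set ℓ
  Agree n D F G = ∀ (α : Vec ℕ n) → Bounded D α → coeff F α ≈ coeff G α

  module _ (n D : ℕ) where

    agree-weaken : ∀ {F G} → S._≈_ n F G → Agree n D F G
    agree-weaken p α _ = coeff-cong {n} p α

    agree-+ : ∀ {F F′ G G′} → Agree n D F F′ → Agree n D G G′ → Agree n D (S._+_ n F G) (S._+_ n F′ G′)
    agree-+ {F} {F′} {G} {G′} p q α α≤D = trans (coeff-+ F G α)
      (trans (+-cong (p α α≤D) (q α α≤D)) (sym (coeff-+ F′ G′ α)))

    agree-neg : ∀ {F F′} → Agree n D F F′ → Agree n D (S.-_ n F) (S.-_ n F′)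
    agree-neg {F} {F′} p α α≤D = trans (coeff-neg F α) (trans (-‿cong (p α α≤D)) (sym (coeff-neg F′ α)))

    agree-sum : ∀ m {f g : Fin m → ⟦ n ⟧} → (∀ j → Agree n D (f j) (g j)) →
      Agree n D (RingOps.sum (Series R n) f) (RingOps.sum (Series R n) g)
    agree-sum zero    p = λ _ _ → refl
    agree-sum (suc m) {f} {g} p = agree-+ {f zero} {g zero} (p zero) (agree-sum m λ j → p (suc j))

  -- The exponents in the two factors add up to the exponent in the product, so neither exceeds it.
  agree-* : ∀ n D {F F′ G G′} → Agree n D F F′ → Agree n D G G′ → Agree n D (S._*_ n F G) (S._*_ n F′ G′)
  agree-* zero    D p q []      Vecᴬ.[]              = *-cong (p [] Vecᴬ.[]) (q [] Vecᴬ.[])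
  agree-* (suc n) D p q (k ∷ α) (k≤D Vecᴬ.∷ α≤D) = agree-sum n D (suc k)
    (λ j → agree-* n D
      (λ β β≤D → p (toℕ j ∷ β) (ℕₚ.≤-trans (ℕₚ.≤-pred (toℕ<n j)) k≤D Vecᴬ.∷ β≤D))
      (λ β β≤D → q (k ∸ toℕ j ∷ β) (ℕₚ.≤-trans (ℕₚ.m∸n≤m k (toℕ j)) k≤D Vecᴬ.∷ β≤D)))
    α α≤D

  Truncated : ℕ → ℕ → CommutativeRing c ℓ
  Truncated n D = coarsen (Series R n) {Agree n D}
    (record { refl  = λ _ _ → refl
            ; sym   = λ p α α≤D → sym (p α α≤D)
            ; trans = λ p q α α≤D → trans (p α α≤D) (q α α≤D) })
    (agree-weaken n D) (λ {F} {F′} → agree-+ n D {F} {F′}) (agree-* n D) (λ {F} → agree-neg n D {F})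

  C-cong : ∀ n {r s} → r ≈ s → S._≈_ n (C n r) (C n s)
  C-cong zero    p         = p
  C-cong (suc n) p zero    = C-cong n p
  C-cong (suc n) p (suc k) = S.refl n

  C-0 : ∀ n → S._≈_ n (C n 0#) (S.0# n)
  C-0 zero            = refl
  C-0 (suc n) zero    = C-0 n
  C-0 (suc n) (suc k) = S.refl n

  C-+ : ∀ n r s → S._≈_ n (C n (r + s)) (S._+_ n (C n r) (C n s))
  C-+ zero    r s         = refl
  C-+ (suc n) r s zero    = C-+ n r s
  C-+ (suc n) r s (suc k) = S.sym n (S.+-identityˡ n _)

  C-neg : ∀ n r → S._≈_ n (C n (- r)) (S.-_ n (C n r))
  C-neg zero    r         = refl
  C-neg (suc n) r zero    = C-neg n r
  C-neg (suc n) r (suc k) = S.sym n ε⁻¹≈ε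
    where open import Algebra.Properties.Group (S.+-group n) using (ε⁻¹≈ε)

  C-isRingHomomorphism : ∀ n D → IsRingHomomorphism (CommutativeRing.rawRing R)
    (CommutativeRing.rawRing (Truncated n D)) (C n)
  C-isRingHomomorphism n D = record
    { isSemiringHomomorphism = record
      { isNearSemiringHomomorphism = record
        { +-isMonoidHomomorphism = record
          { isMagmaHomomorphism = record
            { isRelHomomorphism = record { cong = λ p → agree-weaken n D (C-cong n p) }
            ; homo = λ r s → agree-weaken n D (C-+ n r s)
            }
          ; ε-homo = agree-weaken n D (C-0 n)
          }
        ; *-homo = λ r s → agree-weaken n D (C-* n r s)
        }
      ; 1#-homo = agree-weaken n D (C-1 n)
      }
    ; -‿homo = λ r → agree-weaken n D (C-neg n r)
    }

  coeff-C* : ∀ n r (F : ⟦ n ⟧) (α : Vec ℕ n) → coeff (S._*_ n (C n r) F) α ≈ r * coeff F α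
  coeff-C* zero    r F []      = refl
  coeff-C* (suc n) r F (k ∷ α) = trans
    (coeff-cong {n} (PowerSeries.const-*ˢ (Series R n) (C n r) F k) α)
    (coeff-C* n r (F k) α)

  module _ {n : ℕ} where

    open RingOps (Series R n) using (_^_; Σᴸ)

    coeff-∑ᴸ : ∀ (f : I → ⟦ n ⟧) xs α → coeff {n} (Σᴸ (map f xs)) α ≈ ∑ᴸ (λ y → coeff {n} (f y) α) xs
    coeff-∑ᴸ f []       α = coeff-0 {n} α
    coeff-∑ᴸ f (y ∷ xs) α = trans (coeff-+ {n} (f y) (Σᴸ (map f xs)) α) (+-congˡ (coeff-∑ᴸ f xs α))

    coeff-x^ : ∀ (i : Fin n) m F α → lookup α i < m → coeff (S._*_ n (x i ^ m) F) α ≈ 0#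
    coeff-x^ i (suc m) F α p = trans
      (coeff-cong {n} (S.*-assoc n (x i) (x i ^ m) F) α)
      (trans (reflexive (≡.cong (coeff (S._*_ n (x i) G)) (≡.sym ([]≔-lookup α i)))) (go (lookup α i) p))
      where
      G : ⟦ n ⟧
      G = S._*_ n (x i ^ m) F
      go : ∀ k → k < suc m → coeff (S._*_ n (x i) G) (α [ i ]≔ k) ≈ 0#
      go zero    _         = coeff-x-zero i G α
      go (suc k) (s≤s k<m) = trans (coeff-x-suc i G α k) (coeff-x^ i m F (α [ i ]≔ k)
        (≡.subst (_< m) (≡.sym (lookup∘updateAt i α)) k<m))

    -- Provides the nilpotency assumed in `upperExpansion` and removes the partitions with a large
    -- first row.
    x^-zero : ∀ {D} (i : Fin n) m → D < m → Agree n D (x i ^ m) (S.0# n)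
    x^-zero i m D<m α α≤D = trans (coeff-cong {n} (S.sym n (S.*-identityʳ n (x i ^ m))) α)
      (trans (coeff-x^ i m (S.1# n) α (ℕₚ.≤-<-trans (lookup⁺ α≤D i) D<m)) (sym (coeff-0 {n} α)))

    -- Every single division sums coefficients of the dividend at positions independent of the
    -- dividend. The point is the order of the quantifiers: the finite list `βs` is chosen before F,
    -- so that a coefficient of the quotient is a linear functional of the numerator.
    coeff-quot : ∀ ps (α : Vec ℕ n) → ∃ λ βs → ∀ F → coeff (quot F ps) α ≈ ∑ᴸ (coeff F) βs
    coeff-quot []             α = α ∷ [] , λ F → sym (+-identityʳ _)
    coeff-quot ((i , j) ∷ ps) α with βs , p ← coeff-quot ps α = concatMap γs βs , λ F → begin
      coeff (quot (divide i j F) ps) α       ≈⟨ p (divide i j F) ⟩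
      ∑ᴸ (coeff (divide i j F)) βs           ≈⟨ ∑ᴸ-cong (coeff-divide F) βs ⟩
      ∑ᴸ (λ β → ∑ᴸ (coeff F) (γs β)) βs      ≈⟨ ∑ᴸ-concatMap (coeff F) γs βs ⟨
      ∑ᴸ (coeff F) (concatMap γs βs)         ∎
      where
      open import Relation.Binary.Reasoning.Setoid setoid
      γ : ∀ β → Fin (suc (lookup β j)) → Vec ℕ n
      γ β r = (β [ i ]≔ suc (lookup β i ℕ.+ (lookup β j ∸ toℕ r))) [ j ]≔ toℕ r
      γs : Vec ℕ n → List (Vec ℕ n)
      γs β = tabulate (γ β)
      coeff-divide : ∀ F β → coeff (divide i j F) β ≈ ∑ᴸ (coeff F) (γs β)
      coeff-divide F β = trans (reflexive (coeff-fromCoeff (divideCoeff i j F) β))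
        (sym (∑ᴸ-tabulate (suc (lookup β j)) (coeff F) (γ β)))

  bound : ∀ {n} (βs : List (Vec ℕ n)) → ∃ λ D → All (Bounded D) βs
  bound []       = 0 , []
  bound (β ∷ βs) with D , p ← bound βs = Vec.sum β ℕ.+ D
    , Vecᴬ.map (λ q → ℕₚ.≤-trans q (ℕₚ.m≤m+n _ D)) (entries β)
    ∷ All.map (Vecᴬ.map λ q → ℕₚ.≤-trans q (ℕₚ.m≤n+m D _)) p
    where
    entries : ∀ {n} (β : Vec ℕ n) → Bounded (Vec.sum β) β
    entries []      = Vecᴬ.[]
    entries (k ∷ β) = ℕₚ.m≤m+n k _ Vecᴬ.∷ Vecᴬ.map (λ q → ℕₚ.≤-trans q (ℕₚ.m≤n+m _ k)) (entries β)

-- Partitions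

nth-antitone : ∀ {ps} → Linked _≥_ ps → ∀ {i j} → i ≤ j → nth ps j ≤ nth ps i
nth-antitone []       _                   = z≤n
nth-antitone {p ∷ _} [-] {zero} {zero}  _ = ℕₚ.≤-refl
nth-antitone [-]      {j = suc j} _       = z≤n
nth-antitone (q ∷ qs) {zero} {zero}  _    = ℕₚ.≤-refl
nth-antitone (q ∷ qs) {zero} {suc j} _    = ℕₚ.≤-trans (nth-antitone qs {zero} {j} z≤n) q
nth-antitone (q ∷ qs) (s≤s i≤j)           = nth-antitone qs i≤j

row-antitone : ∀ ν {i j} → i ≤ j → row ν (suc j) ≤ row ν (suc i)
row-antitone (mkPartition _ sorted _) i≤j = recompute (_ ℕₚ.≤? _) (nth-antitone sorted i≤j)

row-≥len : ∀ ν {i} → len ν ≤ i → row ν (suc i) ≡ 0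
row-≥len ν = go (parts ν)
  where
  go : ∀ ps {i} → length ps ≤ i → nth ps i ≡ 0
  go []       _       = ≡.refl
  go (_ ∷ ps) (s≤s p) = go ps p

row-<len : ∀ ν {i} → i < len ν → 0 < row ν (suc i)
row-<len (mkPartition _ _ positive) i<len = recompute (_ ℕₚ.≤? _) (go positive i<len)
  where
  go : ∀ {ps i} → All (0 <_) ps → i < length ps → 0 < nth ps i
  go {i = zero}  (p ∷ _)  _       = p
  go {i = suc i} (_ ∷ ps) (s≤s q) = go ps q

row>0⇒<len : ∀ ν {i} → 0 < row ν (suc i) → i < len ν
row>0⇒<len ν {i} 0<row with ℕₚ.≤-<-connex (len ν) i
... | inj₁ len≤i = ⊥-elim (ℕₚ.<-irrefl (≡.sym (row-≥len ν len≤i)) 0<row)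
... | inj₂ i<len = i<len

module _ {P : ℕ → Set} (P? : Decidable P) where

  -- A condition that holds on an initial segment has its count as threshold. As `diagonal` is such
  -- a count, comparison with it becomes comparison with the rows.
  filter-initial : ∀ n (f : ℕ → ℕ) → (∀ i → P (f (suc i)) → P (f i)) → ∀ i →
    (i < length (filter P? (applyUpTo f n)) → P (f i)) ×
    (i < n → P (f i) → i < length (filter P? (applyUpTo f n)))
  filter-initial zero    f closed i = (λ ()) , λ ()
  filter-initial (suc n) f closed i with P? (f 0)
  filter-initial (suc n) f closed zero    | yes p = (λ _ → p) , λ _ _ → s≤s z≤n
  filter-initial (suc n) f closed (suc i) | yes p
    with to , from ← filter-initial n (λ i → f (suc i)) (λ i → closed (suc i)) i
    = (λ { (s≤s i<l) → to i<l }) , λ { (s≤s i<n) q → s≤s (from i<n q) }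
  ... | no ¬p = (λ i<l → ⊥-elim (¬p (descend (suc i)
      (proj₁ (filter-initial n (λ i → f (suc i)) (λ i → closed (suc i)) i) i<l))))
              , λ _ q → ⊥-elim (¬p (descend i q))
    where
    descend : ∀ i → P (f i) → P (f 0)
    descend zero    p = p
    descend (suc i) p = descend i (closed i p)

module _ (ν : Partition) where

  private
    characterisation : ∀ i →
        (i < diagonal ν → i < row ν (suc i)) × (i < len ν → i < row ν (suc i) → i < diagonal ν)
    characterisation = filter-initial (λ i → suc i ℕₚ.≤? row ν (suc i)) (len ν) (λ i → i)
      λ i p → ℕₚ.≤-trans (ℕₚ.<⇒≤ p) (row-antitone ν (ℕₚ.n≤1+n i))

  <diagonal⇒<row : ∀ {i} → i < diagonal ν → i < row ν (suc i)
  <diagonal⇒<row {i} = proj₁ (characterisation i)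

  <row⇒<diagonal : ∀ {i} → i < row ν (suc i) → i < diagonal ν
  <row⇒<diagonal {i} i<row = proj₂ (characterisation i) (row>0⇒<len ν (ℕₚ.≤-<-trans z≤n i<row)) i<row

  ≥diagonal⇒≥row : ∀ {i} → diagonal ν ≤ i → row ν (suc i) ≤ i
  ≥diagonal⇒≥row d≤i = ℕₚ.≮⇒≥ λ i<row → ℕₚ.<⇒≱ (<row⇒<diagonal i<row) d≤i

  diagonal≤len : diagonal ν ≤ len ν
  diagonal≤len = ℕₚ.≮⇒≥ λ l<d → ℕₚ.<⇒≢ (ℕₚ.≤-<-trans z≤n (<diagonal⇒<row l<d)) (≡.sym (row-≥len ν ℕₚ.≤-refl))

⊆⇒len≤ : ∀ {μ ν} → μ ⊆ ν → len μ ≤ len ν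
⊆⇒len≤ {μ} {ν} μ⊆ν = ℕₚ.≮⇒≥ λ lν<lμ → ℕₚ.<⇒≱ (ℕₚ.<-≤-trans (row-<len μ lν<lμ) (μ⊆ν _))
  (ℕₚ.≤-reflexive (row-≥len ν ℕₚ.≤-refl))

partition-≡ : ∀ {μ ν} → parts μ ≡ parts ν → μ ≡ ν
partition-≡ ≡.refl = ≡.refl

∅ : Partition
∅ = mkPartition [] [] []

-- The partition with first part p, raised to the next part if necessary.
cons : ℕ → Partition → Partition
cons p (mkPartition ps sorted positive) = mkPartition (go p ps) (go-sorted p sorted) (go-positive p positive)
  where
  go : ℕ → List ℕ → List ℕ
  go zero    []       = []
  go (suc p) []       = suc p ∷ []
  go p       (q ∷ qs) = p ⊔ q ∷ q ∷ qs
  go-sorted : ∀ p {qs} → Linked _≥_ qs → Linked _≥_ (go p qs)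
  go-sorted zero    []                = []
  go-sorted (suc p) []                = [-]
  go-sorted zero    {q ∷ qs} linked   = ℕₚ.≤-refl ∷ linked
  go-sorted (suc p) {q ∷ qs} linked   = ℕₚ.m≤n⊔m (suc p) q ∷ linked
  go-positive : ∀ p {qs} → All (0 <_) qs → All (0 <_) (go p qs)
  go-positive zero    []       = []
  go-positive (suc p) []       = s≤s z≤n ∷ []
  go-positive zero    (q ∷ qs) = q ∷ q ∷ qs
  go-positive (suc p) {r ∷ _} (q ∷ qs) = ℕₚ.≤-trans q (ℕₚ.m≤n⊔m (suc p) r) ∷ q ∷ qs

row-cons-1 : ∀ p ν → row (cons p ν) 1 ≡ p ⊔ row ν 1
row-cons-1 zero    (mkPartition []      _ _) = ≡.refl
row-cons-1 (suc p) (mkPartition []      _ _) = ≡.refl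
row-cons-1 zero    (mkPartition (_ ∷ _) _ _) = ≡.refl
row-cons-1 (suc p) (mkPartition (_ ∷ _) _ _) = ≡.refl

tail : Partition → Partition
tail (mkPartition ps sorted positive) = mkPartition (List.drop 1 ps) (go sorted) (Allₚ.drop⁺ 1 positive)
  where
  go : ∀ {ps} → Linked _≥_ ps → Linked _≥_ (List.drop 1 ps)
  go []      = []
  go [-]     = []
  go (_ ∷ l) = l

row-tail : ∀ ν i → row (tail ν) (suc i) ≡ row ν (suc (suc i))
row-tail (mkPartition []      _ _) i = ≡.refl
row-tail (mkPartition (_ ∷ _) _ _) i = ≡.refl

len-tail : ∀ ν {n} → len ν ≤ suc n → len (tail ν) ≤ n
len-tail (mkPartition []      _ _) _       = z≤n
len-tail (mkPartition (_ ∷ _) _ _) (s≤s p) = p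

tail-cons : ∀ p ν → tail (cons p ν) ≡ ν
tail-cons zero    (mkPartition []      _ _) = ≡.refl
tail-cons (suc p) (mkPartition []      _ _) = ≡.refl
tail-cons zero    (mkPartition (_ ∷ _) _ _) = ≡.refl
tail-cons (suc p) (mkPartition (_ ∷ _) _ _) = ≡.refl

cons-tail : ∀ ν → cons (row ν 1) (tail ν) ≡ ν
cons-tail (mkPartition []          _ _) = ≡.refl
cons-tail (mkPartition (zero  ∷ []) _ pos) = ⊥-elim (ℕₚ.<-irrefl ≡.refl (recompute (0 ℕₚ.<? 0) (All.head pos)))
cons-tail (mkPartition (suc p ∷ []) _ _) = ≡.refl
cons-tail ν@(mkPartition (p ∷ q ∷ ps) _ _) = partition-≡ (go p (row-antitone ν {0} {1} z≤n))
  where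
  go : ∀ p → q ≤ p → parts (cons p (tail ν)) ≡ p ∷ q ∷ ps
  go zero    z≤n = ≡.refl
  go (suc p) q≤p = ≡.cong (_∷ q ∷ ps) (ℕₚ.m≥n⇒m⊔n≡m q≤p)

-- Beads (beta-numbers) of partitions with at most n rows

beads : ∀ n → Partition → Vec ℕ n
beads zero    ν = []
beads (suc n) ν = row ν 1 ℕ.+ n ∷ beads n (tail ν)

-- Total on all vectors, but inverse to `beads` only on decreasing ones, where the maximum in `cons`
-- is always its first argument.
shape : ∀ {n} → Vec ℕ n → Partition
shape []               = ∅
shape {suc n} (l ∷ L) = cons (l ∸ n) (shape L)

lookup-beads : ∀ n ν i → lookup (beads n ν) i ≡ row ν (suc (toℕ i)) ℕ.+ (n ∸ suc (toℕ i))
lookup-beads (suc n) ν zero    = ≡.refl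
lookup-beads (suc n) ν (suc i) = ≡.trans (lookup-beads n (tail ν) i)
  (≡.cong (ℕ._+ (n ∸ suc (toℕ i))) (row-tail ν (toℕ i)))

Decreasing : ℕ → ∀ {n} → Vec ℕ n → Set
Decreasing B []      = ⊤
Decreasing B (l ∷ L) = l < B × Decreasing l L

beads-decreasing : ∀ n ν {B} → row ν 1 ℕ.+ (n ∸ 1) < B → Decreasing B (beads n ν)
beads-decreasing zero          ν _ = _
beads-decreasing (suc zero)    ν p = p , _
beads-decreasing (suc (suc n)) ν p = p , beads-decreasing (suc n) (tail ν)
  (ℕₚ.+-mono-≤-< (ℕₚ.≤-trans (ℕₚ.≤-reflexive (row-tail ν 0)) (row-antitone ν z≤n)) ℕₚ.≤-refl)

shape-beads : ∀ n ν → len ν ≤ n → shape (beads n ν) ≡ ν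
shape-beads zero    (mkPartition [] _ _) _ = ≡.refl
shape-beads (suc n) ν len≤n = ≡.trans
  (≡.cong₂ cons (ℕₚ.m+n∸n≡m (row ν 1) n) (shape-beads n (tail ν) (len-tail ν len≤n)))
  (cons-tail ν)

shape-head : ∀ {n} l (L : Vec ℕ n) → row (shape L) 1 ℕ.+ n ≤ l → row (shape (l ∷ L)) 1 ℕ.+ n ≡ l
shape-head {n} l L p = begin
  row (cons (l ∸ n) (shape L)) 1 ℕ.+ n  ≡⟨ ≡.cong (ℕ._+ n) (row-cons-1 (l ∸ n) (shape L)) ⟩
  (l ∸ n ⊔ row (shape L) 1) ℕ.+ n       ≡⟨ ≡.cong (ℕ._+ n) (ℕₚ.m≥n⇒m⊔n≡m (ℕₚ.m+n≤o⇒m≤o∸n _ p)) ⟩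
  l ∸ n ℕ.+ n                           ≡⟨ ℕₚ.m∸n+n≡m (ℕₚ.≤-trans (ℕₚ.m≤n+m n _) p) ⟩
  l                                     ∎
  where open ≡.≡-Reasoning

shape-bound : ∀ {n B} (L : Vec ℕ n) → Decreasing B L → row (shape L) 1 ℕ.+ n ≤ B
shape-bound []      _           = z≤n
shape-bound {suc n} {B} (l ∷ L) (l<B , dec) = ≡.subst (_≤ B) (≡.sym (ℕₚ.+-suc _ n))
  (≡.subst (_< B) (≡.sym (shape-head l L (shape-bound L dec))) l<B)

beads-shape : ∀ {n B} (L : Vec ℕ n) → Decreasing B L → beads n (shape L) ≡ L
beads-shape []              _         = ≡.refl
beads-shape {suc n} (l ∷ L) (_ , dec) = ≡.cong₂ _∷_ (shape-head l L (shape-bound L dec))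
  (≡.trans (≡.cong (beads n) (tail-cons (l ∸ n) (shape L))) (beads-shape L dec))

len-shape : ∀ {n} (L : Vec ℕ n) → len (shape L) ≤ n
len-shape []      = z≤n
len-shape {suc n} (l ∷ L) = go (l ∸ n) (shape L) (len-shape L)
  where
  go : ∀ p ν → len ν ≤ n → len (cons p ν) ≤ suc n
  go zero    (mkPartition []      _ _) _ = z≤n
  go (suc p) (mkPartition []      _ _) _ = s≤s z≤n
  go zero    (mkPartition (_ ∷ _) _ _) q = s≤s q
  go (suc p) (mkPartition (_ ∷ _) _ _) q = s≤s q

decreasing-weaken : ∀ {n B} (L : Vec ℕ n) → Decreasing B L → Decreasing (suc B) L
decreasing-weaken []      _           = _
decreasing-weaken (l ∷ L) (l<B , dec) = ℕₚ.m<n⇒m<1+n l<B , dec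

decreasing-sound : ∀ B n → All (Decreasing B) (decreasing B n)
decreasing-sound B       zero    = _ ∷ []
decreasing-sound zero    (suc n) = []
decreasing-sound (suc B) (suc n) = Allₚ.++⁺
  (All.map (λ {L} → decreasing-weaken L) (decreasing-sound B (suc n)))
  (Allₚ.map⁺ (All.map (ℕₚ.≤-refl ,_) (decreasing-sound B n)))

decreasing-complete : ∀ B {n} (L : Vec ℕ n) → Decreasing B L → L ∈ decreasing B n
decreasing-complete zero    []      _             = here ≡.refl
decreasing-complete (suc B) []      _             = here ≡.refl
decreasing-complete (suc B) (l ∷ L) (s≤s l≤B , dec) with ℕₚ.m≤n⇒m<n∨m≡n l≤B
... | inj₁ l<B    = ∈-++⁺ˡ (decreasing-complete B (l ∷ L) (l<B , dec))
... | inj₂ ≡.refl = ∈-++⁺ʳ (decreasing B _) (∈-map⁺ (B ∷_) (decreasing-complete B L dec))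

decreasing-unique : ∀ B n → Unique (decreasing B n)
decreasing-unique B       zero    = [] ∷ []
decreasing-unique zero    (suc n) = []
decreasing-unique (suc B) (suc n) = Uniqueₚ.++⁺ (decreasing-unique B (suc n))
  (Uniqueₚ.map⁺ ∷-injectiveʳ (decreasing-unique B n)) disjoint
  where
  disjoint : ∀ {L} → L ∈ decreasing B (suc n) × L ∈ map (B ∷_) (decreasing B n) → _
  disjoint (p , q) with _ , _ , ≡.refl ← ∈-map⁻ (B ∷_) q =
    ℕₚ.<-irrefl ≡.refl (proj₁ (All.lookup (decreasing-sound B (suc n)) p))

bead : ℕ → Partition → ℕ → ℕ
bead n ν i = row ν (suc i) ℕ.+ (n ∸ suc i)

module _ {n i : ℕ} (i<n : i < n) where

  private
    n≡ : n ≡ suc i ℕ.+ (n ∸ suc i)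
    n≡ = ≡.sym (ℕₚ.m+[n∸m]≡n i<n)

    cancel : ∀ p q m → (p ℕ.+ m) ∸ (q ℕ.+ m) ≡ p ∸ q
    cancel p q m = ≡.trans (≡.cong₂ _∸_ (ℕₚ.+-comm p m) (ℕₚ.+-comm q m)) (ℕₚ.[m+n]∸[m+o]≡n∸o m p q)

  module _ (ν : Partition) where

    -- This and the next two count parameters: those in `E` and in the denominators of `A`, those in
    -- `H`, and the linear factors of `A`. Truncated subtraction makes a case distinction on the
    -- diagonal unnecessary.
    bead∸n : bead n ν i ∸ n ≡ row ν (suc i) ∸ suc i
    bead∸n = ≡.trans (≡.cong (bead n ν i ∸_) n≡) (cancel (row ν (suc i)) (suc i) (n ∸ suc i))

    n∸bead : n ∸ bead n ν i ≡ suc i ∸ row ν (suc i)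
    n∸bead = ≡.trans (≡.cong (_∸ bead n ν i) n≡) (cancel (suc i) (row ν (suc i)) (n ∸ suc i))

    n∸1+bead : n ∸ suc (bead n ν i) ≡ i ∸ row ν (suc i)
    n∸1+bead = ≡.trans (≡.cong (_∸ suc (bead n ν i)) n≡) (cancel i (row ν (suc i)) (n ∸ suc i))

    row>⇒bead≥ : i < row ν (suc i) → n ≤ bead n ν i
    row>⇒bead≥ p = ≡.subst (_≤ bead n ν i) (≡.sym n≡) (ℕₚ.+-monoˡ-≤ (n ∸ suc i) p)

    row≤⇒bead< : row ν (suc i) ≤ i → bead n ν i < n
    row≤⇒bead< p = ≡.subst (bead n ν i <_) (≡.sym n≡) (s≤s (ℕₚ.+-monoˡ-≤ (n ∸ suc i) p))

bead-antitone : ∀ n ν {i j} → i ≤ j → bead n ν j ≤ bead n ν i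
bead-antitone n ν i≤j = ℕₚ.+-mono-≤ (row-antitone ν i≤j) (ℕₚ.∸-monoʳ-≤ n (s≤s i≤j))

bead-degree : ∀ {n i j} → i < n → j < n → ∀ μ ν → bead n ν i ⊖ bead n μ j ≡
  + row ν (suc i) ℤ.- + row μ (suc j) ℤ.- + suc i ℤ.+ + suc j
bead-degree {n} {i} {j} i<n j<n μ ν = begin
  bead n ν i ⊖ bead n μ j
    ≡⟨ ℤₚ.m-n≡m⊖n (bead n ν i) (bead n μ j) ⟨
  + bead n ν i ℤ.- + bead n μ j
    ≡⟨ ≡.cong₂ (λ p q → (+ row ν (suc i) ℤ.+ p) ℤ.- (+ row μ (suc j) ℤ.+ q)) (shift i<n) (shift j<n) ⟩
  (+ row ν (suc i) ℤ.+ (+ n ℤ.- + suc i)) ℤ.- (+ row μ (suc j) ℤ.+ (+ n ℤ.- + suc j))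
    ≡⟨ rearrange (+ row ν (suc i)) (+ row μ (suc j)) (+ suc i) (+ suc j) (+ n) ⟩
  + row ν (suc i) ℤ.- + row μ (suc j) ℤ.- + suc i ℤ.+ + suc j ∎
  where
  open ≡.≡-Reasoning
  shift : ∀ {i} → i < n → + (n ∸ suc i) ≡ + n ℤ.- + suc i
  shift {i} i<n = ≡.trans (≡.sym (ℤₚ.⊖-≥ i<n)) (≡.sym (ℤₚ.m-n≡m⊖n n (suc i)))
  rearrange : ∀ r s i j n → (r ℤ.+ (n ℤ.- i)) ℤ.- (s ℤ.+ (n ℤ.- j)) ≡ r ℤ.- s ℤ.- i ℤ.+ j
  rearrange = ℤ-Solver.solve-∀

-- The change of basis from the powers of x to the columns of A

module Transition (R : CommutativeRing c ℓ) (a : ℤ → CommutativeRing.Carrier R) (n : ℕ) where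

  open Symmetric R hiding (trans; sym)
  open CommutativeRing R using (trans; sym)
  open DualSchur R a
  open SeriesOps R
  open Sums R
  open Determinants R
  open BlockDeterminants R
  open import Algebra.Properties.Semiring.Exp semiring using (^-homo-*)
  import Algebra.Properties.CommutativeSemigroup *-commutativeSemigroup as *
  open import Relation.Binary.Reasoning.Setoid setoid

  -- The coefficient of the column with bead l in the power x ^ k.
  M : ℕ → ℕ → Carrier
  M k l = if does (n ℕₚ.≤? l)
          then (if does (n ℕₚ.≤? k) then (- 1#) ^ ((l ∸ n) ℕ.+ (k ∸ n)) * e (l ⊖ k) (a₀⋯ (l ∸ n)) else 0#)
          else h (l ⊖ k) (a₁⋯ (n ∸ l))

  M-upper : ∀ {k l} → n ≤ k → n ≤ l → M k l ≡ (- 1#) ^ ((l ∸ n) ℕ.+ (k ∸ n)) * e (l ⊖ k) (a₀⋯ (l ∸ n))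
  M-upper {k} {l} n≤k n≤l rewrite dec-true (n ℕₚ.≤? l) n≤l | dec-true (n ℕₚ.≤? k) n≤k = ≡.refl

  M-mixed : ∀ {k l} → k < n → n ≤ l → M k l ≡ 0#
  M-mixed {k} {l} k<n n≤l rewrite dec-true (n ℕₚ.≤? l) n≤l | dec-false (n ℕₚ.≤? k) (ℕₚ.<⇒≱ k<n) = ≡.refl

  M-lower : ∀ {k l} → l < n → M k l ≡ h (l ⊖ k) (a₁⋯ (n ∸ l))
  M-lower {k} {l} l<n rewrite dec-false (n ℕₚ.≤? l) (ℕₚ.<⇒≱ l<n) = ≡.refl

  M-< : ∀ {k l} → l < k → M k l ≈ 0#
  M-< {k} {l} l<k with ℕₚ.≤-<-connex n l
  ... | inj₁ n≤l = trans (reflexive (M-upper (ℕₚ.≤-trans n≤l (ℕₚ.<⇒≤ l<k)) n≤l))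
                     (trans (*-congˡ (e-< _ l<k)) (zeroʳ _))
  ... | inj₂ l<n = trans (reflexive (M-lower l<n)) (h-< _ l<k)

  private
    sign : ℕ → Carrier
    sign k = (- 1#) ^ k

    sign-+ : ∀ j k → sign (j ℕ.+ k) ≈ sign j * sign k
    sign-+ = ^-homo-* (- 1#)

    sign-even : ∀ k → sign (k ℕ.+ k) ≈ 1#
    sign-even zero    = refl
    sign-even (suc k) = begin
      - 1# * sign (k ℕ.+ suc k)      ≡⟨ ≡.cong (λ m → - 1# * sign m) (ℕₚ.+-suc k k) ⟩
      - 1# * (- 1# * sign (k ℕ.+ k)) ≈⟨ trans (-1*x≈-x _) (-‿cong (-1*x≈-x _)) ⟩
      - - sign (k ℕ.+ k)             ≈⟨ ⁻¹-involutive _ ⟩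
      sign (k ℕ.+ k)                 ≈⟨ sign-even k ⟩
      1#                             ∎

    sign-∸ : ∀ {p q} i → i ≤ q → q ≤ p → sign (p ∸ i) * sign (q ∸ i) ≈ sign (p ∸ q)
    sign-∸ {p} {q} i i≤q q≤p = begin
      sign (p ∸ i) * sign (q ∸ i)
        ≡⟨ ≡.cong (λ k → sign k * sign (q ∸ i)) p∸i ⟩
      sign ((p ∸ q) ℕ.+ (q ∸ i)) * sign (q ∸ i)
        ≈⟨ *-congʳ (sign-+ (p ∸ q) (q ∸ i)) ⟩
      sign (p ∸ q) * sign (q ∸ i) * sign (q ∸ i)
        ≈⟨ trans (*-assoc _ _ _) (*-congˡ (sym (sign-+ (q ∸ i) (q ∸ i)))) ⟩
      sign (p ∸ q) * sign ((q ∸ i) ℕ.+ (q ∸ i))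
        ≈⟨ trans (*-congˡ (sign-even (q ∸ i))) (*-identityʳ _) ⟩
      sign (p ∸ q) ∎
      where
      p∸i : p ∸ i ≡ (p ∸ q) ℕ.+ (q ∸ i)
      p∸i = ≡.trans (≡.cong (_∸ i) (≡.sym (ℕₚ.m∸n+n≡m q≤p))) (ℕₚ.+-∸-assoc (p ∸ q) i≤q)

    Π-sign : ∀ m (σ τ ρ : ℕ → ℕ) → (∀ i → i < m → sign (σ i) * sign (τ i) ≈ sign (ρ i)) →
      Π m (λ i → sign (σ i)) * Π m (λ i → sign (τ i)) ≈ sign (sumℕ (applyUpTo ρ m))
    Π-sign zero    σ τ ρ p = *-identityˡ _
    Π-sign (suc m) σ τ ρ p = trans (*.interchange _ _ _ _) (trans
      (*-cong (p 0 (s≤s z≤n))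
          (Π-sign m (λ i → σ (suc i)) (λ i → τ (suc i)) (λ i → ρ (suc i)) λ i i<m → p (suc i) (s≤s i<m)))
      (sym (sign-+ (ρ 0) _)))

  module _ (μ ν : Partition) where

    transition : ℕ → ℕ → Carrier
    transition i j = M (bead n μ j) (bead n ν i)

    -- For q ≤ i ≤ p, bead p of ν is at most its bead i, which is less than bead i of μ, which is at
    -- most bead q of μ. By `M-<` this gives a zero block with corner (i , i).
    transition-notAbove : ∀ {i} → i < n → row ν (suc i) < row μ (suc i) → det< n transition ≈ 0#
    transition-notAbove {i} i<n νᵢ<μᵢ = det<-lowerLeft i n transition i<n λ p q i≤p _ q≤i →
      M-< (ℕₚ.≤-<-trans (bead-antitone n ν i≤p)
          (ℕₚ.<-≤-trans (ℕₚ.+-monoˡ-< (n ∸ suc i) νᵢ<μᵢ) (bead-antitone n μ q≤i)))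

    diagonal-mono : μ ⊆ ν → diagonal μ ≤ diagonal ν
    diagonal-mono μ⊆ν = ℕₚ.≮⇒≥ λ dν<dμ → ℕₚ.<-irrefl ≡.refl
      (<row⇒<diagonal ν (ℕₚ.<-≤-trans (<diagonal⇒<row μ dν<dμ) (μ⊆ν _)))

    -- By containment a different diagonal is a longer one. With d the diagonal of μ and indices
    -- from 0, the beads of ν up to index d are then at least n, while those of μ from index d on
    -- are below n.
    transition-diagonal : μ ⊆ ν → len ν ≤ n → diagonal ν ≢ diagonal μ → det< n transition ≈ 0#
    transition-diagonal μ⊆ν len≤n dν≢dμ = det<-upperRight (diagonal μ) n transition d<n λ i j i≤d d≤j j<n →
      reflexive (M-mixed (row≤⇒bead< j<n μ (≥diagonal⇒≥row μ d≤j))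
        (row>⇒bead≥ (ℕₚ.≤-<-trans i≤d d<n) ν (<diagonal⇒<row ν (ℕₚ.≤-<-trans i≤d d<dν))))
      where
      d<dν : diagonal μ < diagonal ν
      d<dν = ℕₚ.≤∧≢⇒< (diagonal-mono μ⊆ν) λ eq → dν≢dμ (≡.sym eq)
      d<n : diagonal μ < n
      d<n = ℕₚ.<-≤-trans d<dν (ℕₚ.≤-trans (diagonal≤len ν) len≤n)

    module _ (μ⊆ν : μ ⊆ ν) (dν≡dμ : diagonal ν ≡ diagonal μ) (len≤n : len ν ≤ n) where

      private
        d = diagonal μ

        d≤len : d ≤ len ν
        d≤len = ≡.subst (_≤ len ν) dν≡dμ (diagonal≤len ν)

        d≤n : d ≤ n
        d≤n = ℕₚ.≤-trans d≤len len≤n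

        ν-upper : ∀ {i} → i < d → n ≤ bead n ν i
        ν-upper i<d = row>⇒bead≥ (ℕₚ.<-≤-trans i<d d≤n) ν (<diagonal⇒<row ν (≡.subst (_ <_) (≡.sym dν≡dμ) i<d))

        ν-lower : ∀ {i} → i < n → d ≤ i → bead n ν i < n
        ν-lower i<n d≤i = row≤⇒bead< i<n ν (≥diagonal⇒≥row ν (≡.subst (_≤ _) (≡.sym dν≡dμ) d≤i))

        μ-upper : ∀ {j} → j < d → n ≤ bead n μ j
        μ-upper j<d = row>⇒bead≥ (ℕₚ.<-≤-trans j<d d≤n) μ (<diagonal⇒<row μ j<d)

        E′ H′ : ℕ → ℕ → Carrier
        E′ i j = e (degree μ ν (suc i) (suc j)) (a₀⋯ (row ν (suc i) ∸ suc i))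
        H′ i j = h (degree μ ν (suc (d ℕ.+ i)) (suc (d ℕ.+ j))) (a₁⋯ (suc (d ℕ.+ i) ∸ row ν (suc (d ℕ.+ i))))

        σ τ : ℕ → ℕ
        σ i = row ν (suc i) ∸ suc i
        τ j = row μ (suc j) ∸ suc j

        lowerRight : ℕ → ℕ → Carrier
        lowerRight i j = transition (d ℕ.+ i) (d ℕ.+ j)

      -- Numbering from 1, the sign in entry (i , j) is a factor of parity νᵢ - i from the row times
      -- one of parity μⱼ - j from the column. Pairing row i with column i leaves νᵢ - μᵢ, and these
      -- differences add up to the number of boxes.
      transition-upper : det< d transition ≈ (- 1#) ^ boxes d ν μ * det< d E′
      transition-upper = begin
        det< d transition
          ≈⟨ det<-cong d entry ⟩
        det< d (λ i j → sign (σ i) * sign (τ j) * E′ i j)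
          ≈⟨ det<-scale d (λ i → sign (σ i)) (λ j → sign (τ j)) E′ ⟩
        Π d (λ i → sign (σ i)) * Π d (λ j → sign (τ j)) * det< d E′
          ≈⟨ *-congʳ (Π-sign d σ τ ρ λ i i<d → sign-∸ (suc i) (<diagonal⇒<row μ i<d) (μ⊆ν (suc i))) ⟩
        sign (sumℕ (applyUpTo ρ d)) * det< d E′
          ≡⟨ ≡.cong (λ xs → sign (sumℕ xs) * det< d E′) (map-applyUpTo (λ i → i) ρ d) ⟨
        sign (boxes d ν μ) * det< d E′ ∎
        where
        ρ : ℕ → ℕ
        ρ i = row ν (suc i) ∸ row μ (suc i)
        entry : ∀ i j → i < d → j < d → transition i j ≈ sign (σ i) * sign (τ j) * E′ i j
        entry i j i<d j<d = begin
          transition i j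
            ≡⟨ M-upper (μ-upper j<d) (ν-upper i<d) ⟩
          sign ((bead n ν i ∸ n) ℕ.+ (bead n μ j ∸ n)) * e (bead n ν i ⊖ bead n μ j) (a₀⋯ (bead n ν i ∸ n))
            ≡⟨ ≡.cong₂ (λ p q → sign (p ℕ.+ q) * e (bead n ν i ⊖ bead n μ j) (a₀⋯ p))
                (bead∸n i<n ν) (bead∸n j<n μ) ⟩
          sign (σ i ℕ.+ τ j) * e (bead n ν i ⊖ bead n μ j) (a₀⋯ (σ i))
            ≈⟨ *-cong (sign-+ (σ i) (τ j))
                (reflexive (≡.cong (λ z → e z (a₀⋯ (σ i))) (bead-degree i<n j<n μ ν))) ⟩
          sign (σ i) * sign (τ j) * E′ i j ∎
          where
          i<n = ℕₚ.<-≤-trans i<d d≤n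
          j<n = ℕₚ.<-≤-trans j<d d≤n

      -- Past `len ν` the rows of both partitions are empty and their beads coincide, so the matrix
      -- is unitriangular there. This reduces the size n - d to the size `len ν ∸ d` of `H`.
      transition-lower : det< (n ∸ d) lowerRight ≈ det< (len ν ∸ d) H′
      transition-lower = begin
        det< (n ∸ d) lowerRight
          ≡⟨ ≡.cong (λ m → det< m lowerRight) n∸d ⟩
        det< (l ℕ.+ (n ∸ len ν)) lowerRight
          ≈⟨ det<-blockTriangular l (n ∸ len ν) lowerRight (λ i j l≤i i< j<l →
               zeros (≡.subst (i <_) (≡.sym n∸d) i<) l≤i (ℕₚ.<-≤-trans j<l l≤i)) ⟩
        det< l lowerRight * det< (n ∸ len ν) (λ i j → lowerRight (l ℕ.+ i) (l ℕ.+ j))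
          ≈⟨ *-cong (det<-cong l λ i j i<l j<l → entry i j (<len i<l) (<len j<l))
                    (det<-unitriangular (n ∸ len ν) _
                      (λ i j i< j<i → zeros (inside i<) (ℕₚ.m≤m+n l i) (ℕₚ.+-monoʳ-< l j<i))
                      (λ i i< → ones (inside i<) (ℕₚ.m≤m+n l i))) ⟩
        det< l H′ * 1#
          ≈⟨ *-identityʳ _ ⟩
        det< l H′ ∎
        where
        l = len ν ∸ d
        n∸d : n ∸ d ≡ l ℕ.+ (n ∸ len ν)
        n∸d = ≡.trans (≡.cong (_∸ d) (≡.sym (ℕₚ.m∸n+n≡m len≤n)))
          (≡.trans (ℕₚ.+-∸-assoc (n ∸ len ν) d≤len) (ℕₚ.+-comm (n ∸ len ν) l))
        below : ∀ {i} → i < n ∸ d → d ℕ.+ i < n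
        below {i} i< = ≡.subst (d ℕ.+ i <_) (ℕₚ.m+[n∸m]≡n d≤n) (ℕₚ.+-monoʳ-< d i<)
        <len : ∀ {i} → i < l → d ℕ.+ i < n
        <len {i} i<l = below (ℕₚ.<-≤-trans i<l (≡.subst (l ≤_) (≡.sym n∸d) (ℕₚ.m≤m+n l _)))
        inside : ∀ {i} → i < n ∸ len ν → l ℕ.+ i < n ∸ d
        inside {i} i< = ≡.subst (l ℕ.+ i <_) (≡.sym n∸d) (ℕₚ.+-monoʳ-< l i<)
        empty : ∀ {i} → l ≤ i → len ν ≤ d ℕ.+ i
        empty l≤i = ≡.subst (_≤ d ℕ.+ _) (ℕₚ.m+[n∸m]≡n d≤len) (ℕₚ.+-monoʳ-≤ d l≤i)
        bead-empty : ∀ {i} κ → len κ ≤ i → bead n κ i ≡ n ∸ suc i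
        bead-empty κ p = ≡.cong (ℕ._+ _) (row-≥len κ p)
        zeros : ∀ {i j} → i < n ∸ d → l ≤ i → j < i → lowerRight i j ≈ 0#
        zeros {i} {j} i< l≤i j<i = M-< (≡.subst (_< bead n μ (d ℕ.+ j)) (≡.sym (bead-empty ν (empty l≤i)))
          (ℕₚ.<-≤-trans (ℕₚ.∸-monoʳ-< (s≤s (ℕₚ.+-monoʳ-< d j<i)) (below i<)) (ℕₚ.m≤n+m _ _)))
        ones : ∀ {i} → i < n ∸ d → l ≤ i → lowerRight i i ≈ 1#
        ones {i} i< l≤i = begin
          M (bead n μ (d ℕ.+ i)) (bead n ν (d ℕ.+ i))
            ≡⟨ ≡.cong₂ M (bead-empty μ (ℕₚ.≤-trans (⊆⇒len≤ {μ} {ν} μ⊆ν) (empty l≤i)))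
                (bead-empty ν (empty l≤i)) ⟩
          M b b
            ≡⟨ M-lower (ℕₚ.∸-monoʳ-< {n} (s≤s z≤n) (below i<)) ⟩
          h (b ⊖ b) (a₁⋯ (n ∸ b))
            ≈⟨ h-≡ b _ ⟩
          1# ∎
          where b = n ∸ suc (d ℕ.+ i)
        entry : ∀ i j → d ℕ.+ i < n → d ℕ.+ j < n → lowerRight i j ≈ H′ i j
        entry i j i<n j<n = begin
          M (bead n μ (d ℕ.+ j)) (bead n ν (d ℕ.+ i))
            ≡⟨ M-lower (ν-lower i<n (ℕₚ.m≤m+n d i)) ⟩
          h (bead n ν (d ℕ.+ i) ⊖ bead n μ (d ℕ.+ j)) (a₁⋯ (n ∸ bead n ν (d ℕ.+ i)))
            ≡⟨ ≡.cong₂ (λ z k → h z (a₁⋯ k)) (bead-degree i<n j<n μ ν) (n∸bead i<n ν) ⟩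
          H′ i j ∎

      transition-expansionCoeff : det< n transition ≈ expansionCoeff μ ν
      transition-expansionCoeff = begin
        det< n transition
          ≡⟨ ≡.cong (λ m → det< m transition) (ℕₚ.m+[n∸m]≡n d≤n) ⟨
        det< (d ℕ.+ (n ∸ d)) transition
          -- In the lower left block the bead of ν is below n and that of μ is not.
          ≈⟨ det<-blockTriangular d (n ∸ d) transition (λ i j d≤i i< j<d →
               M-< (ℕₚ.<-≤-trans (ν-lower (≡.subst (i <_) (ℕₚ.m+[n∸m]≡n d≤n) i<) d≤i) (μ-upper j<d))) ⟩
        det< d transition * det< (n ∸ d) lowerRight
          ≈⟨ *-cong transition-upper transition-lower ⟩
        (- 1#) ^ boxes d ν μ * det< d E′ * det< (len ν ∸ d) H′ ∎

module FilteredSums (R : CommutativeRing c ℓ) where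

  open CommutativeRing R hiding (zero)
  open Sums R

  ∑ᴸ-filter : ∀ {P : I → Set} (P? : Decidable P) {f g : I → Carrier} {xs} →
    All (λ y → (P y → f y ≈ g y) × (¬ P y → g y ≈ 0#)) xs → ∑ᴸ f (filter P? xs) ≈ ∑ᴸ g xs
  ∑ᴸ-filter P? {xs = []}     []             = refl
  ∑ᴸ-filter P? {xs = y ∷ xs} ((p , q) ∷ ps) with P? y
  ... | yes Py = +-cong (p Py) (∑ᴸ-filter P? ps)
  ... | no ¬Py = trans (∑ᴸ-filter P? ps) (trans (sym (+-identityˡ _)) (+-congʳ (sym (q ¬Py))))

-- `shape` is not injective on arbitrary vectors; a left inverse on the members of the list is
-- enough.
unique-map : {J : Set ι′} (f : I → J) (g : J → I) {xs : List I} →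
             All (λ y → g (f y) ≡ y) xs → Unique xs → Unique (map f xs)
unique-map f g inverse unique =
  Uniqueₚ.map⁻ {f = g} (≡.subst Unique (≡.sym (map-inverse inverse)) unique)
  where
  map-inverse : ∀ {xs} → All (λ y → g (f y) ≡ y) xs → map g (map f xs) ≡ xs
  map-inverse []       = ≡.refl
  map-inverse (p ∷ ps) = ≡.cong₂ _∷_ p (map-inverse ps)

-- Only the rows of μ need testing. On failure the offending row is returned, since it is the corner
-- of the zero block in `transition-notAbove`.
⊆-or-exceeds : ∀ μ ν → μ ⊆ ν ⊎ ∃ λ i → i < len μ × row ν (suc i) < row μ (suc i)
⊆-or-exceeds μ ν with ℕₚ.anyUpTo? (λ i → row ν (suc i) ℕₚ.<? row μ (suc i)) (len μ)
... | yes p = inj₂ p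
... | no ¬p = inj₁ λ { zero → z≤n ; (suc i) → ℕₚ.≮⇒≥ λ νᵢ<μᵢ →
  ¬p (i , row>0⇒<len μ (ℕₚ.≤-<-trans z≤n νᵢ<μᵢ) , νᵢ<μᵢ) }

_⊆?_ : ∀ μ ν → Dec (μ ⊆ ν)
μ ⊆? ν with ⊆-or-exceeds μ ν
... | inj₁ μ⊆ν            = yes μ⊆ν
... | inj₂ (i , _ , νᵢ<μᵢ) = no λ μ⊆ν → ℕₚ.<⇒≱ νᵢ<μᵢ (μ⊆ν (suc i))

-- Coefficients of the quotients by Δ and the expansion of a Schur function

module Quotients (R : CommutativeRing c ℓ) (a : ℤ → CommutativeRing.Carrier R) (n : ℕ) where

  open SeriesOps R
  open DualSchur R a
  open CommutativeRing R using (_≈_; 0#; reflexive; trans; *-congˡ; zeroʳ)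
  open RingOps (Series R n) using (det)
  private
    module S = CommutativeRing (Series R n)

  overΔ-≤ : ∀ ν N → len ν ≤ n → overΔ ν n N ≡ divideΔ n (det N)
  overΔ-≤ ν N len≤n rewrite dec-true (len ν ℕₚ.≤? n) len≤n = ≡.refl

  overΔ-> : ∀ ν N → n < len ν → overΔ ν n N ≡ S.0#
  overΔ-> ν N n<len rewrite dec-false (len ν ℕₚ.≤? n) (ℕₚ.<⇒≱ n<len) = ≡.refl

  coeff-overΔ-> : ∀ {ν} N α → n < len ν → coeff {n} (overΔ ν n N) α ≈ 0#
  coeff-overΔ-> {ν} N α n<len = trans (reflexive (≡.cong (λ F → coeff {n} F α) (overΔ-> ν N n<len)))
      (coeff-0 {n} α)

  summand-overlong : ∀ r ν α → n < len ν → coeff {n} (C n r S.* ŝ ν n) α ≈ 0#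
  summand-overlong r ν α n<len = trans (Truncation.coeff-C* R n r (ŝ ν n) α)
    (trans (*-congˡ (coeff-overΔ-> {ν} (A ν n) α n<len)) (zeroʳ r))

module Expansion (R : CommutativeRing c ℓ) (a : ℤ → CommutativeRing.Carrier R)
                 (μ : Partition) (n : ℕ) (len≤n : len μ ≤ n) (α : Vec ℕ n) where

  open SeriesOps R
  open DualSchur R a
  open Truncation R
  open Transition R a n
  open Quotients R a n
  open Sums R
  open FilteredSums R
  open BlockDeterminants R using (det<)
  private
    module R = Symmetric R
    module S = CommutativeRing (Series R n)
  open RingOps (Series R n) using (_^_; Πᴸ; det; Σᴸ)

  βs : List (Vec ℕ n)
  βs = proj₁ (coeff-quot (pairs n) α)

  -- `D` bounds all exponents that the coefficient at α depends on. Below `B` lie n beads with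
  -- polynomial columns and `suc D` further ones, and x ^ `B` vanishes in the truncated ring: the
  -- case t = n, P = `suc D` of `upperExpansion`.
  D B : ℕ
  D = proj₁ (bound βs)
  B = n ℕ.+ suc D

  module T where
    open CommutativeRing (Truncated n D) hiding (zero) public
    open Sums (Truncated n D) public
    open Determinants (Truncated n D) public
    open RingOps (Truncated n D) public
  open Expansions R (Truncated n D) {C n} (C-isRingHomomorphism n D)
  open import Algebra.Properties.Semiring.Exp T.semiring using (^-homo-*)

  φ : ⟦ n ⟧ → R.Carrier
  φ F = ∑ᴸ (coeff {n} F) βs

  φ-divideΔ : ∀ F → coeff {n} (divideΔ n F) α R.≈ φ F
  φ-divideΔ = proj₂ (coeff-quot (pairs n) α)

  -- By the choice of `D`, the functional reads only coefficients that survive truncation; it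
  -- replaces the division from here on.
  φ-cong : ∀ {F G} → F T.≈ G → φ F R.≈ φ G
  φ-cong {F} {G} F≈G = ∑ᴸ-cong-All (All.map (λ {β} → F≈G β) (proj₂ (bound βs)))

  φ-0 : φ S.0# R.≈ R.0#
  φ-0 = ∑ᴸ-zero (λ β → coeff-0 {n} β) βs

  φ-∑ᴸ : ∀ {I : Set} (f : I → ⟦ n ⟧) xs → φ (Σᴸ (map f xs)) R.≈ ∑ᴸ (λ y → φ (f y)) xs
  φ-∑ᴸ f xs = R.trans (∑ᴸ-cong (coeff-∑ᴸ {n = n} f xs) βs) (∑ᴸ-comm (λ β y → coeff {n} (f y) β) βs xs)

  φ-C* : ∀ r F → φ (C n r S.* F) R.≈ r R.* φ F
  φ-C* r F = R.trans (∑ᴸ-cong (coeff-C* n r F) βs) (R.sym (∑ᴸ-*ˡ r (coeff {n} F) βs))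

  -- The column of A with bead l; see w-A.
  w : Fin n → ℕ → ⟦ n ⟧
  w i l = if does (n ℕₚ.≤? l)
          then x i ^ l S.* Πᴸ (map (λ r → geometric r i) (a₀⋯ (suc (l ∸ n))))
          else x i ^ l S.* Πᴸ (map (λ r → S.1# S.- C n r S.* x i) (a₁⋯ (n ∸ suc l)))

  w-upper : ∀ i {l} → n ≤ l → w i l ≡ x i ^ l S.* Πᴸ (map (λ r → geometric r i) (a₀⋯ (suc (l ∸ n))))
  w-upper i {l} n≤l rewrite dec-true (n ℕₚ.≤? l) n≤l = ≡.refl

  w-lower : ∀ i {l} → l < n → w i l ≡ x i ^ l S.* Πᴸ (map (λ r → S.1# S.- C n r S.* x i) (a₁⋯ (n ∸ suc l)))
  w-lower i {l} l<n rewrite dec-false (n ℕₚ.≤? l) (ℕₚ.<⇒≱ l<n) = ≡.refl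

  w-A : ∀ ν i j → w i (bead n ν (toℕ j)) ≡ A ν n i j
  w-A ν i j = go (ℕₚ.≤-<-connex (suc (toℕ j)) (diagonal ν))
    where
    row-j = row ν (suc (toℕ j))
    go : suc (toℕ j) ≤ diagonal ν ⊎ diagonal ν < suc (toℕ j) → w i (bead n ν (toℕ j)) ≡ A ν n i j
    go (inj₁ j<d) rewrite dec-true (suc (toℕ j) ℕₚ.≤? diagonal ν) j<d =
      ≡.trans (w-upper i (row>⇒bead≥ (toℕ<n j) ν j<row))
        (≡.cong (λ m → x i ^ bead n ν (toℕ j) S.* Πᴸ (map (λ r → geometric r i) (a₀⋯ m)))
          (≡.trans (≡.cong suc (bead∸n (toℕ<n j) ν)) (≡.sym (ℕₚ.+-∸-assoc 1 j<row))))
      where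
      j<row : toℕ j < row-j
      j<row = <diagonal⇒<row ν j<d
    go (inj₂ d≤j) rewrite dec-false (suc (toℕ j) ℕₚ.≤? diagonal ν) (ℕₚ.<⇒≱ d≤j) =
      ≡.trans (w-lower i (row≤⇒bead< (toℕ<n j) ν (≥diagonal⇒≥row ν (ℕₚ.≤-pred d≤j))))
        (≡.cong (λ m → x i ^ bead n ν (toℕ j) S.* Πᴸ (map (λ r → S.1# S.- C n r S.* x i) (a₁⋯ m)))
          (n∸1+bead (toℕ<n j) ν))

  -- The equality of the ring is an implicit argument of _^_, so that powers with
  -- a variable exponent are not definitionally equal in the two rings.
  ^-truncated : ∀ y k → y ^ k ≡ y T.^ k
  ^-truncated y zero    = ≡.refl
  ^-truncated y (suc k) = ≡.cong (y S.*_) (^-truncated y k)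

  det-truncated : ∀ {m} (N : Fin m → Fin m → ⟦ n ⟧) → det N T.≈ T.det N
  det-truncated {zero}  N = T.refl
  det-truncated {suc m} N = sum-cong-≋ {suc m} λ j → T.*-cong
    (T.*-congʳ {N zero j} (T.reflexive (^-truncated (S.- S.1#) (toℕ j))))
    (det-truncated λ i k → N (suc i) (punchIn j k))
    where open import Algebra.Properties.Semiring.Sum T.semiring using (sum-cong-≋)

  -- The sum is cut at n. For k ≥ n the lower part vanishes because l < k, for k < n the upper part
  -- does by `M-mixed`; the other part is `upperExpansion` or `lowerExpansion`.
  x^-expansion : ∀ i k → x i ^ k T.≈ T.∑ B λ l → w i l T.* C n (M k l)
  x^-expansion i k = T.sym (begin
    T.∑ B (λ l → w i l T.* C n (M k l))
      ≈⟨ T.∑-++ n (suc D) _ ⟩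
    T.∑ n (λ l → w i l T.* C n (M k l)) T.+ T.∑ (suc D) (λ p → w i (n ℕ.+ p) T.* C n (M k (n ℕ.+ p)))
      ≈⟨ go (ℕₚ.≤-<-connex n k) ⟩
    x i T.^ k
      ≡⟨ ^-truncated (x i) k ⟨
    x i ^ k ∎)
    where
    open import Relation.Binary.Reasoning.Setoid T.setoid
    T-power : ∀ {F} l {G} → F ≡ x i ^ l S.* G → F ≡ x i T.^ l T.* G
    T-power l {G} p = ≡.trans p (≡.cong (S._* G) (^-truncated (x i) l))
    C-zero : ∀ {r F} → r R.≈ R.0# → F T.* C n r T.≈ T.0#
    C-zero r≈0 = T.trans (T.*-congˡ (T.trans (agree-weaken n D (S.trans (C-cong n r≈0) (C-0 n))) T.refl))
        (T.zeroʳ _)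
    go : _ → T.∑ n (λ l → w i l T.* C n (M k l)) T.+
             T.∑ (suc D) (λ p → w i (n ℕ.+ p) T.* C n (M k (n ℕ.+ p))) T.≈ x i T.^ k
    go (inj₁ n≤k) = begin
      T.∑ n (λ l → w i l T.* C n (M k l)) T.+ T.∑ (suc D) (λ p → w i (n ℕ.+ p) T.* C n (M k (n ℕ.+ p)))
        ≈⟨ T.+-cong (T.∑-zeros n λ l l<n → C-zero (M-< (ℕₚ.<-≤-trans l<n n≤k)))
            (T.∑-cong (suc D) λ p _ → upper p) ⟩
      T.0# T.+ T.∑ (suc D) (λ p → x i T.^ n T.* upperTerm′ p)
        ≈⟨ T.trans (T.+-identityˡ _) (T.sym (T.∑-*ˡ (suc D) _ _)) ⟩
      x i T.^ n T.* T.∑ (suc D) upperTerm′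
        ≈⟨ upperExpansion (x i) (λ r → geometric r i) inverse (suc D) n (λ m → a (ℤ.- (+ m))) (k ∸ n)
             (T.trans (T.reflexive (≡.sym (^-truncated (x i) (n ℕ.+ suc D))))
                 (x^-zero i (n ℕ.+ suc D) (ℕₚ.m≤n+m (suc D) n))) ⟩
      x i T.^ n T.* x i T.^ (k ∸ n)
        ≈⟨ ^-homo-* (x i) n (k ∸ n) ⟨
      x i T.^ (n ℕ.+ (k ∸ n))
        ≡⟨ ≡.cong (x i T.^_) (ℕₚ.m+[n∸m]≡n n≤k) ⟩
      x i T.^ k ∎
      where
      inverse : ∀ r → (T.1# T.- C n r T.* x i) T.* geometric r i T.≈ T.1#
      inverse r = agree-weaken n D (geometric-correct r i)
      upperTerm′ : ℕ → ⟦ n ⟧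
      upperTerm′ = upperTerm (x i) (λ r → geometric r i) inverse (λ m → a (ℤ.- (+ m))) (k ∸ n)
      upper : ∀ p → w i (n ℕ.+ p) T.* C n (M k (n ℕ.+ p)) T.≈ x i T.^ n T.* upperTerm′ p
      upper p = begin
        w i (n ℕ.+ p) T.* C n (M k (n ℕ.+ p))
          ≡⟨ ≡.cong₂ (λ F r → F T.* C n r) (T-power (n ℕ.+ p) (w-upper i (ℕₚ.m≤m+n n p)))
              (≡.trans (M-upper n≤k (ℕₚ.m≤m+n n p)) same) ⟩
        x i T.^ (n ℕ.+ p) T.* G (suc ((n ℕ.+ p) ∸ n)) T.* C n r
          ≈⟨ T.*-congʳ (T.*-cong (^-homo-* (x i) n p)
              (T.reflexive (≡.cong (λ m → G (suc m)) (ℕₚ.m+n∸m≡n n p)))) ⟩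
        x i T.^ n T.* x i T.^ p T.* G (suc p) T.* C n r
          ≈⟨ T.trans (T.*-congʳ (T.*-assoc _ _ _)) (T.trans (T.*-assoc _ _ _) (T.*-congˡ (T.*-comm _ _))) ⟩
        x i T.^ n T.* (C n r T.* (x i T.^ p T.* G (suc p))) ∎
        where
        G : ℕ → ⟦ n ⟧
        G m = Πᴸ (map (λ r → geometric r i) (a₀⋯ m))
        r : R.Carrier
        r = (R.- R.1#) R.^ (p ℕ.+ (k ∸ n)) R.* R.e (p ⊖ (k ∸ n)) (a₀⋯ p)
        same : (R.- R.1#) R.^ (((n ℕ.+ p) ∸ n) ℕ.+ (k ∸ n)) R.* R.e ((n ℕ.+ p) ⊖ k) (a₀⋯ ((n ℕ.+ p) ∸ n)) ≡ r
        same = ≡.cong₂ (λ m z → (R.- R.1#) R.^ (m ℕ.+ (k ∸ n)) R.* R.e z (a₀⋯ m)) (ℕₚ.m+n∸m≡n n p)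
          (≡.trans (≡.cong ((n ℕ.+ p) ⊖_) (≡.sym (ℕₚ.m+[n∸m]≡n n≤k))) (+-cancelˡ-⊖ n p (k ∸ n)))
    go (inj₂ k<n) = begin
      T.∑ n (λ l → w i l T.* C n (M k l)) T.+ T.∑ (suc D) (λ p → w i (n ℕ.+ p) T.* C n (M k (n ℕ.+ p)))
        ≈⟨ T.+-cong (T.∑-cong n λ l l<n → T.trans
                       (T.reflexive (≡.cong₂ (λ F r → F T.* C n r) (T-power l (w-lower i l<n)) (M-lower l<n)))
                           (T.*-comm _ _))
                    (T.∑-zeros (suc D) λ p _ → C-zero (R.reflexive (M-mixed k<n (ℕₚ.m≤m+n n p)))) ⟩
      T.∑ n (lowerTerm (x i) (λ m → a (+ suc m)) n k) T.+ T.0#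
        ≈⟨ T.+-identityʳ _ ⟩
      T.∑ n (lowerTerm (x i) (λ m → a (+ suc m)) n k)
        ≈⟨ lowerExpansion (x i) n (λ m → a (+ suc m)) k<n ⟩
      x i T.^ k ∎

  Index : Partition → Set
  Index ν = μ ⊆ ν × diagonal ν ≡ diagonal μ

  index? : Decidable Index
  index? ν = (μ ⊆? ν) ×-dec (diagonal ν ℕₚ.≟ diagonal μ)

  -- `reduced` is what Cauchy-Binet yields for every partition with at most n rows. Among these it
  -- equals `summand` on `Index` and is zero elsewhere.
  summand reduced : Partition → R.Carrier
  summand ν = coeff {n} (C n (expansionCoeff μ ν) S.* ŝ ν n) α
  reduced ν = det< n (transition μ ν) R.* φ (det λ i j → w i (bead n ν (toℕ j)))

  summand-φ : ∀ ν → len ν ≤ n → summand ν R.≈ expansionCoeff μ ν R.* φ (det (A ν n))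
  summand-φ ν lν≤n = R.trans (coeff-C* n _ (ŝ ν n) α) (R.*-congˡ (R.trans
    (R.reflexive (≡.cong (λ F → coeff {n} F α) (overΔ-≤ ν (A ν n) lν≤n))) (φ-divideΔ (det (A ν n)))))

  summand-reduced : ∀ ν → len ν ≤ n → Index ν → summand ν R.≈ reduced ν
  summand-reduced ν lν≤n (μ⊆ν , dν≡dμ) = R.trans (summand-φ ν lν≤n) (R.*-cong
    (R.sym (transition-expansionCoeff μ ν μ⊆ν dν≡dμ lν≤n))
    (φ-cong (agree-weaken n D (Determinants.det-cong (Series R n) λ i j → S.reflexive (≡.sym (w-A ν i j))))))

  reduced-zero : ∀ ν → len ν ≤ n → ¬ Index ν → reduced ν R.≈ R.0#
  reduced-zero ν lν≤n ¬index = R.trans (R.*-congʳ vanishing) (R.zeroˡ _)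
    where
    vanishing : det< n (transition μ ν) R.≈ R.0#
    vanishing with ⊆-or-exceeds μ ν
    ... | inj₁ μ⊆ν               = transition-diagonal μ ν μ⊆ν lν≤n λ dν≡dμ → ¬index (μ⊆ν , dν≡dμ)
    ... | inj₂ (i , i<len , νᵢ<μᵢ) = transition-notAbove μ ν (ℕₚ.<-≤-trans i<len len≤n) νᵢ<μᵢ

  Contributing : Partition → Set
  Contributing ν = len ν ≤ n × row ν 1 ℕ.+ (n ∸ 1) < B

  contributing? : Decidable Contributing
  contributing? ν = (len ν ℕₚ.≤? n) ×-dec (row ν 1 ℕ.+ (n ∸ 1) ℕₚ.<? B)

  -- The first column is divisible by a power of the variables with exponent at least `B`, which
  -- exceeds `D`. As n is a module parameter, its positivity is passed as an equation.
  A-highDegree : ∀ ν {m} → n ≡ suc m → B ≤ row ν 1 ℕ.+ (n ∸ 1) → det (A ν n) T.≈ T.0#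
  A-highDegree ν n≡1+m B≤ = T.trans (det-truncated (A ν n)) (go n≡1+m (A ν n) λ i j j≡0 → T.trans
    (T.*-congʳ (T.trans (T.reflexive (≡.cong (λ k → x i ^ (row ν (suc k) ℕ.+ (n ∸ suc k))) j≡0))
      (x^-zero i _ (ℕₚ.≤-trans (ℕₚ.m≤n+m (suc D) n) B≤)))) (T.zeroˡ _))
    where
    go : ∀ {k m} → k ≡ suc m → (N : Fin k → Fin k → ⟦ n ⟧) →
        (∀ i j → toℕ j ≡ 0 → N i j T.≈ T.0#) → T.det N T.≈ T.0#
    go ≡.refl N p = T.det-zeroColumn N λ i → p i zero ≡.refl

  summand-zero : ∀ ν → ¬ Contributing ν → summand ν R.≈ R.0#
  summand-zero ν ¬contributing with ℕₚ.≤-<-connex (len ν) n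
  ... | inj₂ n<lν = summand-overlong _ ν α n<lν
  ... | inj₁ lν≤n = R.trans (summand-φ ν lν≤n) (R.trans (R.*-congˡ
    (R.trans (φ-cong (A-highDegree ν n≡1+m B≤)) φ-0)) (R.zeroʳ _))
    where
    B≤ : B ≤ row ν 1 ℕ.+ (n ∸ 1)
    B≤ = ℕₚ.≮⇒≥ λ p → ¬contributing (lν≤n , p)
    -- There must be a first column. For k = 0 the partition is empty and the truncated k ∸ 1 is 0,
    -- so the assumption would read `suc D` ≤ 0.
    positive-n : ∀ k → len ν ≤ k → k ℕ.+ suc D ≤ row ν 1 ℕ.+ (k ∸ 1) → k ≡ suc (k ∸ 1)
    positive-n zero    lν≤0 p with () ← ≡.subst (λ r → suc D ≤ r ℕ.+ 0) (row-≥len ν lν≤0) p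
    positive-n (suc k) _    _ = ≡.refl
    n≡1+m : n ≡ suc (n ∸ 1)
    n≡1+m = positive-n n lν≤n B≤

  lookup-decreasing : ∀ {B} (L : Vec ℕ n) → Decreasing B L → ∀ i → lookup L i ≡ bead n (shape L) (toℕ i)
  lookup-decreasing L dec i = ≡.trans (≡.cong (λ L → lookup L i) (≡.sym (beads-shape L dec)))
    (lookup-beads n (shape L) i)

  s-expansion : coeff {n} (s μ n) α R.≈ ∑ᴸ reduced (map shape (decreasing B n))
  s-expansion = begin
    coeff {n} (s μ n) α
      ≡⟨ ≡.cong (λ F → coeff {n} F α) (overΔ-≤ μ powers len≤n) ⟩
    coeff {n} (divideΔ n (det powers)) α
      ≈⟨ φ-divideΔ (det powers) ⟩
    φ (det powers)
      -- Under φ the powers may be replaced by their truncated, hence finite, expansions in the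
      -- columns.
      ≈⟨ φ-cong (T.trans (det-truncated powers) (T.trans
           (T.det-cong λ i j → x^-expansion i (bead n μ (toℕ j)))
           (T.cauchyBinet n B w λ l j → C n (M (bead n μ (toℕ j)) l)))) ⟩
    φ (T.∑ᴸ term (decreasing B n))
      ≈⟨ φ-∑ᴸ term (decreasing B n) ⟩
    ∑ᴸ (λ L → φ (term L)) (decreasing B n)
      ≈⟨ ∑ᴸ-cong-All (All.map (λ {L} → term-reduced L) (decreasing-sound B n)) ⟩
    ∑ᴸ (λ L → reduced (shape L)) (decreasing B n)
      ≡⟨ ∑ᴸ-map reduced shape (decreasing B n) ⟨
    ∑ᴸ reduced (map shape (decreasing B n)) ∎
    where
    open import Relation.Binary.Reasoning.Setoid R.setoid
    powers : Fin n → Fin n → ⟦ n ⟧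
    powers i j = x i ^ bead n μ (toℕ j)
    term : Vec ℕ n → ⟦ n ⟧
    term L = T.det (λ i j → w i (lookup L j)) S.* T.det (λ i j → C n (M (bead n μ (toℕ j)) (lookup L i)))
    term-reduced : ∀ L → Decreasing B L → φ (term L) R.≈ reduced (shape L)
    term-reduced L dec = R.trans (φ-cong (T.trans (T.*-comm _ _) (T.*-cong
      (T.trans (T.det-cong λ i j → T.reflexive (≡.cong (λ l → C n (M (bead n μ (toℕ j)) l))
          (lookup-decreasing L dec i)))
               (T.sym (C-det {n} λ i j → transition μ (shape L) (toℕ i) (toℕ j))))
      (T.trans (T.det-cong λ i j → T.reflexive (≡.cong (w i) (lookup-decreasing L dec j)))
               (T.sym (det-truncated λ i j → w i (bead n (shape L) (toℕ j))))))))
      (φ-C* (det< n (transition μ (shape L))) _)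

  shapes : List Partition
  shapes = map shape (decreasing B n)

  shapes-len : All (λ ν → len ν ≤ n) shapes
  shapes-len = Allₚ.map⁺ (All.universal len-shape (decreasing B n))

  shapes-unique : Unique shapes
  shapes-unique = unique-map shape (beads n)
      (All.map (λ {L} → beads-shape L) (decreasing-sound B n))
      (decreasing-unique B n)

  shapes-contributing : All Contributing shapes
  shapes-contributing = Allₚ.map⁺
      (All.map (λ {L} dec → len-shape L ,
      strict {n} (shape-bound L dec)
      λ n≡0 → row-≥len (shape L) (≡.subst (len (shape L) ≤_) n≡0 (len-shape L))) (decreasing-sound B n))
    where
    -- `shape-bound` bounds row + n, whereas the largest bead is row + n - 1. For n = 0 the
    -- truncated subtraction spoils this, and the emptiness of the row is used instead.
    strict : ∀ {k r} → r ℕ.+ k ≤ k ℕ.+ suc D → (k ≡ 0 → r ≡ 0) → r ℕ.+ (k ∸ 1) < k ℕ.+ suc D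
    strict {zero}      _ r≡0 rewrite r≡0 ≡.refl = s≤s z≤n
    strict {suc k} {r} p _   = ≡.subst (_≤ suc k ℕ.+ suc D) (ℕₚ.+-suc r k) p

  contributing∈shapes : ∀ {ν} → Contributing ν → ν ∈ shapes
  contributing∈shapes {ν} (lν≤n , p) = ≡.subst (_∈ shapes) (shape-beads n ν lν≤n)
    (∈-map⁺ shape (decreasing-complete B (beads n ν) (beads-decreasing n ν p)))

  -- The initial list required by `IsSum`: the indices with at most n rows and all beads below `B`.
  relevant : List Partition
  relevant = filter index? shapes

  -- Discarding the partitions with zero summand leaves a list without repetitions that has the same
  -- members as `relevant`, hence a permutation of it. Enlarging `relevant` to all shapes then adds
  -- only vanishing determinants.
  expansion : ∀ is → All Index is → Unique is → (∀ {ν} → ν ∈ relevant → ν ∈ is) →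
    ∑ᴸ summand is R.≈ coeff {n} (s μ n) α
  expansion is indices unique relevant⊆is = begin
    ∑ᴸ summand is
      ≈⟨ ∑ᴸ-filter contributing? (All.universal (λ ν → (λ _ → R.refl) , summand-zero ν) is) ⟨
    ∑ᴸ summand (filter contributing? is)
      ≈⟨ ∑ᴸ-↭ summand same ⟩
    ∑ᴸ summand relevant
      ≈⟨ ∑ᴸ-filter index? (All.map (λ {ν} lν≤n → summand-reduced ν lν≤n , reduced-zero ν lν≤n) shapes-len) ⟩
    ∑ᴸ reduced shapes
      ≈⟨ s-expansion ⟨
    coeff {n} (s μ n) α ∎
    where
    open import Relation.Binary.Reasoning.Setoid R.setoid
    to : ∀ {ν} → ν ∈ filter contributing? is → ν ∈ relevant
    to p with ν∈is , q ← ∈-filter⁻ contributing? {xs = is} p =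
      ∈-filter⁺ index? (contributing∈shapes q) (All.lookup indices ν∈is)
    from : ∀ {ν} → ν ∈ relevant → ν ∈ filter contributing? is
    from p = ∈-filter⁺ contributing? (relevant⊆is p)
      (All.lookup shapes-contributing (proj₁ (∈-filter⁻ index? {xs = shapes} p)))
    same : filter contributing? is ↭ relevant
    same = ∼bag⇒↭ (unique∧set⇒bag
        (Uniqueₚ.filter⁺ contributing? unique)
        (Uniqueₚ.filter⁺ index? shapes-unique) (mk⇔ to from))

proposition3p19 : (μ : Partition) (n : ℕ) →
    let open SeriesOps ℚ[a] using (C)
        open DualSchur ℚ[a] 𝐚
        open CommutativeRing (Series ℚ[a] n) using (_*_)
    in IsSum (λ ν → μ ⊆ ν × diagonal ν ≡ diagonal μ) n
         (λ ν → C n (expansionCoeff μ ν) * ŝ ν n)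
         (s μ n)
proposition3p19 μ n α with ℕₚ.≤-<-connex (len μ) n
... | inj₁ len≤n = relevant , Allₚ.all-filter index? shapes , λ is indices unique relevant⊆is →
  expansion is indices unique relevant⊆is
  where open Expansion ℚ[a] 𝐚 μ n len≤n α
-- With fewer variables than rows of μ both sides vanish, since every ν containing μ has too many
-- rows as well; the empty list serves as witness.
... | inj₂ n<len = [] , [] , λ is indices _ _ → CommutativeRing.trans ℚ[a]
  (Sums.∑ᴸ-zeros ℚ[a] (All.map (λ {ν} (μ⊆ν , _) → summand-overlong (DualSchur.expansionCoeff ℚ[a] 𝐚 μ ν) ν α
    (ℕₚ.<-≤-trans n<len (⊆⇒len≤ {μ} {ν} μ⊆ν))) indices))
  (CommutativeRing.sym ℚ[a] (coeff-overΔ-> {μ} _ α n<len))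
  where open Quotients ℚ[a] 𝐚 n
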